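{- Every $(P_7,C_7,C_4,\text{gem})$-free graph $G$ (with at least one vertex) satisfies $\chi(G)\leq 2\omega(G)-1$.
   Context: All graphs are finite and simple. $P_\ell$ and $C_\ell$ denote the chordless path and chordless cycle on $\ell$ vertices. The gem is the graph consisting of a $P_4$ together with a vertex adjacent to all four vertices of the $P_4$. A graph is $(L_1,L_2,\ldots)$-free if it has no induced subgraph isomorphic to any $L_i$. $\chi(G)$ is the chromatic number and $\omega(G)$ the size of a largest clique of $G$. -}

module Defs where

open import Level using (0ℓ)
open import Data.Nat using (ℕ; zero; suc; _≤_; _≤?_; z≤n; s≤s)
import Data.Nat.Properties as ℕ
open import Data.Fin using (Fin; zero; suc; toℕ)
import Data.Fin.Properties as Fin
open import Data.Fin.Subset using (Subset; _∈_; ∣_∣) renaming (⊥ to ∅)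
open import Data.Fin.Subset.Properties using (_∈?_; anySubset?; ∉⊥; ∣⊥∣≡0; ∣p∣≤n)
open import Data.Vec using (Vec; []; _∷_; lookup; tabulate)
open import Data.Vec.Properties using (lookup∘tabulate)
open import Data.List using (List)
open import Data.List.Relation.Unary.All using (All)
open import Data.Product using (∃; Σ; _×_; _,_; proj₁)
open import Data.Sum using (_⊎_; inj₁; inj₂; swap)
open import Data.Unit using (⊤; tt)
open import Data.Empty using (⊥; ⊥-elim)
open import Function using (id; _∘_; _⇔_)
open import Function.Definitions using (Injective)
open import Relation.Binary.Core using (Rel)
import Relation.Binary.Definitions as B
import Relation.Unary as U
open import Relation.Binary.PropositionalEquality
  using (_≡_; _≢_; refl; sym; trans; cong; subst; subst₂)
open import Relation.Nullary using (¬_; Dec; yes; no)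
open import Relation.Nullary.Decidable using (True; toWitness; map′; ¬?; _×-dec_; _⊎-dec_; _→-dec_)

-- Finite simple graphs; the vertex set is taken to be Fin order.
record Graph : Set₁ where
  field
    order   : ℕ
    Adj     : Rel (Fin order) 0ℓ
    adj?    : B.Decidable Adj
    adj-sym : B.Symmetric Adj
    irrefl  : ∀ {v} → ¬ Adj v v

  Vertex : Set
  Vertex = Fin order

open Graph public

Consecutive : ∀ {ℓ} → Rel (Fin ℓ) 0ℓ
Consecutive i j = suc (toℕ i) ≡ toℕ j

P : ℕ → Graph
P ℓ .order = ℓ
P ℓ .Adj i j = Consecutive i j ⊎ Consecutive j i
P ℓ .adj? i j = (suc (toℕ i) ℕ.≟ toℕ j) ⊎-dec (suc (toℕ j) ℕ.≟ toℕ i)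
P ℓ .adj-sym = swap
P ℓ .irrefl (inj₁ e) = ℕ.1+n≢n e
P ℓ .irrefl (inj₂ e) = ℕ.1+n≢n e

FirstLast : ∀ {ℓ} → Rel (Fin ℓ) 0ℓ
FirstLast {ℓ} i j = toℕ i ≡ 0 × suc (toℕ j) ≡ ℓ

C : (ℓ : ℕ) {3≤ℓ : True (3 ≤? ℓ)} → Graph
C ℓ .order = ℓ
C ℓ .Adj i j = Adj (P ℓ) i j ⊎ (FirstLast i j ⊎ FirstLast j i)
C ℓ .adj? i j = adj? (P ℓ) i j ⊎-dec (firstLast? i j ⊎-dec firstLast? j i)
  where
  firstLast? : B.Decidable (FirstLast {ℓ})
  firstLast? i j = (toℕ i ℕ.≟ 0) ×-dec (suc (toℕ j) ℕ.≟ ℓ)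
C ℓ .adj-sym (inj₁ e) = inj₁ (adj-sym (P ℓ) e)
C ℓ .adj-sym (inj₂ e) = inj₂ (swap e)
C ℓ .irrefl (inj₁ e) = irrefl (P ℓ) e
C ℓ {3≤ℓ} .irrefl {v} (inj₂ e) = notBoth e
  where
  one : FirstLast v v → ℓ ≡ 1
  one (z , l) = trans (sym l) (cong suc z)
  absurd : ℓ ≢ 1
  absurd eq with subst (3 ≤_) eq (toWitness 3≤ℓ)
  ... | s≤s ()
  notBoth : ¬ (FirstLast v v ⊎ FirstLast v v)
  notBoth (inj₁ f) = absurd (one f)
  notBoth (inj₂ f) = absurd (one f)

-- In a cone, zero is the new vertex and suc v is the old vertex v.
ConeAdj : (G : Graph) → Rel (Fin (suc (order G))) 0ℓ
ConeAdj G zero    zero    = ⊥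
ConeAdj G zero    (suc _) = ⊤
ConeAdj G (suc _) zero    = ⊤
ConeAdj G (suc u) (suc v) = Adj G u v

cone : Graph → Graph
cone G .order = suc (order G)
cone G .Adj = ConeAdj G
cone G .adj? zero    zero    = no id
cone G .adj? zero    (suc _) = yes tt
cone G .adj? (suc _) zero    = yes tt
cone G .adj? (suc u) (suc v) = adj? G u v
cone G .adj-sym {zero}  {suc _} _ = tt
cone G .adj-sym {suc _} {zero}  _ = tt
cone G .adj-sym {suc _} {suc _} e = adj-sym G e
cone G .irrefl {suc _} e = irrefl G e

gem : Graph
gem = cone (P 4)

-- An isomorphism from H onto the subgraph of G induced on the image of f.
record _↪ᵢ_ (H G : Graph) : Set where
  field
    f         : Vertex H → Vertex G
    injective : Injective _≡_ _≡_ f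
    preserves : ∀ u v → Adj H u v ⇔ Adj G (f u) (f v)

_-Free_ : List Graph → Graph → Set₁
Ls -Free G = All (λ L → ¬ (L ↪ᵢ G)) Ls

Proper : (G : Graph) {k : ℕ} → (Vertex G → Fin k) → Set
Proper G c = ∀ u v → Adj G u v → c u ≢ c v

Colourable : Graph → ℕ → Set
Colourable G k = Σ (Vertex G → Fin k) (Proper G)

IsChromaticNumber : Graph → ℕ → Set
IsChromaticNumber G k = Colourable G k × (∀ m → Colourable G m → k ≤ m)

IsClique : (G : Graph) → Subset (order G) → Set
IsClique G S = ∀ u v → u ∈ S → v ∈ S → u ≢ v → Adj G u v

CliqueOfSize : Graph → ℕ → Set
CliqueOfSize G k = ∃ λ S → IsClique G S × ∣ S ∣ ≡ k

IsCliqueNumber : Graph → ℕ → Set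
IsCliqueNumber G k = CliqueOfSize G k × (∀ m → CliqueOfSize G m → m ≤ k)

private
  least : {Q : ℕ → Set} → U.Decidable Q → (n : ℕ) → Q n →
          ∃ λ k → Q k × (∀ m → Q m → k ≤ m)
  least Q? n qn with Q? 0
  least Q? n       qn | yes q0 = 0 , q0 , λ _ _ → z≤n
  least Q? zero    qn | no ¬q0 = ⊥-elim (¬q0 qn)
  least Q? (suc n) qn | no ¬q0 with least (Q? ∘ suc) n qn
  ... | k , qk , min = suc k , qk , λ
    { zero    q → ⊥-elim (¬q0 q)
    ; (suc m) q → s≤s (min m q) }

  greatest : {Q : ℕ → Set} → U.Decidable Q → Q 0 →
             (n : ℕ) → (∀ m → Q m → m ≤ n) →
             ∃ λ k → Q k × (∀ m → Q m → m ≤ k)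
  greatest Q? q0 zero    bound = 0 , q0 , bound
  greatest Q? q0 (suc n) bound with Q? (suc n)
  ... | yes q = suc n , q , bound
  ... | no ¬q = greatest Q? q0 n λ m qm →
    ℕ.≤-pred (ℕ.≤∧≢⇒< (bound m qm) λ { refl → ¬q qm })

  anyVec? : ∀ {k} n {Q : Vec (Fin k) n → Set} → U.Decidable Q → Dec (∃ Q)
  anyVec? zero    Q? = map′ (λ q → [] , q) (λ { ([] , q) → q }) (Q? [])
  anyVec? (suc n) Q? =
    map′ (λ { (x , xs , q) → x ∷ xs , q }) (λ { (x ∷ xs , q) → x , xs , q })
         (Fin.any? λ x → anyVec? n λ xs → Q? (x ∷ xs))

-- χ and ω are found by exhaustive search; chromaticNumber and cliqueNumber
-- also carry the proofs that the numbers found are the right ones.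
colourable? : ∀ G → U.Decidable (Colourable G)
colourable? G k = map′
  (λ (xs , p) → lookup xs , p)
  (λ (c , p) → tabulate c , λ u v e →
    subst₂ _≢_ (sym (lookup∘tabulate c u)) (sym (lookup∘tabulate c v)) (p u v e))
  (anyVec? (order G) λ xs → Fin.all? λ u → Fin.all? λ v →
    adj? G u v →-dec ¬? (lookup xs u Fin.≟ lookup xs v))

isClique? : ∀ G → U.Decidable (IsClique G)
isClique? G S = Fin.all? λ u → Fin.all? λ v →
  (u ∈? S) →-dec ((v ∈? S) →-dec (¬? (u Fin.≟ v) →-dec adj? G u v))

cliqueOfSize? : ∀ G → U.Decidable (CliqueOfSize G)
cliqueOfSize? G k = anySubset? λ S → isClique? G S ×-dec (∣ S ∣ ℕ.≟ k)

chromaticNumber : ∀ G → ∃ (IsChromaticNumber G)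
chromaticNumber G = least (colourable? G) (order G)
  (id , λ { u .u e refl → irrefl G e })

cliqueNumber : ∀ G → ∃ (IsCliqueNumber G)
cliqueNumber G = greatest (cliqueOfSize? G)
  (∅ , (λ _ _ u∈∅ → ⊥-elim (∉⊥ u∈∅)) , ∣⊥∣≡0 (order G))
  (order G) λ { _ (S , _ , refl) → ∣p∣≤n S }

χ : Graph → ℕ
χ G = proj₁ (chromaticNumber G)

ω : Graph → ℕ
ω G = proj₁ (cliqueNumber G)

{-# OPTIONS --safe #-}

-- Say that a vertex dominates a C₅ if it is adjacent to one of its vertices.  In a connected graph
-- of the class, a vertex v whose set of dominated C₅s is maximal dominates every C₅: otherwise
-- there is an undominated C₅ Q at distance two from v, and by a finite case analysis some vertex of
-- Q dominates all that v dominates, and Q as well.  Hence G − N(v) has no C₅.  Neither has N(v),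
-- because the graph is gem-free.  It remains to colour C₅-free members of the class with ω colours:
-- then N(v) takes ω − 1 colours and the rest ω colours.
--
-- For C₅-free graphs, take the component Z of the non-neighbours of a non-universal vertex.  If
-- the border of Z is a clique, colour both sides and glue.  Otherwise an induced path through Z
-- closes up to a hole, which must be a C₆.  Then either another clique cutset appears, or some
-- vertex of the C₆ has a neighbourhood covered by two cliques and is coloured after a Kempe change:
-- a Kempe chain joining the two cliques would give a C₅, a C₇ or a P₇.
--
-- The finite case analyses are refutations by splitting on adjacency and equality of a few
-- vertices.  They are recorded as certificates, found by computer search, and evaluated by a
-- verified checker.
module Submission where

open import Defs
open import Data.Bool using (Bool; true; false; _∧_; _∨_; T; if_then_else_)
open import Data.Bool.Properties using (T-∧; T-∨)
open import Data.Empty using (⊥; ⊥-elim)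
open import Data.Fin using (Fin; zero; suc; toℕ; fromℕ<)
open import Data.Fin.Patterns
import Data.Fin.Properties as Fin
open import Data.Fin.Subset as Subset
  using (Subset; _∈_; _∉_; _⊂_; _⊃_; _⊆_; ∣_∣; ⁅_⁆; _∪_) renaming (⊥ to ∅)
open import Data.Fin.Subset.Induction using (⊂-wellFounded; ⊃-wellFounded)
open import Data.Fin.Subset.Properties
  using (_∈?_; x∈⁅x⁆; x∈⁅y⁆⇒x≡y; p⊆p∪q; x∈p∪q⁻; x∈p∪q⁺; ∈⊤; ∉⊥; ∣⊥∣≡0; ∪-identityˡ)
open import Data.List as List
  using (List; []; _∷_; _++_; map; concatMap; allFin; filter; length; cartesianProductWith)
open import Data.List.Membership.Propositional using () renaming (_∈_ to _∈ˡ_)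
open import Data.List.Membership.Propositional.Properties
  using (∈-allFin; ∈-map⁺; ∈-filter⁺; ∈-concatMap⁺; ∈-cartesianProductWith⁺)
open import Data.List.Properties using (length-map)
open import Data.List.Relation.Unary.All as All using (All; []; _∷_)
open import Data.List.Relation.Unary.All.Properties
  using (++⁻ˡ; ++⁻ʳ; ¬Any⇒All¬; all-filter; ++⁺; ¬All⇒Any¬)
open import Data.List.Relation.Unary.AllPairs using (AllPairs; []; _∷_)
open import Data.List.Relation.Unary.Any as Any using (Any; here; there)
open import Data.List.Relation.Unary.Any.Properties using (lookup-index)
open import Data.List.Relation.Unary.Unique.Propositional.Properties using (allFin⁺; filter⁺)
open import Data.Nat using (ℕ; zero; suc; _+_; _*_; _∸_; _≤_; _<_; _≡ᵇ_; _/_; _%_; _<?_; _≟_)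
import Data.Nat.Properties as ℕ
open import Data.Nat.Tactic.RingSolver using (solve-∀)
open import Data.Product using (∃; _×_; _,_; proj₁; proj₂; ∃₂)
open import Data.Sum using (_⊎_; inj₁; inj₂)
open import Data.Unit using (tt; ⊤)
open import Data.Vec as Vec using (tabulate; here; there; Vec; []; _∷_)
open import Data.Vec.Properties using ([]=⇒lookup; lookup⇒[]=; lookup∘tabulate)
open import Data.Vec.Relation.Unary.All as Allᵛ using ([]; _∷_) renaming (All to Allᵛ)
open import Data.Vec.Relation.Unary.Any as Anyᵛ using (here; there) renaming (Any to Anyᵛ)
open import Function using (_∘_; _⇔_; mk⇔; Equivalence; id)
open import Induction.WellFounded using (Acc; acc)
open import Relation.Binary.Construct.Closure.ReflexiveTransitive
  using (Star; ε; _◅_; _◅◅_; reverse)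
open import Relation.Binary.Definitions using (Tri; tri<; tri≈; tri>)
open import Relation.Binary.PropositionalEquality using (_≡_; _≢_; refl; sym; trans; cong; subst)
open import Relation.Nullary using (¬_; Dec; yes; no; does)
open import Relation.Nullary.Decidable
  using (toWitness; _×-dec_; _⊎-dec_; _→-dec_; dec-true; ¬?; decidable-stable)
import Relation.Unary as U

-- A vertex `a` of an undominated C₅ `Q` can only fail as a better choice than `v` through a single
-- C₅ that `v` dominates and `a` does not. The failure is then visible on at most twelve vertices:
-- `v`, its neighbour `p` next to `Q`, and two C₅s. This is why a finite analysis can work. The
-- neighbours of `p` on `Q` are one, two or three consecutive vertices. For one or three, the single
-- or the middle neighbour is shown to be a better choice. For two, it is not settled which of them
-- works; they cannot both fail, even on different C₅s. Around a C₆, the vertices that could replace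
-- one of its vertices form six cliques arranged like the C₆ itself. The obstacle is a component of
-- the remaining vertices that meets both of two opposite vertices. Edges responsible for this
-- cannot occur at two successive pairs of opposite vertices, so turning the C₆ by one step avoids
-- them.

-- Refutation trees over adjacency and equality literals, and their checker.

data Lit : Set where
  _∼_ _≁_ _≐_ _≠_ : ℕ → ℕ → Lit

infix 6 _∼_ _≁_ _≐_ _≠_

-- A number used as a substitution sends i to its i-th hexadecimal digit, counted from the right.
-- edge and equal split on whether the vertices given by two digits are adjacent, respectively equal;
-- use i s closes a branch by the i-th impossible pattern under the substitution s, and hyp i by the
-- i-th hypothesis, a set of literals known not to hold together.
data Cert : Set where
  edge equal : ℕ → Cert → Cert → Cert
  use : ℕ → ℕ → Cert
  hyp : ℕ → Cert

digit : ℕ → ℕ → ℕ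
digit s zero = s % 16
digit s (suc i) = digit (s / 16) i

rename : ℕ → Lit → Lit
rename s (i ∼ j) = digit s i ∼ digit s j
rename s (i ≁ j) = digit s i ≁ digit s j
rename s (i ≐ j) = digit s i ≐ digit s j
rename s (i ≠ j) = digit s i ≠ digit s j

same : ℕ → ℕ → ℕ → ℕ → Bool
same i j k l = ((i ≡ᵇ k) ∧ (j ≡ᵇ l)) ∨ ((i ≡ᵇ l) ∧ (j ≡ᵇ k))

matches : Lit → Lit → Bool
matches (i ∼ j) (k ∼ l) = same i j k l
matches (i ≁ j) (k ≁ l) = same i j k l
matches (i ≐ j) (k ≐ l) = same i j k l
matches (i ≠ j) (k ≠ l) = same i j k l
matches _ _ = false

known : List Lit → Lit → Bool
known [] l = false
known (m ∷ Γ) l = matches l m ∨ known Γ l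

allKnown : List Lit → ℕ → List Lit → Bool
allKnown Γ s [] = true
allKnown Γ s (l ∷ ls) = known Γ (rename s l) ∧ allKnown Γ s ls

-- No substitution here: a hypothesis is known only for the assignment at hand, whereas a forbidden
-- pattern is impossible for every assignment and may be renamed.
allKnown′ : List Lit → List Lit → Bool
allKnown′ Γ [] = true
allKnown′ Γ (l ∷ ls) = known Γ l ∧ allKnown′ Γ ls

useAt : List (List Lit) → ℕ → List Lit → ℕ → Bool
useAt [] i Γ s = false
useAt (π ∷ πs) zero Γ s = allKnown Γ s π
useAt (π ∷ πs) (suc i) Γ s = useAt πs i Γ s

hypAt : List (List Lit) → ℕ → List Lit → Bool
hypAt [] i Γ = false
hypAt (π ∷ πs) zero Γ = allKnown′ Γ π
hypAt (π ∷ πs) (suc i) Γ = hypAt πs i Γ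

check : (πs ηs : List (List Lit)) → List Lit → Cert → Bool
check πs ηs Γ (edge s t f) = check πs ηs ((digit s 1 ∼ digit s 0) ∷ Γ) t ∧ check πs ηs ((digit s 1 ≁ digit s 0) ∷ Γ) f
check πs ηs Γ (equal s t f) = check πs ηs ((digit s 1 ≐ digit s 0) ∷ Γ) t ∧ check πs ηs ((digit s 1 ≠ digit s 0) ∷ Γ) f
check πs ηs Γ (use i s) = useAt πs i Γ s
check πs ηs Γ (hyp i) = hypAt ηs i Γ

-- Soundness of the checker.

module Vertices (G : Graph) where

  V : Set
  V = Vertex G

  infix 4 _~_ _~?_

  _~_ : V → V → Set
  _~_ = Adj G

  _~?_ : ∀ u v → Dec (u ~ v)
  _~?_ = adj? G

  ~-sym : ∀ {u v} → u ~ v → v ~ u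
  ~-sym = adj-sym G

  ~⇒≢ : ∀ {u v} → u ~ v → u ≢ v
  ~⇒≢ uv refl = irrefl G uv

module Semantics (G : Graph) where
  open Vertices G

  Holds : (ℕ → V) → Lit → Set
  Holds φ (i ∼ j) = φ i ~ φ j
  Holds φ (i ≁ j) = ¬ φ i ~ φ j
  Holds φ (i ≐ j) = φ i ≡ φ j
  Holds φ (i ≠ j) = φ i ≢ φ j

  -- Quantifying over all `φ` makes a pattern usable under any renaming. The range `W` serves
  -- C₅-freeness, which is assumed of a vertex subset and not of all of `G`.
  Impossible : (V → Set) → List Lit → Set
  Impossible W π = ∀ φ → (∀ i → W (φ i)) → ¬ All (Holds φ) π

  private
    same-sound : ∀ i j k l → T (same i j k l) → (i ≡ k × j ≡ l) ⊎ (i ≡ l × j ≡ k)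
    same-sound i j k l t with Equivalence.to T-∨ t
    ... | inj₁ a = let (x , y) = Equivalence.to T-∧ a in inj₁ (ℕ.≡ᵇ⇒≡ i k x , ℕ.≡ᵇ⇒≡ j l y)
    ... | inj₂ a = let (x , y) = Equivalence.to T-∧ a in inj₂ (ℕ.≡ᵇ⇒≡ i l x , ℕ.≡ᵇ⇒≡ j k y)

    matches-sound : ∀ φ l m → T (matches l m) → Holds φ m → Holds φ l
    matches-sound φ (i ∼ j) (k ∼ l) t h with same-sound i j k l t
    ... | inj₁ (refl , refl) = h
    ... | inj₂ (refl , refl) = adj-sym G h
    matches-sound φ (i ≁ j) (k ≁ l) t h with same-sound i j k l t
    ... | inj₁ (refl , refl) = h
    ... | inj₂ (refl , refl) = h ∘ adj-sym G
    matches-sound φ (i ≐ j) (k ≐ l) t h with same-sound i j k l t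
    ... | inj₁ (refl , refl) = h
    ... | inj₂ (refl , refl) = sym h
    matches-sound φ (i ≠ j) (k ≠ l) t h with same-sound i j k l t
    ... | inj₁ (refl , refl) = h
    ... | inj₂ (refl , refl) = h ∘ sym

    known-sound : ∀ φ Γ l → T (known Γ l) → All (Holds φ) Γ → Holds φ l
    known-sound φ (m ∷ Γ) l t (h ∷ hs) with Equivalence.to T-∨ t
    ... | inj₁ a = matches-sound φ l m a h
    ... | inj₂ a = known-sound φ Γ l a hs

    rename-holds : ∀ φ s l → Holds φ (rename s l) → Holds (φ ∘ digit s) l
    rename-holds φ s (i ∼ j) h = h
    rename-holds φ s (i ≁ j) h = h
    rename-holds φ s (i ≐ j) h = h
    rename-holds φ s (i ≠ j) h = h

    allKnown-sound : ∀ φ Γ s π → T (allKnown Γ s π) → All (Holds φ) Γ → All (Holds (φ ∘ digit s)) π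
    allKnown-sound φ Γ s [] t h = []
    allKnown-sound φ Γ s (l ∷ π) t h =
      let (a , b) = Equivalence.to T-∧ t
      in rename-holds φ s l (known-sound φ Γ (rename s l) a h) ∷ allKnown-sound φ Γ s π b h

    allKnown′-sound : ∀ φ Γ π → T (allKnown′ Γ π) → All (Holds φ) Γ → All (Holds φ) π
    allKnown′-sound φ Γ [] t h = []
    allKnown′-sound φ Γ (l ∷ π) t h =
      let (a , b) = Equivalence.to T-∧ t
      in known-sound φ Γ l a h ∷ allKnown′-sound φ Γ π b h

  module _ {W : V → Set} {πs : List (List Lit)} (imp : All (Impossible W) πs) where

    private
      useAt-sound : ∀ {πs} → All (Impossible W) πs → ∀ φ → (∀ i → W (φ i)) → ∀ i Γ s →
                    T (useAt πs i Γ s) → ¬ All (Holds φ) Γ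
      useAt-sound {π ∷ _} (p ∷ ps) φ w zero Γ s t h = p (φ ∘ digit s) (w ∘ digit s) (allKnown-sound φ Γ s π t h)
      useAt-sound (p ∷ ps) φ w (suc i) Γ s t h = useAt-sound ps φ w i Γ s t h

      hypAt-sound : ∀ {ηs} φ → All (λ η → ¬ All (Holds φ) η) ηs → ∀ i Γ → T (hypAt ηs i Γ) → ¬ All (Holds φ) Γ
      hypAt-sound {π ∷ _} φ (p ∷ ps) zero Γ t h = p (allKnown′-sound φ Γ π t h)
      hypAt-sound φ (p ∷ ps) (suc i) Γ t h = hypAt-sound φ ps i Γ t h

    refute : ∀ ηs Γ c → T (check πs ηs Γ c) → ∀ φ → (∀ i → W (φ i)) →
             All (λ η → ¬ All (Holds φ) η) ηs → ¬ All (Holds φ) Γ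
    refute ηs Γ (edge s t f) ok φ w hy h with adj? G (φ (digit s 1)) (φ (digit s 0))
    ... | yes a = refute ηs _ t (proj₁ (Equivalence.to T-∧ ok)) φ w hy (a ∷ h)
    ... | no ¬a = refute ηs _ f (proj₂ (Equivalence.to T-∧ ok)) φ w hy (¬a ∷ h)
    refute ηs Γ (equal s t f) ok φ w hy h with φ (digit s 1) Fin.≟ φ (digit s 0)
    ... | yes a = refute ηs _ t (proj₁ (Equivalence.to T-∧ ok)) φ w hy (a ∷ h)
    ... | no ¬a = refute ηs _ f (proj₂ (Equivalence.to T-∧ ok)) φ w hy (¬a ∷ h)
    refute ηs Γ (use i s) ok φ w hy h = useAt-sound imp φ w i Γ s ok h
    refute ηs Γ (hyp i) ok φ w hy h = hypAt-sound φ hy i Γ ok h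

-- From excluded induced subgraphs to impossible patterns.

litOf : (H : Graph) → Vertex H → Vertex H → Lit
litOf H i j = if does (adj? H i j) then toℕ i ∼ toℕ j else toℕ i ≁ toℕ j

-- One literal per unordered pair; `diagram-adj` recovers the rest by symmetry and irreflexivity.
diagram : Graph → List Lit
diagram H = concatMap (λ i → map (litOf H i) (filter (λ j → toℕ i <? toℕ j) (allFin (order H)))) (allFin (order H))

unequal : ∀ {n} → Fin n × Fin n → Lit
unequal (a , b) = toℕ a ≠ toℕ b

-- Vertices with equal neighbourhoods, such as opposite vertices of C 4, are not told apart by the
-- adjacency literals of a diagram: such pairs have to be listed in E.
SeparatedBy : (H : Graph) → List (Vertex H × Vertex H) → Set
SeparatedBy H E = ∀ i j → (∀ k → (Adj H i k → Adj H j k) × (Adj H j k → Adj H i k)) →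
  i ≡ j ⊎ Any (λ (a , b) → (i ≡ a × j ≡ b) ⊎ (i ≡ b × j ≡ a)) E

separatedBy? : ∀ H E → Dec (SeparatedBy H E)
separatedBy? H E = Fin.all? λ i → Fin.all? λ j →
  Fin.all? (λ k → (adj? H i k →-dec adj? H j k) ×-dec (adj? H j k →-dec adj? H i k)) →-dec
  ((i Fin.≟ j) ⊎-dec Any.any? (λ (a , b) → ((i Fin.≟ a) ×-dec (j Fin.≟ b)) ⊎-dec ((i Fin.≟ b) ×-dec (j Fin.≟ a))) E)

module _ (G : Graph) where
  open Vertices G
  open Semantics G

  diagram-adj : ∀ H {φ} → All (Holds φ) (diagram H) → ∀ i j → Adj H i j ⇔ (φ (toℕ i) ~ φ (toℕ j))
  diagram-adj H {φ} hs i j = by-order (ℕ.<-cmp (toℕ i) (toℕ j))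
    where
    ∈-diagram : ∀ {i j} → toℕ i < toℕ j → litOf H i j ∈ˡ diagram H
    ∈-diagram {i} {j} i<j = ∈-concatMap⁺ (λ i → map (litOf H i) (filter (λ j → toℕ i <? toℕ j) (allFin (order H))))
      (Any.map (λ { refl → ∈-map⁺ (litOf H i) (∈-filter⁺ (λ j → toℕ i <? toℕ j) (∈-allFin j) i<j) }) (∈-allFin i))
    below : ∀ {i j} → toℕ i < toℕ j → Adj H i j ⇔ (φ (toℕ i) ~ φ (toℕ j))
    below {i} {j} i<j with adj? H i j | All.lookup hs (∈-diagram i<j)
    ... | yes e | h = mk⇔ (λ _ → h) (λ _ → e)
    ... | no ¬e | h = mk⇔ (⊥-elim ∘ ¬e) (⊥-elim ∘ h)
    by-order : Tri (toℕ i < toℕ j) (toℕ i ≡ toℕ j) (toℕ j < toℕ i) → Adj H i j ⇔ (φ (toℕ i) ~ φ (toℕ j))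
    by-order (tri< i<j _ _) = below i<j
    by-order (tri> _ _ j<i) = mk⇔ (~-sym ∘ Equivalence.to (below j<i) ∘ adj-sym H)
                                  (adj-sym H ∘ Equivalence.from (below j<i) ∘ ~-sym)
    by-order (tri≈ _ eq _) with Fin.toℕ-injective eq
    ... | refl = mk⇔ (⊥-elim ∘ irrefl H) (⊥-elim ∘ irrefl G)

  diagram-impossible : ∀ H E W → SeparatedBy H E → ¬ (H ↪ᵢ G) → Impossible W (map unequal E ++ diagram H)
  diagram-impossible H E W sep H∉G φ _ hs = H∉G record
    { f = φ ∘ toℕ ; injective = λ {i} {j} → inj i j ; preserves = pres }
    where
    pres = diagram-adj H (++⁻ʳ (map unequal E) hs)
    open Equivalence
    inj : ∀ i j → φ (toℕ i) ≡ φ (toℕ j) → i ≡ j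
    distinct : ∀ {E i j} → All (Holds φ) (map unequal E) →
               Any (λ (a , b) → (i ≡ a × j ≡ b) ⊎ (i ≡ b × j ≡ a)) E → φ (toℕ i) ≢ φ (toℕ j)
    distinct (ne ∷ _)  (here (inj₁ (refl , refl))) = ne
    distinct (ne ∷ _)  (here (inj₂ (refl , refl))) = ne ∘ sym
    distinct (_ ∷ nes) (there ij)                  = distinct nes ij
    -- Vertices with a common image have the same neighbours in `H`, since `φ` preserves and
    -- reflects adjacency. So they coincide or form a listed pair, whose images differ by a literal
    -- of the pattern.
    inj i j eq with sep i j (λ k → (λ e → from (pres j k) (subst (_~ φ (toℕ k)) eq (to (pres i k) e)))
                                 , (λ e → from (pres i k) (subst (_~ φ (toℕ k)) (sym eq) (to (pres j k) e))))
    ... | inj₁ i≡j = i≡j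
    ... | inj₂ ij = ⊥-elim (distinct (++⁻ˡ (map unequal E) hs) ij eq)

-- The first pattern is not a subgraph but the compatibility of adjacency with equality; it closes
-- an `equal` branch once a third vertex tells the two apart. The inequalities in the second concern
-- the two pairs of opposite vertices of `C 4`.
forbidden : List (List Lit)
forbidden = (0 ≐ 1 ∷ 0 ∼ 2 ∷ 1 ≁ 2 ∷ []) ∷ (0 ≠ 2 ∷ 1 ≠ 3 ∷ diagram (C 4))
  ∷ diagram gem ∷ diagram (P 7) ∷ diagram (C 7) ∷ []

-- Positions in forbidden; c₅ is only available for C₅-free graphs, where the pattern is appended.
pattern twin s = use 0 s
pattern c₄ s = use 1 s
pattern fan s = use 2 s
pattern p₇ s = use 3 s
pattern c₇ s = use 4 s
pattern c₅ s = use 5 s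

module _ (G : Graph) where
  open Vertices G
  open Semantics G

  forbidden-impossible : ∀ W → (P 7 ∷ C 7 ∷ C 4 ∷ gem ∷ []) -Free G → All (Impossible W) forbidden
  forbidden-impossible W (noP₇ ∷ noC₇ ∷ noC₄ ∷ noGem ∷ []) =
    (λ { φ _ (e ∷ a ∷ n ∷ []) → n (subst (_~ φ 2) e a) }) ∷
    diagram-impossible G (C 4) ((0F , 2F) ∷ (1F , 3F) ∷ []) W (toWitness {a? = separatedBy? (C 4) _} tt) noC₄ ∷
    diagram-impossible G gem [] W (toWitness {a? = separatedBy? gem []} tt) noGem ∷
    diagram-impossible G (P 7) [] W (toWitness {a? = separatedBy? (P 7) []} tt) noP₇ ∷
    diagram-impossible G (C 7) [] W (toWitness {a? = separatedBy? (C 7) []} tt) noC₇ ∷ []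

-- Certificates for the case analyses.

cert-lone : Cert
cert-lone =
  edge 0x17 (edge 0x37 (equal 0x27 (twin 0x027) (equal 0x13 (twin 0x031) (c₄ 0x7321))) (edge 0x67
  (equal 0x27 (twin 0x372) (equal 0x16 (twin 0x061) (c₄ 0x7621))) (edge 0x19 (edge 0x39 (equal 0x29
  (twin 0x829) (equal 0x13 (twin 0x031) (c₄ 0x9321))) (edge 0x69 (equal 0x29 (twin 0x392)
  (equal 0x16 (twin 0x061) (c₄ 0x9621))) (edge 0x18 (edge 0x38 (equal 0x28 (twin 0x728) (equal 0x13
  (twin 0x031) (c₄ 0x8321))) (edge 0x68 (equal 0x28 (twin 0x382) (equal 0x16 (twin 0x061)
  (c₄ 0x8621))) (edge 0x1a (fan 0xa9871) (edge 0x1b (equal 0x9b (twin 0x8b9) (equal 0x1a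
  (twin 0x2a1) (c₄ 0xba91))) (edge 0x3a (edge 0x6a (equal 0x36 (twin 0x463) (equal 0x2a
  (twin 0x1a2) (c₄ 0x6a32))) (p₇ 0x789a326)) (edge 0x6a (p₇ 0x789a623) (edge 0x3b (edge 0x6b
  (equal 0x36 (twin 0x463) (equal 0x2b (twin 0x1b2) (c₄ 0x6b32))) (p₇ 0x987b326)) (edge 0x6b
  (p₇ 0x987b623) (edge 0x47 (edge 0x49 (equal 0x79 (twin 0xb97) (equal 0x14 (twin 0x041)
  (c₄ 0x9471))) (edge 0x48 (fan 0x91748) (p₇ 0x9874326))) (edge 0x4b (edge 0x48 (equal 0x8b
  (twin 0x1b8) (equal 0x47 (twin 0x374) (c₄ 0xb784))) (p₇ 0x87b4326)) (edge 0x4a (p₇ 0x6217ba4)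
  (p₇ 0xab71234)))))))))))) (equal 0x79 (twin 0xb97) (equal 0x18 (twin 0x281) (c₄ 0x9871))))))
  (edge 0x1a (edge 0x3a (equal 0x2a (twin 0x92a) (equal 0x13 (twin 0x031) (c₄ 0xa321))) (edge 0x6a
  (equal 0x2a (twin 0x3a2) (equal 0x16 (twin 0x061) (c₄ 0xa621))) (edge 0x1b (edge 0x3b (equal 0x2b
  (twin 0x72b) (equal 0x13 (twin 0x031) (c₄ 0xb321))) (edge 0x6b (equal 0x2b (twin 0x3b2)
  (equal 0x16 (twin 0x061) (c₄ 0xb621))) (edge 0x18 (equal 0x8a (twin 0x7a8) (equal 0x19
  (twin 0x291) (c₄ 0xa981))) (edge 0x38 (edge 0x68 (equal 0x36 (twin 0x463) (equal 0x28
  (twin 0x182) (c₄ 0x6832))) (p₇ 0xab78326)) (edge 0x68 (p₇ 0xab78623) (edge 0x39 (edge 0x69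
  (equal 0x36 (twin 0x463) (equal 0x29 (twin 0x192) (c₄ 0x6932))) (p₇ 0xb789326)) (edge 0x69
  (p₇ 0xb789623) (edge 0x47 (edge 0x4a (equal 0x7a (twin 0x8a7) (equal 0x14 (twin 0x041)
  (c₄ 0xa471))) (edge 0x4b (fan 0xa174b) (p₇ 0xab74326))) (edge 0x48 (edge 0x4b (equal 0x8b
  (twin 0x9b8) (equal 0x47 (twin 0x374) (c₄ 0xb784))) (p₇ 0xb784326)) (edge 0x49 (p₇ 0x6217894)
  (p₇ 0x9871234))))))))))) (equal 0x7a (twin 0x8a7) (equal 0x1b (twin 0x2b1) (c₄ 0xab71))))))
  (edge 0x38 (edge 0x18 (equal 0x28 (twin 0x728) (equal 0x13 (twin 0x031) (c₄ 0x8321))) (edge 0x68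
  (equal 0x36 (twin 0x463) (equal 0x28 (twin 0x182) (c₄ 0x6832))) (edge 0x3b (equal 0x8b
  (twin 0x9b8) (equal 0x37 (twin 0x273) (c₄ 0xb783))) (edge 0x69 (edge 0x39 (equal 0x36
  (twin 0x463) (equal 0x29 (twin 0x192) (c₄ 0x6932))) (edge 0x3a (equal 0x8a (twin 0x7a8)
  (equal 0x39 (twin 0x293) (c₄ 0xa983))) (edge 0x1b (c₇ 0xba98321) (p₇ 0xba98321)))) (edge 0x6a
  (c₇ 0x789a621) (p₇ 0xa987126)))))) (edge 0x6b (edge 0x1b (equal 0x2b (twin 0x72b) (equal 0x16
  (twin 0x061) (c₄ 0xb621))) (edge 0x3b (equal 0x36 (twin 0x463) (equal 0x2b (twin 0x1b2)
  (c₄ 0x6b32))) (edge 0x68 (equal 0x8b (twin 0x9b8) (equal 0x67 (twin 0x276) (c₄ 0xb786)))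
  (edge 0x69 (edge 0x39 (equal 0x36 (twin 0x463) (equal 0x29 (twin 0x192) (c₄ 0x6932))) (edge 0x6a
  (edge 0x3a (equal 0x36 (twin 0x463) (equal 0x2a (twin 0x1a2) (c₄ 0x6a32))) (p₇ 0x9ab7123))
  (equal 0x9b (twin 0x8b9) (equal 0x6a (twin 0x2a6) (c₄ 0xba96))))) (edge 0x39 (c₇ 0x6b78932)
  (p₇ 0x987b623)))))) (edge 0x1b (edge 0x3b (equal 0x2b (twin 0x6b2) (equal 0x13 (twin 0x031)
  (c₄ 0xb321))) (edge 0x39 (edge 0x69 (equal 0x36 (twin 0x463) (equal 0x29 (twin 0x192)
  (c₄ 0x6932))) (edge 0x68 (edge 0x18 (equal 0x28 (twin 0x382) (equal 0x16 (twin 0x061)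
  (c₄ 0x8621))) (edge 0x6a (equal 0x8a (twin 0x7a8) (equal 0x69 (twin 0x296) (c₄ 0xa986)))
  (c₇ 0xba98621))) (p₇ 0xb789326))) (edge 0x18 (edge 0x68 (equal 0x28 (twin 0x382) (equal 0x16
  (twin 0x061) (c₄ 0x8621))) (edge 0x69 (p₇ 0xb789623) (edge 0x3a (edge 0x6a (equal 0x36
  (twin 0x463) (equal 0x2a (twin 0x1a2) (c₄ 0x6a32))) (p₇ 0x789a326)) (edge 0x6a (p₇ 0x789a623)
  (edge 0x48 (edge 0x4b (equal 0x8b (twin 0x9b8) (equal 0x14 (twin 0x041) (c₄ 0xb481))) (edge 0x47
  (fan 0xb1847) (p₇ 0xb784326))) (edge 0x49 (edge 0x47 (equal 0x79 (twin 0x197) (equal 0x48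
  (twin 0x384) (c₄ 0x9874))) (p₇ 0x7894326)) (edge 0x4a (p₇ 0x62189a4) (p₇ 0xa981234))))))))
  (edge 0x3a (c₇ 0x789a321) (p₇ 0xa987123))))) (edge 0x6a (edge 0x3a (equal 0x36 (twin 0x463)
  (equal 0x2a (twin 0x1a2) (c₄ 0x6a32))) (edge 0x3b (edge 0x39 (equal 0x9b (twin 0x8b9) (equal 0x3a
  (twin 0x2a3) (c₄ 0xba93))) (edge 0x18 (c₇ 0x89ab321) (p₇ 0x89ab321))) (edge 0x39 (c₇ 0x7ba9321)
  (p₇ 0x9ab7123)))) (edge 0x69 (c₇ 0x7ba9621) (p₇ 0x9ab7126)))))))))) (edge 0x18 (edge 0x1b
  (equal 0x8b (twin 0x9b8) (equal 0x17 (twin 0x271) (c₄ 0xb781))) (edge 0x0b (edge 0x08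
  (fan 0xb7810) (equal 0x17 (twin 0x271) (equal 0x08 (twin 0xb80) (c₄ 0x7810)))) (edge 0x0a
  (equal 0x7a (twin 0x8a7) (equal 0x0b (twin 0x1b0) (c₄ 0xab70))) (edge 0x09 (edge 0x19 (edge 0x39
  (equal 0x29 (twin 0x029) (equal 0x13 (twin 0x031) (c₄ 0x9321))) (edge 0x69 (equal 0x29
  (twin 0x392) (equal 0x16 (twin 0x061) (c₄ 0x9621))) (edge 0x1a (edge 0x3a (equal 0x2a
  (twin 0x92a) (equal 0x13 (twin 0x031) (c₄ 0xa321))) (edge 0x6a (equal 0x2a (twin 0x3a2)
  (equal 0x16 (twin 0x061) (c₄ 0xa621))) (edge 0x37 (edge 0x67 (equal 0x36 (twin 0x463) (equal 0x27
  (twin 0x172) (c₄ 0x6732))) (p₇ 0xa907326)) (edge 0x67 (p₇ 0xa907623) (edge 0x47 (edge 0x49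
  (equal 0x79 (twin 0xb97) (equal 0x04 (twin 0x140) (c₄ 0x9470))) (p₇ 0x9074326)) (edge 0x57
  (c₇ 0x7543210) (p₇ 0x7012654))))))) (edge 0x47 (edge 0x49 (equal 0x79 (twin 0xb97) (equal 0x04
  (twin 0x140) (c₄ 0x9470))) (edge 0x57 (edge 0x59 (equal 0x79 (twin 0x497) (equal 0x05
  (twin 0x150) (c₄ 0x9570))) (edge 0x3a (edge 0x6a (equal 0x36 (twin 0x463) (equal 0x2a
  (twin 0x1a2) (c₄ 0x6a32))) (edge 0x5a (edge 0x4a (edge 0x37 (equal 0x7a (twin 0x0a7) (equal 0x35
  (twin 0x253) (c₄ 0xa573))) (fan 0x75a34)) (equal 0x4a (twin 0x7a4) (equal 0x35 (twin 0x253)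
  (c₄ 0xa543)))) (p₇ 0x5623a90))) (edge 0x37 (edge 0x5a (c₇ 0x9a57321) (p₇ 0xa912375)) (edge 0x4a
  (edge 0x6a (edge 0x5a (p₇ 0xa570123) (equal 0x5a (twin 0x7a5) (equal 0x46 (twin 0x364)
  (c₄ 0xa654)))) (p₇ 0x6234a90)) (p₇ 0xa907432))))) (edge 0x67 (equal 0x57 (twin 0x057) (equal 0x46
  (twin 0x364) (c₄ 0x7654))) (c₇ 0x7456210)))) (edge 0x37 (edge 0x67 (equal 0x36 (twin 0x463)
  (equal 0x27 (twin 0x172) (c₄ 0x6732))) (edge 0x57 (equal 0x47 (twin 0x047) (equal 0x35
  (twin 0x253) (c₄ 0x7543))) (p₇ 0x6543701))) (edge 0x57 (c₇ 0x7543210) (p₇ 0x7012345)))))))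
  (edge 0x1a (equal 0x19 (twin 0x291) (equal 0x0a (twin 0x7a0) (c₄ 0x9a10))) (edge 0x37 (edge 0x39
  (equal 0x79 (twin 0xb97) (equal 0x03 (twin 0x130) (c₄ 0x9370))) (edge 0x67 (equal 0x36
  (twin 0x463) (equal 0x27 (twin 0x172) (c₄ 0x6732))) (edge 0x3a (edge 0x6a (equal 0x36
  (twin 0x463) (equal 0x2a (twin 0x1a2) (c₄ 0x6a32))) (edge 0x3b (edge 0x6b (equal 0x36
  (twin 0x463) (equal 0x2b (twin 0x1b2) (c₄ 0x6b32))) (p₇ 0xab70126)) (equal 0x7a (twin 0x0a7)
  (equal 0x3b (twin 0x2b3) (c₄ 0xab73))))) (edge 0x3b (c₇ 0x9ab3210) (p₇ 0x9ab7321))))) (edge 0x3b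
  (edge 0x6b (equal 0x36 (twin 0x463) (equal 0x2b (twin 0x1b2) (c₄ 0x6b32))) (edge 0x67 (edge 0x69
  (equal 0x79 (twin 0xb97) (equal 0x06 (twin 0x160) (c₄ 0x9670))) (edge 0x6a (equal 0x7a
  (twin 0x0a7) (equal 0x6b (twin 0x2b6) (c₄ 0xab76))) (p₇ 0x9ab7621))) (edge 0x6a (c₇ 0x7ba6210)
  (p₇ 0xab70126)))) (edge 0x3a (c₇ 0x7ba3210) (p₇ 0xab70123)))))) (edge 0x08 (edge 0x19
  (fan 0x91078) (edge 0x1a (equal 0x8a (twin 0x0a8) (equal 0x19 (twin 0x091) (c₄ 0xa981)))
  (p₇ 0x9ab7012))) (equal 0x17 (twin 0x271) (equal 0x08 (twin 0x908) (c₄ 0x7810)))))))) (edge 0x1b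
  (edge 0x08 (edge 0x0b (fan 0x87b10) (equal 0x17 (twin 0x271) (equal 0x0b (twin 0x8b0)
  (c₄ 0x7b10)))) (edge 0x09 (equal 0x79 (twin 0xb97) (equal 0x08 (twin 0x180) (c₄ 0x9870)))
  (edge 0x0a (edge 0x1a (edge 0x3a (equal 0x2a (twin 0x02a) (equal 0x13 (twin 0x031) (c₄ 0xa321)))
  (edge 0x6a (equal 0x2a (twin 0x3a2) (equal 0x16 (twin 0x061) (c₄ 0xa621))) (edge 0x19 (edge 0x39
  (equal 0x29 (twin 0x829) (equal 0x13 (twin 0x031) (c₄ 0x9321))) (edge 0x69 (equal 0x29
  (twin 0x392) (equal 0x16 (twin 0x061) (c₄ 0x9621))) (edge 0x37 (edge 0x67 (equal 0x36
  (twin 0x463) (equal 0x27 (twin 0x172) (c₄ 0x6732))) (p₇ 0x9a07326)) (edge 0x67 (p₇ 0x9a07623)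
  (edge 0x47 (edge 0x4a (equal 0x7a (twin 0x8a7) (equal 0x04 (twin 0x140) (c₄ 0xa470)))
  (p₇ 0xa074326)) (edge 0x57 (c₇ 0x7543210) (p₇ 0x7012654))))))) (edge 0x47 (edge 0x4a (equal 0x7a
  (twin 0x8a7) (equal 0x04 (twin 0x140) (c₄ 0xa470))) (edge 0x57 (edge 0x5a (equal 0x7a
  (twin 0x4a7) (equal 0x05 (twin 0x150) (c₄ 0xa570))) (edge 0x39 (edge 0x69 (equal 0x36
  (twin 0x463) (equal 0x29 (twin 0x192) (c₄ 0x6932))) (edge 0x59 (edge 0x49 (edge 0x37 (equal 0x79
  (twin 0x097) (equal 0x35 (twin 0x253) (c₄ 0x9573))) (fan 0x75934)) (equal 0x49 (twin 0x794)
  (equal 0x35 (twin 0x253) (c₄ 0x9543)))) (p₇ 0x56239a0))) (edge 0x37 (edge 0x59 (c₇ 0xa957321)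
  (p₇ 0x9a12375)) (edge 0x49 (edge 0x69 (edge 0x59 (p₇ 0x9570123) (equal 0x59 (twin 0x795)
  (equal 0x46 (twin 0x364) (c₄ 0x9654)))) (p₇ 0x62349a0)) (p₇ 0x9a07432))))) (edge 0x67 (equal 0x57
  (twin 0x057) (equal 0x46 (twin 0x364) (c₄ 0x7654))) (c₇ 0x7456210)))) (edge 0x37 (edge 0x67
  (equal 0x36 (twin 0x463) (equal 0x27 (twin 0x172) (c₄ 0x6732))) (edge 0x57 (equal 0x47
  (twin 0x047) (equal 0x35 (twin 0x253) (c₄ 0x7543))) (p₇ 0x6543701))) (edge 0x57 (c₇ 0x7543210)
  (p₇ 0x7012345))))))) (edge 0x19 (equal 0x1a (twin 0x2a1) (equal 0x09 (twin 0x790) (c₄ 0xa910)))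
  (edge 0x37 (edge 0x3a (equal 0x7a (twin 0x8a7) (equal 0x03 (twin 0x130) (c₄ 0xa370))) (edge 0x67
  (equal 0x36 (twin 0x463) (equal 0x27 (twin 0x172) (c₄ 0x6732))) (edge 0x39 (edge 0x69 (equal 0x36
  (twin 0x463) (equal 0x29 (twin 0x192) (c₄ 0x6932))) (edge 0x38 (edge 0x68 (equal 0x36
  (twin 0x463) (equal 0x28 (twin 0x182) (c₄ 0x6832))) (p₇ 0x9870126)) (equal 0x79 (twin 0x097)
  (equal 0x38 (twin 0x283) (c₄ 0x9873))))) (edge 0x38 (c₇ 0xa983210) (p₇ 0xa987321))))) (edge 0x38
  (edge 0x68 (equal 0x36 (twin 0x463) (equal 0x28 (twin 0x182) (c₄ 0x6832))) (edge 0x67 (edge 0x6a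
  (equal 0x7a (twin 0x8a7) (equal 0x06 (twin 0x160) (c₄ 0xa670))) (edge 0x69 (equal 0x79
  (twin 0x097) (equal 0x68 (twin 0x286) (c₄ 0x9876))) (p₇ 0xa987621))) (edge 0x69 (c₇ 0x7896210)
  (p₇ 0x9870126)))) (edge 0x39 (c₇ 0x7893210) (p₇ 0x9870123)))))) (edge 0x0b (edge 0x1a
  (fan 0xa107b) (edge 0x19 (equal 0x9b (twin 0x8b9) (equal 0x1a (twin 0x0a1) (c₄ 0xba91)))
  (p₇ 0xa987012))) (equal 0x17 (twin 0x271) (equal 0x0b (twin 0xa0b) (c₄ 0x7b10))))))) (edge 0x09
  (edge 0x08 (edge 0x19 (fan 0x78910) (edge 0x0a (fan 0xa9870) (edge 0x1a (equal 0x19 (twin 0x291)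
  (equal 0x0a (twin 0x7a0) (c₄ 0x9a10))) (edge 0x0b (equal 0x9b (twin 0x8b9) (equal 0x0a
  (twin 0x1a0) (c₄ 0xba90))) (edge 0x37 (edge 0x39 (equal 0x79 (twin 0xb97) (equal 0x03
  (twin 0x130) (c₄ 0x9370))) (edge 0x67 (equal 0x36 (twin 0x463) (equal 0x27 (twin 0x172)
  (c₄ 0x6732))) (edge 0x38 (fan 0x90738) (edge 0x3a (edge 0x6a (equal 0x36 (twin 0x463) (equal 0x2a
  (twin 0x1a2) (c₄ 0x6a32))) (edge 0x3b (edge 0x6b (equal 0x36 (twin 0x463) (equal 0x2b
  (twin 0x1b2) (c₄ 0x6b32))) (p₇ 0xab70126)) (equal 0x7a (twin 0x0a7) (equal 0x3b (twin 0x2b3)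
  (c₄ 0xab73))))) (p₇ 0xa987321))))) (edge 0x3b (edge 0x6b (equal 0x36 (twin 0x463) (equal 0x2b
  (twin 0x1b2) (c₄ 0x6b32))) (edge 0x38 (equal 0x8b (twin 0x0b8) (equal 0x37 (twin 0x273)
  (c₄ 0xb783))) (edge 0x39 (edge 0x69 (equal 0x36 (twin 0x463) (equal 0x29 (twin 0x192)
  (c₄ 0x6932))) (edge 0x3a (edge 0x6a (equal 0x36 (twin 0x463) (equal 0x2a (twin 0x1a2)
  (c₄ 0x6a32))) (p₇ 0xba90126)) (equal 0x9b (twin 0x0b9) (equal 0x3a (twin 0x2a3) (c₄ 0xba93)))))
  (p₇ 0x987b321)))) (edge 0x3a (c₇ 0x7ba3210) (p₇ 0xab70123)))))))) (equal 0x79 (twin 0xb97)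
  (equal 0x08 (twin 0x180) (c₄ 0x9870)))) (edge 0x0a (edge 0x0b (edge 0x08 (equal 0x8a (twin 0x7a8)
  (equal 0x09 (twin 0x790) (c₄ 0xa980))) (edge 0x1a (fan 0x7ba10) (edge 0x19 (equal 0x1a
  (twin 0x2a1) (equal 0x09 (twin 0x790) (c₄ 0xa910))) (edge 0x37 (edge 0x3a (equal 0x7a
  (twin 0x8a7) (equal 0x03 (twin 0x130) (c₄ 0xa370))) (edge 0x67 (equal 0x36 (twin 0x463)
  (equal 0x27 (twin 0x172) (c₄ 0x6732))) (edge 0x3b (fan 0xa073b) (edge 0x39 (edge 0x69 (equal 0x36
  (twin 0x463) (equal 0x29 (twin 0x192) (c₄ 0x6932))) (edge 0x38 (edge 0x68 (equal 0x36
  (twin 0x463) (equal 0x28 (twin 0x182) (c₄ 0x6832))) (p₇ 0x9870126)) (equal 0x79 (twin 0x097)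
  (equal 0x38 (twin 0x283) (c₄ 0x9873))))) (p₇ 0x9ab7321))))) (edge 0x38 (edge 0x68 (equal 0x36
  (twin 0x463) (equal 0x28 (twin 0x182) (c₄ 0x6832))) (edge 0x3b (equal 0x8b (twin 0x9b8)
  (equal 0x37 (twin 0x273) (c₄ 0xb783))) (edge 0x3a (edge 0x6a (equal 0x36 (twin 0x463) (equal 0x2a
  (twin 0x1a2) (c₄ 0x6a32))) (edge 0x39 (edge 0x69 (equal 0x36 (twin 0x463) (equal 0x29
  (twin 0x192) (c₄ 0x6932))) (p₇ 0x89a0126)) (equal 0x8a (twin 0x7a8) (equal 0x39 (twin 0x293)
  (c₄ 0xa983))))) (p₇ 0xab78321)))) (edge 0x39 (c₇ 0x7893210) (p₇ 0x9870123))))))) (equal 0x7a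
  (twin 0x8a7) (equal 0x0b (twin 0x1b0) (c₄ 0xab70)))) (edge 0x19 (edge 0x08 (equal 0x18
  (twin 0x281) (equal 0x09 (twin 0x790) (c₄ 0x8910))) (edge 0x39 (equal 0x29 (twin 0x829)
  (equal 0x13 (twin 0x031) (c₄ 0x9321))) (edge 0x69 (equal 0x29 (twin 0x392) (equal 0x16
  (twin 0x061) (c₄ 0x9621))) (edge 0x3a (edge 0x1a (equal 0x2a (twin 0x92a) (equal 0x13
  (twin 0x031) (c₄ 0xa321))) (edge 0x6a (equal 0x36 (twin 0x463) (equal 0x2a (twin 0x1a2)
  (c₄ 0x6a32))) (edge 0x38 (equal 0x8a (twin 0x7a8) (equal 0x39 (twin 0x293) (c₄ 0xa983)))
  (edge 0x37 (edge 0x67 (equal 0x36 (twin 0x463) (equal 0x27 (twin 0x172) (c₄ 0x6732))) (edge 0x3b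
  (edge 0x6b (equal 0x36 (twin 0x463) (equal 0x2b (twin 0x1b2) (c₄ 0x6b32))) (p₇ 0x7ba9126))
  (equal 0x7a (twin 0x0a7) (equal 0x3b (twin 0x2b3) (c₄ 0xab73))))) (p₇ 0x23a9870))))) (edge 0x6a
  (edge 0x1a (equal 0x2a (twin 0x3a2) (equal 0x16 (twin 0x061) (c₄ 0xa621))) (edge 0x68 (equal 0x8a
  (twin 0x7a8) (equal 0x69 (twin 0x296) (c₄ 0xa986))) (edge 0x67 (edge 0x37 (equal 0x36
  (twin 0x463) (equal 0x27 (twin 0x172) (c₄ 0x6732))) (edge 0x6b (edge 0x3b (equal 0x36
  (twin 0x463) (equal 0x2b (twin 0x1b2) (c₄ 0x6b32))) (p₇ 0x7ba9123)) (equal 0x7a (twin 0x0a7)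
  (equal 0x6b (twin 0x2b6) (c₄ 0xab76))))) (p₇ 0x26a9870)))) (edge 0x1a (edge 0x37 (edge 0x67
  (equal 0x36 (twin 0x463) (equal 0x27 (twin 0x172) (c₄ 0x6732))) (edge 0x68 (edge 0x6b (equal 0x8b
  (twin 0x9b8) (equal 0x67 (twin 0x276) (c₄ 0xb786))) (c₇ 0xab78621)) (edge 0x6b (c₇ 0x987b621)
  (p₇ 0xb789126)))) (edge 0x38 (edge 0x3b (equal 0x8b (twin 0x9b8) (equal 0x37 (twin 0x273)
  (c₄ 0xb783))) (c₇ 0xab78321)) (edge 0x3b (c₇ 0x987b321) (p₇ 0xb789123)))) (edge 0x3b (edge 0x6b
  (equal 0x36 (twin 0x463) (equal 0x2b (twin 0x1b2) (c₄ 0x6b32))) (edge 0x67 (c₇ 0x9ab7621)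
  (p₇ 0x7ba9126))) (edge 0x37 (c₇ 0x9ab7321) (p₇ 0x7ba9123))))))))) (edge 0x1a (edge 0x0b
  (equal 0x1b (twin 0x2b1) (equal 0x0a (twin 0x7a0) (c₄ 0xba10))) (edge 0x3a (equal 0x2a
  (twin 0x92a) (equal 0x13 (twin 0x031) (c₄ 0xa321))) (edge 0x6a (equal 0x2a (twin 0x3a2)
  (equal 0x16 (twin 0x061) (c₄ 0xa621))) (edge 0x39 (edge 0x69 (equal 0x36 (twin 0x463) (equal 0x29
  (twin 0x192) (c₄ 0x6932))) (edge 0x3b (equal 0x9b (twin 0x8b9) (equal 0x3a (twin 0x2a3)
  (c₄ 0xba93))) (edge 0x37 (edge 0x67 (equal 0x36 (twin 0x463) (equal 0x27 (twin 0x172)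
  (c₄ 0x6732))) (edge 0x38 (edge 0x68 (equal 0x36 (twin 0x463) (equal 0x28 (twin 0x182)
  (c₄ 0x6832))) (p₇ 0x789a126)) (equal 0x79 (twin 0x097) (equal 0x38 (twin 0x283) (c₄ 0x9873)))))
  (p₇ 0x239ab70)))) (edge 0x38 (edge 0x68 (equal 0x36 (twin 0x463) (equal 0x28 (twin 0x182)
  (c₄ 0x6832))) (edge 0x69 (edge 0x67 (equal 0x79 (twin 0x097) (equal 0x68 (twin 0x286)
  (c₄ 0x9876))) (edge 0x6b (equal 0x9b (twin 0x8b9) (equal 0x6a (twin 0x2a6) (c₄ 0xba96)))
  (p₇ 0x269ab70))) (edge 0x67 (c₇ 0xa987621) (p₇ 0x789a126)))) (edge 0x37 (c₇ 0xa987321)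
  (p₇ 0x789a123))))))) (edge 0x08 (edge 0x0b (edge 0x38 (edge 0x3b (equal 0x8b (twin 0x9b8)
  (equal 0x03 (twin 0x130) (c₄ 0xb380))) (edge 0x68 (equal 0x36 (twin 0x463) (equal 0x28
  (twin 0x182) (c₄ 0x6832))) (edge 0x37 (fan 0xb0837) (edge 0x3a (edge 0x6a (equal 0x36
  (twin 0x463) (equal 0x2a (twin 0x1a2) (c₄ 0x6a32))) (edge 0x39 (edge 0x69 (equal 0x36
  (twin 0x463) (equal 0x29 (twin 0x192) (c₄ 0x6932))) (p₇ 0xa980126)) (equal 0x8a (twin 0x0a8)
  (equal 0x39 (twin 0x293) (c₄ 0xa983))))) (p₇ 0xab78321))))) (edge 0x39 (edge 0x69 (equal 0x36
  (twin 0x463) (equal 0x29 (twin 0x192) (c₄ 0x6932))) (edge 0x37 (equal 0x79 (twin 0x097)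
  (equal 0x38 (twin 0x283) (c₄ 0x9873))) (edge 0x3b (edge 0x6b (equal 0x36 (twin 0x463) (equal 0x2b
  (twin 0x1b2) (c₄ 0x6b32))) (edge 0x3a (edge 0x6a (equal 0x36 (twin 0x463) (equal 0x2a
  (twin 0x1a2) (c₄ 0x6a32))) (p₇ 0x9ab0126)) (equal 0x9b (twin 0x8b9) (equal 0x3a (twin 0x2a3)
  (c₄ 0xba93))))) (p₇ 0xb789321)))) (edge 0x3a (c₇ 0x89a3210) (p₇ 0xa980123)))) (p₇ 0x9ab7012))
  (p₇ 0xa987012))))))))

cert-middle : Cert
cert-middle =
  edge 0x37 (edge 0x17 (fan 0x23701) (equal 0x17 (twin 0x271) (equal 0x03 (twin 0x203)
  (c₄ 0x7310)))) (edge 0x67 (edge 0x17 (fan 0x26701) (equal 0x17 (twin 0x271) (equal 0x06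
  (twin 0x206) (c₄ 0x7610)))) (edge 0x38 (edge 0x68 (equal 0x36 (twin 0x463) (equal 0x28
  (twin 0x728) (c₄ 0x6832))) (edge 0x3b (equal 0x8b (twin 0x9b8) (equal 0x37 (twin 0x273)
  (c₄ 0xb783))) (edge 0x18 (fan 0x83261) (edge 0x08 (equal 0x18 (twin 0x281) (equal 0x03
  (twin 0x730) (c₄ 0x8310))) (edge 0x09 (equal 0x79 (twin 0xb97) (equal 0x08 (twin 0x180)
  (c₄ 0x9870))) (edge 0x17 (equal 0x37 (twin 0x273) (equal 0x18 (twin 0x081) (c₄ 0x7831)))
  (edge 0x3a (edge 0x6a (equal 0x36 (twin 0x463) (equal 0x2a (twin 0x92a) (c₄ 0x6a32))) (edge 0x39
  (edge 0x69 (equal 0x36 (twin 0x463) (equal 0x29 (twin 0x829) (c₄ 0x6932))) (edge 0x19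
  (fan 0x93261) (edge 0x1a (fan 0xa3261) (edge 0x0a (equal 0x1a (twin 0x2a1) (equal 0x03
  (twin 0x730) (c₄ 0xa310))) (p₇ 0xa987012))))) (equal 0x8a (twin 0x7a8) (equal 0x39 (twin 0x293)
  (c₄ 0xa983))))) (edge 0x6a (edge 0x1a (fan 0xa6231) (edge 0x0a (equal 0x1a (twin 0x2a1)
  (equal 0x06 (twin 0x760) (c₄ 0xa610))) (p₇ 0xa623870))) (edge 0x0a (p₇ 0xa078326) (edge 0x6b
  (edge 0x69 (equal 0x9b (twin 0x8b9) (equal 0x6a (twin 0x2a6) (c₄ 0xba96))) (edge 0x1b
  (fan 0xb6231) (edge 0x0b (equal 0x1b (twin 0x2b1) (equal 0x06 (twin 0x760) (c₄ 0xb610)))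
  (edge 0x1a (equal 0x6a (twin 0x2a6) (equal 0x1b (twin 0x0b1) (c₄ 0xab61))) (edge 0x19 (edge 0x39
  (fan 0x93261) (equal 0x39 (twin 0x293) (equal 0x18 (twin 0x081) (c₄ 0x9831))))
  (p₇ 0x89ab610)))))) (p₇ 0xab78326))))))))))) (edge 0x6b (edge 0x3b (equal 0x36 (twin 0x463)
  (equal 0x2b (twin 0x72b) (c₄ 0x6b32))) (edge 0x68 (equal 0x8b (twin 0x9b8) (equal 0x67
  (twin 0x276) (c₄ 0xb786))) (edge 0x1b (fan 0xb6231) (edge 0x0b (equal 0x1b (twin 0x2b1)
  (equal 0x06 (twin 0x760) (c₄ 0xb610))) (edge 0x0a (equal 0x7a (twin 0x8a7) (equal 0x0b
  (twin 0x1b0) (c₄ 0xab70))) (edge 0x17 (equal 0x67 (twin 0x276) (equal 0x1b (twin 0x0b1)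
  (c₄ 0x7b61))) (edge 0x69 (edge 0x39 (equal 0x36 (twin 0x463) (equal 0x29 (twin 0x829)
  (c₄ 0x6932))) (edge 0x6a (edge 0x3a (equal 0x36 (twin 0x463) (equal 0x2a (twin 0x92a)
  (c₄ 0x6a32))) (edge 0x19 (fan 0x96231) (edge 0x09 (equal 0x19 (twin 0x291) (equal 0x06
  (twin 0x760) (c₄ 0x9610))) (edge 0x1a (fan 0xa6231) (p₇ 0x9ab7012))))) (equal 0x9b (twin 0x8b9)
  (equal 0x6a (twin 0x2a6) (c₄ 0xba96))))) (edge 0x39 (c₇ 0x6b78932) (p₇ 0x987b623)))))))))
  (edge 0x18 (edge 0x48 (equal 0x38 (twin 0x283) (equal 0x14 (twin 0x041) (c₄ 0x8431))) (edge 0x68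
  (fan 0x86231) (edge 0x58 (equal 0x68 (twin 0x286) (equal 0x15 (twin 0x051) (c₄ 0x8561)))
  (edge 0x39 (edge 0x19 (fan 0x89321) (equal 0x38 (twin 0x283) (equal 0x19 (twin 0x291)
  (c₄ 0x8931)))) (edge 0x69 (edge 0x19 (fan 0x89621) (equal 0x68 (twin 0x286) (equal 0x19
  (twin 0x291) (c₄ 0x8961)))) (edge 0x3b (p₇ 0x987b326) (edge 0x47 (edge 0x49 (equal 0x79
  (twin 0xb97) (equal 0x48 (twin 0x384) (c₄ 0x9874))) (p₇ 0x9874326)) (edge 0x49 (p₇ 0x7894326)
  (edge 0x4b (p₇ 0x987b432) (edge 0x57 (edge 0x59 (equal 0x79 (twin 0xb97) (equal 0x58 (twin 0x485)
  (c₄ 0x9875))) (p₇ 0x9875432)) (edge 0x59 (p₇ 0x7895432) (edge 0x5b (p₇ 0x87b5432) (edge 0x3a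
  (edge 0x6a (equal 0x36 (twin 0x463) (equal 0x2a (twin 0x92a) (c₄ 0x6a32))) (p₇ 0x789a326))
  (edge 0x4a (p₇ 0x789a432) (edge 0x5a (p₇ 0x89a5432) (edge 0x6a (p₇ 0x789a623) (edge 0x1b
  (edge 0x17 (edge 0x1a (fan 0xab781) (edge 0x19 (equal 0x9b (twin 0x8b9) (equal 0x1a (twin 0x2a1)
  (c₄ 0xba91))) (p₇ 0xa981654))) (equal 0x8b (twin 0x9b8) (equal 0x17 (twin 0x271) (c₄ 0xb781))))
  (edge 0x17 (edge 0x1a (equal 0x7a (twin 0x8a7) (equal 0x1b (twin 0x2b1) (c₄ 0xab71)))
  (p₇ 0xab71654)) (p₇ 0xb781654))))))))))))))))))) (edge 0x17 (edge 0x47 (equal 0x37 (twin 0x273)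
  (equal 0x14 (twin 0x041) (c₄ 0x7431))) (edge 0x57 (equal 0x67 (twin 0x276) (equal 0x15
  (twin 0x051) (c₄ 0x7561))) (edge 0x68 (equal 0x67 (twin 0x276) (equal 0x18 (twin 0x281)
  (c₄ 0x7861))) (edge 0x19 (equal 0x79 (twin 0xb97) (equal 0x18 (twin 0x281) (c₄ 0x9871)))
  (edge 0x09 (edge 0x08 (fan 0x98710) (equal 0x79 (twin 0x197) (equal 0x08 (twin 0x180)
  (c₄ 0x9870)))) (edge 0x39 (edge 0x69 (equal 0x36 (twin 0x463) (equal 0x19 (twin 0x091)
  (c₄ 0x6931))) (edge 0x3b (edge 0x1b (fan 0x7b321) (equal 0x37 (twin 0x273) (equal 0x1b
  (twin 0x2b1) (c₄ 0x7b31)))) (p₇ 0xb789326))) (edge 0x1b (edge 0x5b (equal 0x6b (twin 0x2b6)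
  (equal 0x15 (twin 0x051) (c₄ 0xb561))) (edge 0x3b (fan 0x7b321) (edge 0x4b (equal 0x3b
  (twin 0x2b3) (equal 0x14 (twin 0x041) (c₄ 0xb431))) (edge 0x58 (p₇ 0xb785623) (edge 0x48
  (p₇ 0xb784562) (edge 0x49 (p₇ 0xb789432) (edge 0x59 (p₇ 0x4598712) (p₇ 0x9871345))))))))
  (edge 0x3b (equal 0x37 (twin 0x273) (equal 0x1b (twin 0x2b1) (c₄ 0x7b31))) (edge 0x1a (equal 0x7a
  (twin 0x8a7) (equal 0x1b (twin 0x2b1) (c₄ 0xab71))) (edge 0x69 (p₇ 0xb789623) (edge 0x3a
  (edge 0x0a (equal 0x1a (twin 0x2a1) (equal 0x03 (twin 0x730) (c₄ 0xa310))) (edge 0x6a (equal 0x36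
  (twin 0x463) (equal 0x1a (twin 0x0a1) (c₄ 0x6a31))) (p₇ 0x789a326))) (edge 0x48 (edge 0x4b
  (equal 0x8b (twin 0x9b8) (equal 0x47 (twin 0x374) (c₄ 0xb784))) (p₇ 0xb784326)) (edge 0x49
  (p₇ 0x7894326) (edge 0x4a (p₇ 0x4a98712) (p₇ 0xa987134))))))))))))))) (edge 0x09 (edge 0x08
  (edge 0x68 (equal 0x18 (twin 0x281) (equal 0x06 (twin 0x760) (c₄ 0x8610))) (edge 0x19
  (fan 0x78910) (edge 0x39 (equal 0x19 (twin 0x291) (equal 0x03 (twin 0x730) (c₄ 0x9310)))
  (edge 0x69 (equal 0x19 (twin 0x291) (equal 0x06 (twin 0x760) (c₄ 0x9610))) (edge 0x0a
  (fan 0xa9870) (edge 0x1a (equal 0x19 (twin 0x291) (equal 0x0a (twin 0x7a0) (c₄ 0x9a10)))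
  (edge 0x0b (equal 0x9b (twin 0x8b9) (equal 0x0a (twin 0x1a0) (c₄ 0xba90))) (edge 0x1b (equal 0x17
  (twin 0x271) (equal 0x0b (twin 0x8b0) (c₄ 0x7b10))) (edge 0x3b (p₇ 0x987b316) (edge 0x3a
  (edge 0x6a (equal 0x36 (twin 0x463) (equal 0x1a (twin 0x0a1) (c₄ 0x6a31))) (p₇ 0x623ab70))
  (edge 0x47 (edge 0x49 (equal 0x79 (twin 0xb97) (equal 0x04 (twin 0x140) (c₄ 0x9470)))
  (p₇ 0x9074326)) (edge 0x4b (p₇ 0x6234b70) (edge 0x4a (p₇ 0x234ab70) (p₇ 0xab70134))))))))))))))
  (equal 0x79 (twin 0xb97) (equal 0x08 (twin 0x180) (c₄ 0x9870)))) (edge 0x08 (edge 0x68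
  (equal 0x18 (twin 0x281) (equal 0x06 (twin 0x760) (c₄ 0x8610))) (edge 0x19 (equal 0x18
  (twin 0x281) (equal 0x09 (twin 0x790) (c₄ 0x8910))) (edge 0x0a (equal 0x8a (twin 0x7a8)
  (equal 0x09 (twin 0x190) (c₄ 0xa980))) (edge 0x1b (edge 0x0b (fan 0x87b10) (equal 0x17
  (twin 0x271) (equal 0x0b (twin 0x8b0) (c₄ 0x7b10)))) (edge 0x39 (edge 0x69 (equal 0x36
  (twin 0x463) (equal 0x19 (twin 0x091) (c₄ 0x6931))) (edge 0x3b (edge 0x0b (equal 0x1b
  (twin 0x2b1) (equal 0x03 (twin 0x730) (c₄ 0xb310))) (edge 0x3a (edge 0x6a (equal 0x36
  (twin 0x463) (equal 0x2a (twin 0x92a) (c₄ 0x6a32))) (edge 0x1a (fan 0xa3261) (p₇ 0x9ab7012)))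
  (equal 0x9b (twin 0x8b9) (equal 0x3a (twin 0x2a3) (c₄ 0xba93))))) (p₇ 0xb789316))) (edge 0x3b
  (edge 0x0b (equal 0x1b (twin 0x2b1) (equal 0x03 (twin 0x730) (c₄ 0xb310))) (edge 0x69
  (p₇ 0x9623b70) (p₇ 0x987b316))) (edge 0x69 (p₇ 0xb789613) (edge 0x3a (edge 0x6a (equal 0x36
  (twin 0x463) (equal 0x2a (twin 0x92a) (c₄ 0x6a32))) (p₇ 0x623a980)) (edge 0x6a (p₇ 0x326a980)
  (edge 0x4a (edge 0x1a (equal 0x3a (twin 0x2a3) (equal 0x14 (twin 0x041) (c₄ 0xa431))) (edge 0x0b
  (edge 0x4b (edge 0x48 (equal 0x8b (twin 0x9b8) (equal 0x04 (twin 0x140) (c₄ 0xb480)))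
  (p₇ 0x80b4326)) (p₇ 0x6234ab0)) (p₇ 0x9ab7012))) (edge 0x49 (edge 0x4b (equal 0x9b (twin 0x8b9)
  (equal 0x4a (twin 0x3a4) (c₄ 0xba94))) (p₇ 0xba94326)) (edge 0x48 (p₇ 0xa984326) (edge 0x47
  (p₇ 0xa987432) (edge 0x1a (p₇ 0x789a134) (p₇ 0xa980134))))))))))))))) (edge 0x3a (edge 0x6a
  (equal 0x36 (twin 0x463) (equal 0x2a (twin 0x92a) (c₄ 0x6a32))) (edge 0x1a (fan 0xa3261)
  (edge 0x0a (equal 0x1a (twin 0x2a1) (equal 0x03 (twin 0x730) (c₄ 0xa310))) (edge 0x68
  (p₇ 0xa326870) (edge 0x39 (edge 0x69 (equal 0x36 (twin 0x463) (equal 0x29 (twin 0x829)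
  (c₄ 0x6932))) (p₇ 0x6239870)) (p₇ 0x23a9870)))))) (edge 0x39 (edge 0x69 (equal 0x36 (twin 0x463)
  (equal 0x29 (twin 0x829) (c₄ 0x6932))) (edge 0x3b (equal 0x9b (twin 0x8b9) (equal 0x3a
  (twin 0x2a3) (c₄ 0xba93))) (edge 0x19 (fan 0x93261) (edge 0x68 (edge 0x6a (equal 0x8a
  (twin 0x7a8) (equal 0x69 (twin 0x196) (c₄ 0xa986))) (p₇ 0xab78623)) (p₇ 0x6239870))))) (edge 0x6a
  (edge 0x1a (fan 0xa6231) (edge 0x0a (equal 0x1a (twin 0x2a1) (equal 0x06 (twin 0x760)
  (c₄ 0xa610))) (edge 0x19 (edge 0x69 (fan 0x96231) (equal 0x69 (twin 0x296) (equal 0x1a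
  (twin 0x0a1) (c₄ 0x9a61)))) (p₇ 0xa987012)))) (edge 0x3b (edge 0x1b (fan 0xb3261) (edge 0x0b
  (equal 0x1b (twin 0x2b1) (equal 0x03 (twin 0x730) (c₄ 0xb310))) (edge 0x0a (equal 0x7a
  (twin 0x8a7) (equal 0x0b (twin 0x1b0) (c₄ 0xab70))) (edge 0x1a (equal 0x3a (twin 0x2a3)
  (equal 0x1b (twin 0x0b1) (c₄ 0xab31))) (edge 0x19 (edge 0x69 (fan 0x96231) (edge 0x68 (equal 0x69
  (twin 0x296) (equal 0x18 (twin 0x081) (c₄ 0x9861))) (p₇ 0x987b326))) (p₇ 0x89ab310))))))
  (edge 0x68 (p₇ 0xab78623) (edge 0x69 (p₇ 0x3269870) (edge 0x1b (edge 0x4b (equal 0x3b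
  (twin 0x2b3) (equal 0x14 (twin 0x041) (c₄ 0xb431))) (edge 0x5b (equal 0x6b (twin 0x2b6)
  (equal 0x15 (twin 0x051) (c₄ 0xb561))) (edge 0x1a (edge 0x4a (equal 0x3a (twin 0x2a3) (equal 0x14
  (twin 0x041) (c₄ 0xa431))) (edge 0x5a (equal 0x6a (twin 0x2a6) (equal 0x15 (twin 0x051)
  (c₄ 0xa561))) (edge 0x57 (p₇ 0xab75623) (edge 0x58 (p₇ 0x3265870) (edge 0x47 (p₇ 0xab74562)
  (edge 0x48 (p₇ 0x6234870) (p₇ 0x8701654))))))) (edge 0x19 (equal 0x9b (twin 0x8b9) (equal 0x1a
  (twin 0x2a1) (c₄ 0xba91))) (edge 0x0a (edge 0x47 (edge 0x4a (equal 0x7a (twin 0x8a7) (equal 0x04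
  (twin 0x140) (c₄ 0xa470))) (p₇ 0xa074326)) (edge 0x48 (p₇ 0x6234870) (edge 0x49 (p₇ 0x2349870)
  (p₇ 0x9870134)))) (p₇ 0xa987012)))))) (edge 0x47 (edge 0x4a (edge 0x0a (equal 0x7a (twin 0x8a7)
  (equal 0x04 (twin 0x140) (c₄ 0xa470))) (edge 0x4b (edge 0x49 (fan 0x9ab74) (edge 0x48 (equal 0x8a
  (twin 0x7a8) (equal 0x49 (twin 0x394) (c₄ 0xa984))) (p₇ 0x9874326))) (equal 0x7a (twin 0x0a7)
  (equal 0x4b (twin 0x3b4) (c₄ 0xab74))))) (edge 0x4b (edge 0x49 (equal 0x9b (twin 0x8b9)
  (equal 0x4a (twin 0x3a4) (c₄ 0xba94))) (p₇ 0x9ab4326)) (p₇ 0xab74326))) (edge 0x48 (p₇ 0x6234870)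
  (edge 0x49 (p₇ 0x2349870) (edge 0x4b (p₇ 0x987b432) (edge 0x19 (p₇ 0xb789134)
  (p₇ 0x9870134))))))))))))))))))))

cert-edge₁ : Cert
cert-edge₁ =
  edge 0x37 (edge 0x17 (fan 0x23701) (equal 0x17 (twin 0x271) (equal 0x03 (twin 0x203)
  (c₄ 0x7310)))) (edge 0x39 (edge 0x09 (equal 0x19 (twin 0x291) (equal 0x03 (twin 0x730)
  (c₄ 0x9310))) (edge 0x69 (equal 0x36 (twin 0x163) (equal 0x29 (twin 0x192) (c₄ 0x6932)))
  (edge 0x18 (edge 0x38 (fan 0x98123) (equal 0x38 (twin 0x283) (equal 0x19 (twin 0x091)
  (c₄ 0x8931)))) (edge 0x3b (edge 0x3a (edge 0x1a (fan 0x9a123) (edge 0x0a (equal 0x1a (twin 0x2a1)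
  (equal 0x03 (twin 0x730) (c₄ 0xa310))) (edge 0x1b (fan 0x9ab13) (edge 0x0b (equal 0x1b
  (twin 0x2b1) (equal 0x03 (twin 0x730) (c₄ 0xb310))) (edge 0x17 (equal 0x37 (twin 0x273)
  (equal 0x1b (twin 0x0b1) (c₄ 0x7b31))) (p₇ 0x9ab7012)))))) (equal 0x9b (twin 0x8b9) (equal 0x3a
  (twin 0x2a3) (c₄ 0xba93)))) (edge 0x1a (edge 0x3a (fan 0x9a123) (equal 0x3a (twin 0x2a3)
  (equal 0x19 (twin 0x091) (c₄ 0xa931)))) (edge 0x38 (edge 0x08 (equal 0x18 (twin 0x281)
  (equal 0x03 (twin 0x730) (c₄ 0x8310))) (edge 0x17 (equal 0x37 (twin 0x273) (equal 0x18
  (twin 0x081) (c₄ 0x7831))) (edge 0x68 (equal 0x36 (twin 0x163) (equal 0x28 (twin 0x182)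
  (c₄ 0x6832))) (edge 0x0a (edge 0x67 (edge 0x6a (equal 0x7a (twin 0x8a7) (equal 0x06 (twin 0x160)
  (c₄ 0xa670))) (p₇ 0xa987621)) (p₇ 0x9870126)) (p₇ 0xa987012))))) (edge 0x3a (edge 0x0a
  (equal 0x1a (twin 0x2a1) (equal 0x03 (twin 0x730) (c₄ 0xa310))) (edge 0x1b (equal 0x3b
  (twin 0x2b3) (equal 0x1a (twin 0x0a1) (c₄ 0xba31))) (edge 0x6a (equal 0x36 (twin 0x163)
  (equal 0x2a (twin 0x1a2) (c₄ 0x6a32))) (edge 0x17 (edge 0x67 (equal 0x27 (twin 0x372) (equal 0x16
  (twin 0x061) (c₄ 0x7621))) (edge 0x68 (edge 0x6b (equal 0x8b (twin 0x9b8) (equal 0x67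
  (twin 0x276) (c₄ 0xb786))) (p₇ 0xba98621)) (p₇ 0xa987126))) (edge 0x08 (edge 0x0b (edge 0x68
  (edge 0x6b (equal 0x8b (twin 0x9b8) (equal 0x06 (twin 0x160) (c₄ 0xb680))) (p₇ 0xba98621))
  (p₇ 0xa980126)) (p₇ 0x9ab7012)) (p₇ 0xa987012)))))) (edge 0x0a (edge 0x08 (equal 0x8a
  (twin 0x7a8) (equal 0x09 (twin 0x190) (c₄ 0xa980))) (edge 0x6a (edge 0x67 (equal 0x7a
  (twin 0x8a7) (equal 0x06 (twin 0x160) (c₄ 0xa670))) (edge 0x68 (equal 0x8a (twin 0x7a8)
  (equal 0x69 (twin 0x296) (c₄ 0xa986))) (p₇ 0x6239870))) (edge 0x68 (c₇ 0xa986210)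
  (p₇ 0x89a0126)))) (edge 0x0b (edge 0x1b (edge 0x6b (equal 0x2b (twin 0x3b2) (equal 0x16
  (twin 0x061) (c₄ 0xb621))) (edge 0x6a (edge 0x67 (equal 0x7a (twin 0x0a7) (equal 0x6b
  (twin 0x2b6) (c₄ 0xab76))) (edge 0x68 (equal 0x8a (twin 0x7a8) (equal 0x69 (twin 0x296)
  (c₄ 0xa986))) (p₇ 0x87ba623))) (p₇ 0x6239ab0))) (edge 0x08 (edge 0x68 (edge 0x6b (equal 0x8b
  (twin 0x9b8) (equal 0x06 (twin 0x160) (c₄ 0xb680))) (edge 0x6a (equal 0x8a (twin 0x0a8)
  (equal 0x69 (twin 0x296) (c₄ 0xa986))) (p₇ 0x6239ab0))) (edge 0x6a (c₇ 0x89a6210)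
  (p₇ 0xa980126))) (p₇ 0x89ab012))) (p₇ 0x239ab70)))))))))) (edge 0x38 (edge 0x68 (equal 0x36
  (twin 0x163) (equal 0x28 (twin 0x728) (c₄ 0x6832))) (edge 0x3b (equal 0x8b (twin 0x9b8)
  (equal 0x37 (twin 0x273) (c₄ 0xb783))) (edge 0x3a (equal 0x8a (twin 0x7a8) (equal 0x39
  (twin 0x193) (c₄ 0xa983))) (edge 0x18 (edge 0x08 (fan 0x23801) (edge 0x17 (fan 0x38701)
  (equal 0x17 (twin 0x271) (equal 0x08 (twin 0x308) (c₄ 0x7810))))) (edge 0x08 (equal 0x18
  (twin 0x281) (equal 0x03 (twin 0x730) (c₄ 0x8310))) (edge 0x09 (equal 0x79 (twin 0xb97)
  (equal 0x08 (twin 0x180) (c₄ 0x9870))) (edge 0x17 (equal 0x37 (twin 0x273) (equal 0x18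
  (twin 0x081) (c₄ 0x7831))) (edge 0x67 (edge 0x69 (equal 0x79 (twin 0x097) (equal 0x68
  (twin 0x286) (c₄ 0x9876))) (edge 0x6a (edge 0x0a (equal 0x7a (twin 0x8a7) (equal 0x06
  (twin 0x160) (c₄ 0xa670))) (edge 0x1a (equal 0x2a (twin 0x3a2) (equal 0x16 (twin 0x061)
  (c₄ 0xa621))) (p₇ 0x89a6210))) (edge 0x0a (p₇ 0x62389a0) (edge 0x0b (p₇ 0x2389ab0) (edge 0x1b
  (equal 0x17 (twin 0x271) (equal 0x0b (twin 0xa0b) (c₄ 0x7b10))) (edge 0x1a (c₇ 0xa987621)
  (p₇ 0xba98310))))))) (edge 0x69 (c₇ 0x7896210) (p₇ 0x9870126)))))))))) (edge 0x18 (edge 0x68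
  (equal 0x28 (twin 0x382) (equal 0x16 (twin 0x061) (c₄ 0x8621))) (edge 0x48 (equal 0x38
  (twin 0x283) (equal 0x14 (twin 0x041) (c₄ 0x8431))) (edge 0x1a (equal 0x8a (twin 0x7a8)
  (equal 0x19 (twin 0x291) (c₄ 0xa981))) (edge 0x1b (edge 0x6b (equal 0x2b (twin 0x72b) (equal 0x16
  (twin 0x061) (c₄ 0xb621))) (edge 0x17 (edge 0x67 (equal 0x27 (twin 0x372) (equal 0x16
  (twin 0x061) (c₄ 0x7621))) (edge 0x47 (equal 0x37 (twin 0x273) (equal 0x14 (twin 0x041)
  (c₄ 0x7431))) (edge 0x3b (fan 0x7b321) (edge 0x4b (equal 0x3b (twin 0x2b3) (equal 0x14
  (twin 0x041) (c₄ 0xb431))) (edge 0x49 (p₇ 0xb789432) (edge 0x69 (p₇ 0xb789623) (edge 0x58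
  (edge 0x5b (equal 0x8b (twin 0x9b8) (equal 0x15 (twin 0x051) (c₄ 0xb581))) (edge 0x57
  (fan 0xb1857) (p₇ 0xb785432))) (edge 0x59 (edge 0x57 (equal 0x79 (twin 0x197) (equal 0x58
  (twin 0x485) (c₄ 0x9875))) (p₇ 0x7895432)) (p₇ 0x9812654))))))))) (equal 0x8b (twin 0x9b8)
  (equal 0x17 (twin 0x271) (c₄ 0xb781))))) (edge 0x0a (edge 0x0b (edge 0x17 (fan 0xab710)
  (edge 0x08 (fan 0xb7810) (equal 0x17 (twin 0x271) (equal 0x08 (twin 0xa80) (c₄ 0x7810)))))
  (equal 0x7a (twin 0x8a7) (equal 0x0b (twin 0x1b0) (c₄ 0xab70)))) (edge 0x3b (edge 0x0b
  (equal 0x1b (twin 0x2b1) (equal 0x03 (twin 0x730) (c₄ 0xb310))) (edge 0x17 (equal 0x37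
  (twin 0x273) (equal 0x1b (twin 0x0b1) (c₄ 0x7b31))) (edge 0x6b (equal 0x36 (twin 0x163)
  (equal 0x2b (twin 0x1b2) (c₄ 0x6b32))) (edge 0x09 (edge 0x67 (edge 0x69 (equal 0x79 (twin 0xb97)
  (equal 0x06 (twin 0x160) (c₄ 0x9670))) (edge 0x6a (equal 0x7a (twin 0x0a7) (equal 0x6b
  (twin 0x2b6) (c₄ 0xab76))) (p₇ 0x9ab7621))) (edge 0x6a (c₇ 0x7ba6210) (p₇ 0xab70126)))
  (p₇ 0x9ab7012))))) (edge 0x69 (edge 0x67 (equal 0x79 (twin 0xb97) (equal 0x68 (twin 0x286)
  (c₄ 0x9876))) (edge 0x6b (edge 0x49 (edge 0x47 (equal 0x79 (twin 0xb97) (equal 0x48 (twin 0x384)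
  (c₄ 0x9874))) (edge 0x4b (equal 0x9b (twin 0x8b9) (equal 0x46 (twin 0x364) (c₄ 0xb694)))
  (p₇ 0xb789432))) (edge 0x4b (c₇ 0x896b431) (p₇ 0xb698134))) (p₇ 0xb789623))) (edge 0x17
  (edge 0x67 (equal 0x27 (twin 0x372) (equal 0x16 (twin 0x061) (c₄ 0x7621))) (edge 0x6b
  (p₇ 0x987b623) (edge 0x6a (edge 0x3a (equal 0x36 (twin 0x163) (equal 0x2a (twin 0x1a2)
  (c₄ 0x6a32))) (p₇ 0x789a623)) (p₇ 0x9ab7126)))) (edge 0x6a (edge 0x3a (equal 0x36 (twin 0x163)
  (equal 0x2a (twin 0x1a2) (c₄ 0x6a32))) (edge 0x67 (edge 0x6b (edge 0x0b (fan 0xa670b) (edge 0x09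
  (edge 0x47 (edge 0x49 (equal 0x79 (twin 0x697) (equal 0x04 (twin 0x140) (c₄ 0x9470))) (edge 0x57
  (edge 0x59 (equal 0x79 (twin 0x497) (equal 0x05 (twin 0x150) (c₄ 0x9570))) (p₇ 0x9012654))
  (equal 0x57 (twin 0x057) (equal 0x46 (twin 0x364) (c₄ 0x7654))))) (edge 0x4a (c₇ 0x76a4310)
  (p₇ 0xa670134))) (p₇ 0x9ab7012))) (equal 0x7a (twin 0x0a7) (equal 0x6b (twin 0x2b6)
  (c₄ 0xab76)))) (p₇ 0x789a623))) (edge 0x6b (c₇ 0x89ab621) (p₇ 0xba98126))))))))))) (edge 0x09
  (edge 0x08 (edge 0x17 (fan 0x98710) (edge 0x0a (fan 0xa9870) (edge 0x1a (equal 0x19 (twin 0x291)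
  (equal 0x0a (twin 0x7a0) (c₄ 0x9a10))) (edge 0x0b (equal 0x9b (twin 0x8b9) (equal 0x0a
  (twin 0x1a0) (c₄ 0xba90))) (edge 0x1b (equal 0x17 (twin 0x271) (equal 0x0b (twin 0x8b0)
  (c₄ 0x7b10))) (edge 0x67 (edge 0x69 (equal 0x79 (twin 0xb97) (equal 0x06 (twin 0x160)
  (c₄ 0x9670))) (edge 0x68 (fan 0x90768) (edge 0x6a (edge 0x3a (equal 0x36 (twin 0x163) (equal 0x2a
  (twin 0x1a2) (c₄ 0x6a32))) (edge 0x47 (edge 0x49 (equal 0x79 (twin 0x697) (equal 0x04
  (twin 0x140) (c₄ 0x9470))) (edge 0x57 (edge 0x59 (equal 0x79 (twin 0x497) (equal 0x05
  (twin 0x150) (c₄ 0x9570))) (p₇ 0x9012654)) (equal 0x57 (twin 0x057) (equal 0x46 (twin 0x364)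
  (c₄ 0x7654))))) (edge 0x4a (c₇ 0x76a4310) (p₇ 0xa670134)))) (p₇ 0xa987621)))) (edge 0x6b
  (edge 0x3b (equal 0x36 (twin 0x163) (equal 0x2b (twin 0x1b2) (c₄ 0x6b32))) (edge 0x68 (equal 0x8b
  (twin 0x0b8) (equal 0x67 (twin 0x276) (c₄ 0xb786))) (edge 0x69 (edge 0x49 (edge 0x47 (equal 0x79
  (twin 0xb97) (equal 0x04 (twin 0x140) (c₄ 0x9470))) (edge 0x59 (edge 0x57 (equal 0x79
  (twin 0xb97) (equal 0x05 (twin 0x150) (c₄ 0x9570))) (p₇ 0x7012654)) (equal 0x59 (twin 0x059)
  (equal 0x46 (twin 0x364) (c₄ 0x9654))))) (edge 0x4b (c₇ 0x96b4310) (p₇ 0xb690134)))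
  (p₇ 0x987b621)))) (edge 0x6a (c₇ 0x7ba6210) (p₇ 0xab70126))))))))) (equal 0x79 (twin 0xb97)
  (equal 0x08 (twin 0x180) (c₄ 0x9870)))) (edge 0x17 (edge 0x67 (equal 0x27 (twin 0x372)
  (equal 0x16 (twin 0x061) (c₄ 0x7621))) (edge 0x47 (equal 0x37 (twin 0x273) (equal 0x14
  (twin 0x041) (c₄ 0x7431))) (edge 0x3b (edge 0x1b (fan 0x7b321) (equal 0x37 (twin 0x273)
  (equal 0x1b (twin 0x2b1) (c₄ 0x7b31)))) (edge 0x1a (edge 0x6a (equal 0x2a (twin 0x92a)
  (equal 0x16 (twin 0x061) (c₄ 0xa621))) (edge 0x1b (edge 0x6b (equal 0x2b (twin 0x3b2) (equal 0x16
  (twin 0x061) (c₄ 0xb621))) (edge 0x4b (equal 0x3b (twin 0x2b3) (equal 0x14 (twin 0x041)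
  (c₄ 0xb431))) (edge 0x3a (fan 0xba321) (edge 0x4a (equal 0x3a (twin 0x2a3) (equal 0x14
  (twin 0x041) (c₄ 0xa431))) (edge 0x48 (p₇ 0xab78432) (edge 0x68 (p₇ 0xab78623) (edge 0x57
  (edge 0x5a (equal 0x7a (twin 0x8a7) (equal 0x15 (twin 0x051) (c₄ 0xa571))) (edge 0x5b
  (fan 0xa175b) (p₇ 0xab75432))) (edge 0x58 (edge 0x5b (equal 0x8b (twin 0x9b8) (equal 0x57
  (twin 0x475) (c₄ 0xb785))) (p₇ 0xb785432)) (p₇ 0x8712654))))))))) (equal 0x7a (twin 0x8a7)
  (equal 0x1b (twin 0x2b1) (c₄ 0xab71))))) (edge 0x6b (edge 0x1b (equal 0x2b (twin 0x3b2)
  (equal 0x16 (twin 0x061) (c₄ 0xb621))) (edge 0x68 (equal 0x8b (twin 0x9b8) (equal 0x67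
  (twin 0x276) (c₄ 0xb786))) (edge 0x69 (edge 0x08 (edge 0x0a (equal 0x8a (twin 0x7a8) (equal 0x09
  (twin 0x190) (c₄ 0xa980))) (edge 0x0b (edge 0x4b (edge 0x48 (equal 0x8b (twin 0x9b8) (equal 0x04
  (twin 0x140) (c₄ 0xb480))) (edge 0x5b (edge 0x58 (equal 0x8b (twin 0x9b8) (equal 0x05
  (twin 0x150) (c₄ 0xb580))) (p₇ 0x8012654)) (equal 0x5b (twin 0x05b) (equal 0x46 (twin 0x364)
  (c₄ 0xb654))))) (edge 0x49 (c₇ 0xb694310) (p₇ 0x96b0134))) (p₇ 0xba98012))) (p₇ 0x3269870))
  (p₇ 0x987b623)))) (edge 0x3a (edge 0x0a (equal 0x1a (twin 0x2a1) (equal 0x03 (twin 0x730)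
  (c₄ 0xa310))) (edge 0x1b (equal 0x3b (twin 0x2b3) (equal 0x1a (twin 0x0a1) (c₄ 0xba31)))
  (edge 0x6a (equal 0x36 (twin 0x163) (equal 0x2a (twin 0x1a2) (c₄ 0x6a32))) (edge 0x0b (edge 0x69
  (c₇ 0xba96210) (p₇ 0x9ab0126)) (p₇ 0x623ab70))))) (edge 0x68 (edge 0x6a (edge 0x48 (edge 0x4a
  (equal 0x8a (twin 0x7a8) (equal 0x46 (twin 0x364) (c₄ 0xa684))) (edge 0x4b (equal 0x8b
  (twin 0x6b8) (equal 0x47 (twin 0x374) (c₄ 0xb784))) (p₇ 0xab78432))) (edge 0x08 (edge 0x0a
  (equal 0x8a (twin 0x7a8) (equal 0x06 (twin 0x160) (c₄ 0xa680))) (edge 0x4a (c₇ 0x86a4310)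
  (p₇ 0xa680134))) (p₇ 0x4326870))) (p₇ 0xab78623)) (edge 0x69 (p₇ 0xb789623) (edge 0x6a
  (p₇ 0x6a98713) (p₇ 0xa987126)))))))))) (edge 0x6a (edge 0x1a (equal 0x2a (twin 0x92a) (equal 0x16
  (twin 0x061) (c₄ 0xa621))) (edge 0x3a (equal 0x36 (twin 0x163) (equal 0x2a (twin 0x1a2)
  (c₄ 0x6a32))) (edge 0x67 (edge 0x0a (equal 0x7a (twin 0x8a7) (equal 0x06 (twin 0x160)
  (c₄ 0xa670))) (edge 0x6b (edge 0x69 (fan 0x9ab76) (p₇ 0x9a67013)) (equal 0x7a (twin 0x0a7)
  (equal 0x6b (twin 0x2b6) (c₄ 0xab76))))) (edge 0x57 (edge 0x0a (edge 0x5a (equal 0x7a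
  (twin 0x8a7) (equal 0x05 (twin 0x150) (c₄ 0xa570))) (edge 0x4a (equal 0x5a (twin 0x7a5)
  (equal 0x46 (twin 0x364) (c₄ 0xa654))) (c₇ 0xa654310))) (edge 0x5a (edge 0x59 (edge 0x58
  (fan 0xa9875) (equal 0x79 (twin 0x097) (equal 0x58 (twin 0xa85) (c₄ 0x9875)))) (p₇ 0x9a57012))
  (p₇ 0xa657013))) (edge 0x47 (c₇ 0x7456210) (p₇ 0x7012654)))))) (edge 0x6b (edge 0x1b (equal 0x2b
  (twin 0x72b) (equal 0x16 (twin 0x061) (c₄ 0xb621))) (edge 0x3b (equal 0x36 (twin 0x163)
  (equal 0x2b (twin 0x1b2) (c₄ 0x6b32))) (edge 0x69 (equal 0x9b (twin 0x8b9) (equal 0x6a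
  (twin 0x2a6) (c₄ 0xba96))) (edge 0x68 (edge 0x67 (edge 0x0b (edge 0x08 (equal 0x8b (twin 0x9b8)
  (equal 0x06 (twin 0x160) (c₄ 0xb680))) (fan 0x86b07)) (edge 0x0a (equal 0x7a (twin 0x6a7)
  (equal 0x0b (twin 0x1b0) (c₄ 0xab70))) (edge 0x08 (fan 0xb6807) (edge 0x1a (edge 0x3a
  (p₇ 0x9a32670) (edge 0x4a (equal 0x3a (twin 0x2a3) (equal 0x14 (twin 0x041) (c₄ 0xa431)))
  (edge 0x4b (edge 0x48 (equal 0x8b (twin 0x9b8) (equal 0x46 (twin 0x364) (c₄ 0xb684)))
  (p₇ 0x86b4310)) (edge 0x48 (p₇ 0xb684310) (p₇ 0x86ba134))))) (p₇ 0xa986210))))) (equal 0x8b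
  (twin 0x9b8) (equal 0x67 (twin 0x276) (c₄ 0xb786)))) (edge 0x67 (edge 0x1a (c₇ 0xa987621)
  (p₇ 0xa987621)) (p₇ 0x987b621)))))) (edge 0x0a (edge 0x08 (equal 0x8a (twin 0x7a8) (equal 0x09
  (twin 0x190) (c₄ 0xa980))) (edge 0x3a (edge 0x1a (fan 0x23a01) (equal 0x1a (twin 0x2a1)
  (equal 0x03 (twin 0x730) (c₄ 0xa310)))) (edge 0x69 (edge 0x67 (edge 0x47 (edge 0x4a (equal 0x7a
  (twin 0x6a7) (equal 0x04 (twin 0x140) (c₄ 0xa470))) (edge 0x49 (equal 0x79 (twin 0x097)
  (equal 0x46 (twin 0x364) (c₄ 0x9674))) (p₇ 0x43269a0))) (edge 0x49 (c₇ 0x7694310)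
  (p₇ 0x9670134))) (p₇ 0x70a9623)) (edge 0x68 (p₇ 0x32689a0) (edge 0x67 (p₇ 0x9a07623)
  (p₇ 0x9870126)))))) (edge 0x1b (edge 0x0b (edge 0x08 (fan 0x87b10) (edge 0x1a (fan 0xa107b)
  (p₇ 0xa987012))) (equal 0x17 (twin 0x271) (equal 0x0b (twin 0xa0b) (c₄ 0x7b10)))) (edge 0x0b
  (edge 0x1a (equal 0x1b (twin 0x2b1) (equal 0x0a (twin 0x7a0) (c₄ 0xba10))) (edge 0x69
  (c₇ 0xba96210) (p₇ 0x9ab0126))) (edge 0x1a (edge 0x3a (edge 0x3b (fan 0xba123) (edge 0x08
  (edge 0x67 (edge 0x69 (edge 0x68 (fan 0x96708) (equal 0x79 (twin 0x097) (equal 0x68 (twin 0x286)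
  (c₄ 0x9876)))) (p₇ 0x9a32670)) (p₇ 0x623ab70)) (p₇ 0x23a9870))) (edge 0x4a (equal 0x3a
  (twin 0x2a3) (equal 0x14 (twin 0x041) (c₄ 0xa431))) (edge 0x3b (equal 0x3a (twin 0x2a3)
  (equal 0x1b (twin 0x0b1) (c₄ 0xab31))) (edge 0x67 (edge 0x69 (edge 0x49 (edge 0x47 (equal 0x79
  (twin 0x097) (equal 0x46 (twin 0x364) (c₄ 0x9674))) (c₇ 0x7694310)) (edge 0x47 (c₇ 0xa967431)
  (p₇ 0x9670134))) (p₇ 0x9ab7623)) (edge 0x69 (p₇ 0x269ab70) (edge 0x68 (p₇ 0x687ba13)
  (p₇ 0x789a126))))))) (p₇ 0x9ab7012))))))))))))

cert-edge₂ : Cert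
cert-edge₂ =
  edge 0x69 (equal 0x29 (twin 0x392) (equal 0x16 (twin 0x061) (c₄ 0x9621))) (edge 0x49 (equal 0x39
  (twin 0x293) (equal 0x14 (twin 0x041) (c₄ 0x9431))) (edge 0x38 (edge 0x18 (fan 0x98321)
  (equal 0x39 (twin 0x293) (equal 0x18 (twin 0x281) (c₄ 0x9831)))) (edge 0x37 (edge 0x17
  (fan 0x23701) (equal 0x17 (twin 0x271) (equal 0x03 (twin 0x203) (c₄ 0x7310)))) (edge 0x3a
  (edge 0x1a (fan 0x9a321) (equal 0x39 (twin 0x293) (equal 0x1a (twin 0x2a1) (c₄ 0x9a31))))
  (edge 0x1b (edge 0x6b (equal 0x2b (twin 0x72b) (equal 0x16 (twin 0x061) (c₄ 0xb621))) (edge 0x1a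
  (edge 0x6a (equal 0x2a (twin 0x3a2) (equal 0x16 (twin 0x061) (c₄ 0xa621))) (edge 0x4a (equal 0x3a
  (twin 0x2a3) (equal 0x14 (twin 0x041) (c₄ 0xa431))) (edge 0x3b (fan 0xab321) (edge 0x4b
  (equal 0x3b (twin 0x2b3) (equal 0x14 (twin 0x041) (c₄ 0xb431))) (edge 0x17 (fan 0x9ab71)
  (edge 0x18 (equal 0x8b (twin 0x9b8) (equal 0x17 (twin 0x271) (c₄ 0xb781))) (edge 0x47
  (p₇ 0x9ab7432) (edge 0x48 (p₇ 0xab78432) (edge 0x67 (p₇ 0x9ab7623) (edge 0x57 (edge 0x59
  (edge 0x5b (equal 0x9b (twin 0x8b9) (equal 0x15 (twin 0x051) (c₄ 0xb591))) (edge 0x5a (equal 0x7a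
  (twin 0x8a7) (equal 0x5b (twin 0x4b5) (c₄ 0xab75))) (p₇ 0xab75432))) (edge 0x58 (edge 0x5a
  (equal 0x8a (twin 0x7a8) (equal 0x59 (twin 0x495) (c₄ 0xa985))) (p₇ 0xa985432)) (p₇ 0x4578912)))
  (p₇ 0x7012654))))))))))) (equal 0x9b (twin 0x8b9) (equal 0x1a (twin 0x2a1) (c₄ 0xba91)))))
  (edge 0x0a (edge 0x0b (edge 0x09 (fan 0x9ab70) (edge 0x1a (fan 0xb019a) (equal 0x1a (twin 0x2a1)
  (equal 0x09 (twin 0x790) (c₄ 0xa910))))) (equal 0x7a (twin 0x8a7) (equal 0x0b (twin 0x1b0)
  (c₄ 0xab70)))) (edge 0x17 (edge 0x67 (equal 0x27 (twin 0x372) (equal 0x16 (twin 0x061)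
  (c₄ 0x7621))) (edge 0x47 (equal 0x37 (twin 0x273) (equal 0x14 (twin 0x041) (c₄ 0x7431)))
  (edge 0x3b (equal 0x37 (twin 0x273) (equal 0x1b (twin 0x2b1) (c₄ 0x7b31))) (edge 0x18 (edge 0x68
  (equal 0x28 (twin 0x382) (equal 0x16 (twin 0x061) (c₄ 0x8621))) (edge 0x48 (equal 0x38
  (twin 0x283) (equal 0x14 (twin 0x041) (c₄ 0x8431))) (edge 0x4b (p₇ 0x987b432) (edge 0x6b
  (p₇ 0x987b623) (edge 0x57 (edge 0x59 (equal 0x79 (twin 0xb97) (equal 0x15 (twin 0x051)
  (c₄ 0x9571))) (edge 0x58 (fan 0x91758) (p₇ 0x9875432))) (edge 0x5b (edge 0x58 (equal 0x8b
  (twin 0x1b8) (equal 0x57 (twin 0x475) (c₄ 0xb785))) (p₇ 0x87b5432)) (p₇ 0xb712654)))))))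
  (equal 0x79 (twin 0xb97) (equal 0x18 (twin 0x281) (c₄ 0x9871))))))) (edge 0x6a (edge 0x1a
  (equal 0x2a (twin 0x3a2) (equal 0x16 (twin 0x061) (c₄ 0xa621))) (edge 0x68 (equal 0x8a
  (twin 0x7a8) (equal 0x69 (twin 0x296) (c₄ 0xa986))) (edge 0x67 (edge 0x4a (edge 0x47 (equal 0x7a
  (twin 0x0a7) (equal 0x46 (twin 0x364) (c₄ 0xa674))) (c₇ 0x76a4310)) (edge 0x47 (c₇ 0x9a67431)
  (p₇ 0xa670134))) (p₇ 0x789a623)))) (edge 0x3b (edge 0x0b (equal 0x1b (twin 0x2b1) (equal 0x03
  (twin 0x730) (c₄ 0xb310))) (edge 0x1a (equal 0x3a (twin 0x2a3) (equal 0x1b (twin 0x0b1)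
  (c₄ 0xab31))) (edge 0x6b (equal 0x36 (twin 0x163) (equal 0x2b (twin 0x1b2) (c₄ 0x6b32)))
  (edge 0x67 (c₇ 0x9ab7621) (p₇ 0xab70126))))) (edge 0x09 (edge 0x4a (p₇ 0x6234a90) (edge 0x47
  (p₇ 0xa907432) (edge 0x67 (p₇ 0xa907623) (edge 0x57 (edge 0x59 (equal 0x79 (twin 0xb97)
  (equal 0x05 (twin 0x150) (c₄ 0x9570))) (p₇ 0x9075432)) (p₇ 0x7012654))))) (edge 0x18 (edge 0x08
  (fan 0x91078) (equal 0x17 (twin 0x271) (equal 0x08 (twin 0x908) (c₄ 0x7810)))) (edge 0x08
  (equal 0x18 (twin 0x281) (equal 0x09 (twin 0x790) (c₄ 0x8910))) (edge 0x68 (edge 0x6b (edge 0x67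
  (edge 0x0b (fan 0x86b07) (edge 0x48 (edge 0x4b (equal 0x8b (twin 0x9b8) (equal 0x46 (twin 0x364)
  (c₄ 0xb684))) (p₇ 0xb684310)) (edge 0x4b (p₇ 0x86b4310) (p₇ 0xb689134)))) (equal 0x8b
  (twin 0x9b8) (equal 0x67 (twin 0x276) (c₄ 0xb786)))) (p₇ 0xba98623)) (edge 0x67 (p₇ 0xa987623)
  (edge 0x6b (p₇ 0x6b78913) (p₇ 0xb789126))))))))))))))))

-- The last branch is a gem with hub 1 over the path 7, 3, 2, 9. The first two splits rule out the
-- edges 5-7 and 4-9, which is then used to see that 2 differs from 7 and 3 from 9.
cert-edge₃ : Cert
cert-edge₃ =
  edge 0x57 (equal 0x27 (twin 0x627) (equal 0x15 (twin 0x051) (c₄ 0x7521))) (edge 0x49 (equal 0x39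
  (twin 0x839) (equal 0x14 (twin 0x041) (c₄ 0x9431))) (edge 0x79 (equal 0x39 (twin 0x493)
  (equal 0x27 (twin 0x572) (c₄ 0x9732))) (fan 0x92371)))

-- From here up to `cert-bridges`, 0 to 5 run around a C₆ and larger numbers are extra vertices.
cert-near₀₀ : Cert
cert-near₀₀ =
  equal 0x15 (twin 0x251) (c₄ 0x7561)

cert-near₀₁ : Cert
cert-near₀₁ =
  edge 0x17 (edge 0x06 (edge 0x57 (fan 0x50127) (fan 0x71650)) (equal 0x15 (twin 0x251) (equal 0x06
  (twin 0x760) (c₄ 0x5610)))) (equal 0x17 (twin 0x671) (equal 0x02 (twin 0x520) (c₄ 0x7210)))

cert-near₀₂ : Cert
cert-near₀₂ =
  edge 0x07 (edge 0x27 (fan 0x32107) (equal 0x27 (twin 0x027) (equal 0x13 (twin 0x031)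
  (c₄ 0x7321)))) (edge 0x06 (edge 0x57 (equal 0x15 (twin 0x251) (equal 0x07 (twin 0x307)
  (c₄ 0x5710))) (fan 0x71056)) (equal 0x15 (twin 0x251) (equal 0x06 (twin 0x706) (c₄ 0x5610))))

cert-near₀₃ : Cert
cert-near₀₃ =
  edge 0x17 (edge 0x37 (fan 0x43217) (equal 0x37 (twin 0x137) (equal 0x24 (twin 0x142)
  (c₄ 0x7432)))) (edge 0x07 (equal 0x17 (twin 0x417) (equal 0x02 (twin 0x520) (c₄ 0x7210)))
  (edge 0x06 (edge 0x26 (fan 0x72106) (equal 0x26 (twin 0x026) (equal 0x17 (twin 0x071)
  (c₄ 0x6721)))) (equal 0x15 (twin 0x251) (equal 0x06 (twin 0x706) (c₄ 0x5610)))))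

cert-attach₀₂ : Cert
cert-attach₀₂ =
  edge 0x07 (edge 0x27 (fan 0x32107) (equal 0x27 (twin 0x027) (equal 0x13 (twin 0x031)
  (c₄ 0x7321)))) (edge 0x57 (equal 0x15 (twin 0x251) (equal 0x07 (twin 0x307) (c₄ 0x5710)))
  (edge 0x67 (edge 0x06 (fan 0x71056) (equal 0x15 (twin 0x251) (equal 0x06 (twin 0x706)
  (c₄ 0x5610)))) (edge 0x08 (edge 0x28 (hyp 1) (edge 0x18 (edge 0x27 (fan 0x27801) (equal 0x27
  (twin 0x827) (equal 0x13 (twin 0x031) (c₄ 0x7321)))) (equal 0x18 (twin 0x281) (equal 0x07
  (twin 0x570) (c₄ 0x8710))))) (edge 0x06 (edge 0x18 (fan 0x78601) (equal 0x67 (twin 0x076)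
  (equal 0x18 (twin 0x081) (c₄ 0x7861)))) (equal 0x15 (twin 0x251) (equal 0x06 (twin 0x806)
  (c₄ 0x5610)))))))

cert-attach₀₃ : Cert
cert-attach₀₃ =
  edge 0x17 (edge 0x37 (fan 0x43217) (equal 0x37 (twin 0x137) (equal 0x24 (twin 0x142)
  (c₄ 0x7432)))) (edge 0x07 (equal 0x17 (twin 0x417) (equal 0x02 (twin 0x520) (c₄ 0x7210)))
  (edge 0x57 (c₅ 0x57210) (edge 0x28 (edge 0x08 (hyp 1) (edge 0x48 (hyp 3) (edge 0x06 (edge 0x58
  (equal 0x57 (twin 0x075) (equal 0x48 (twin 0x248) (c₄ 0x7854))) (edge 0x46 (fan 0x45016)
  (edge 0x36 (equal 0x46 (twin 0x046) (equal 0x35 (twin 0x253) (c₄ 0x6543))) (edge 0x67 (equal 0x57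
  (twin 0x075) (equal 0x46 (twin 0x364) (c₄ 0x7654))) (c₅ 0x78654))))) (equal 0x15 (twin 0x251)
  (equal 0x06 (twin 0x806) (c₄ 0x5610)))))) (edge 0x26 (edge 0x06 (fan 0x50126) (equal 0x15
  (twin 0x251) (equal 0x06 (twin 0x206) (c₄ 0x5610)))) (edge 0x36 (equal 0x26 (twin 0x526)
  (equal 0x13 (twin 0x031) (c₄ 0x6321))) (edge 0x67 (equal 0x26 (twin 0x362) (equal 0x17
  (twin 0x071) (c₄ 0x6721))) (edge 0x18 (equal 0x28 (twin 0x628) (equal 0x17 (twin 0x071)
  (c₄ 0x8721))) (c₅ 0x68721))))))))

cert-spread : Cert
cert-spread =
  edge 0x56 (hyp 0) (edge 0x36 (hyp 2) (edge 0x06 (edge 0x26 (hyp 1) (edge 0x46 (hyp 5) (edge 0x27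
  (edge 0x07 (hyp 7) (equal 0x26 (twin 0x362) (equal 0x17 (twin 0x071) (c₄ 0x6721)))) (edge 0x37
  (c₅ 0x67321) (edge 0x57 (c₇ 0x6754321) (p₇ 0x7612345)))))) (edge 0x46 (c₅ 0x54610) (edge 0x07
  (edge 0x27 (hyp 7) (equal 0x17 (twin 0x271) (equal 0x06 (twin 0x560) (c₄ 0x7610)))) (edge 0x57
  (c₅ 0x57610) (edge 0x37 (c₇ 0x5437610) (p₇ 0x7610543)))))))

cert-share₀ : Cert
cert-share₀ =
  edge 0x56 (hyp 0) (edge 0x36 (hyp 2) (edge 0x57 (hyp 6) (edge 0x37 (hyp 8) (edge 0x06 (edge 0x26
  (hyp 1) (edge 0x46 (hyp 5) (edge 0x07 (edge 0x08 (fan 0x71850) (equal 0x15 (twin 0x251)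
  (equal 0x08 (twin 0x780) (c₄ 0x5810)))) (edge 0x27 (fan 0x27601) (edge 0x47 (c₅ 0x54710)
  (p₇ 0x7605432)))))) (edge 0x08 (fan 0x61058) (equal 0x15 (twin 0x251) (equal 0x08 (twin 0x608)
  (c₄ 0x5810))))))))

cert-share₁ : Cert
cert-share₁ =
  edge 0x18 (edge 0x07 (edge 0x27 (hyp 7) (fan 0x70821)) (edge 0x27 (fan 0x72801) (edge 0x06
  (edge 0x26 (hyp 1) (fan 0x76821)) (fan 0x76801)))) (equal 0x18 (twin 0x781) (equal 0x02
  (twin 0x520) (c₄ 0x8210)))

cert-share₂ : Cert
cert-share₂ =
  edge 0x56 (hyp 0) (edge 0x36 (hyp 2) (edge 0x57 (hyp 6) (edge 0x37 (hyp 8) (edge 0x26 (edge 0x06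
  (hyp 1) (edge 0x46 (hyp 3) (edge 0x27 (edge 0x28 (fan 0x71832) (equal 0x28 (twin 0x782)
  (equal 0x13 (twin 0x031) (c₄ 0x8321)))) (edge 0x07 (fan 0x26701) (edge 0x47 (c₅ 0x54710)
  (p₇ 0x7623450)))))) (edge 0x28 (fan 0x61238) (equal 0x28 (twin 0x628) (equal 0x13 (twin 0x031)
  (c₄ 0x8321))))))))

cert-bridges : Cert
cert-bridges =
  edge 0x26 (hyp 1) (edge 0x46 (hyp 5) (edge 0x17 (hyp 8) (edge 0x57 (hyp 10) (edge 0x58 (hyp 12)
  (edge 0x38 (hyp 14) (edge 0x29 (hyp 21) (edge 0x09 (hyp 23) (edge 0x27 (edge 0x07 (hyp 7)
  (edge 0x16 (equal 0x26 (twin 0x026) (equal 0x17 (twin 0x071) (c₄ 0x6721))) (c₅ 0x67210)))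
  (edge 0x07 (c₅ 0x73210) (edge 0x28 (edge 0x48 (hyp 15) (edge 0x39 (equal 0x38 (twin 0x483)
  (equal 0x29 (twin 0x429) (c₄ 0x8932))) (c₅ 0x89432))) (edge 0x48 (c₅ 0x84321) (edge 0x78
  (c₅ 0x87321) (edge 0x59 (edge 0x19 (hyp 18) (edge 0x08 (equal 0x58 (twin 0x485) (equal 0x09
  (twin 0x190) (c₄ 0x8950))) (c₅ 0x59810))) (edge 0x08 (c₅ 0x89450) (edge 0x47 (edge 0x56
  (equal 0x57 (twin 0x075) (equal 0x46 (twin 0x046) (c₄ 0x7654))) (c₅ 0x67450))
  (p₇ 0x8105437))))))))))))))))

cert-gap : Cert
cert-gap =
  equal 0x24 (twin 0x642) (equal 0x13 (twin 0x031) (c₄ 0x4321))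

cert-four : Cert
cert-four =
  fan 0x62341

cert-far : Cert
cert-far =
  edge 0x36 (edge 0x35 (edge 0x37 (fan 0x76543) (edge 0x38 (equal 0x68 (twin 0x586) (equal 0x37
  (twin 0x273) (c₄ 0x8763))) (p₇ 0x7843210))) (equal 0x46 (twin 0x864) (equal 0x35 (twin 0x253)
  (c₄ 0x6543)))) (edge 0x35 (edge 0x37 (equal 0x57 (twin 0x475) (equal 0x36 (twin 0x263)
  (c₄ 0x7653))) (p₇ 0x7653210)) (p₇ 0x6543210))

-- Decidable subsets, colour transpositions and maximal elements.

module _ {n : ℕ} {P : Fin n → Set} (P? : U.Decidable P) where

  ⟪_⟫ : Subset n
  ⟪_⟫ = tabulate (does ∘ P?)

  ∈⟪⟫⁺ : ∀ {i} → P i → i ∈ ⟪_⟫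
  ∈⟪⟫⁺ {i} p = lookup⇒[]= i ⟪_⟫ (trans (lookup∘tabulate (does ∘ P?) i) (dec-true (P? i) p))

  ∈⟪⟫⁻ : ∀ {i} → i ∈ ⟪_⟫ → P i
  ∈⟪⟫⁻ {i} i∈ with P? i | trans (sym (lookup∘tabulate (does ∘ P?) i)) ([]=⇒lookup i∈)
  ... | yes p | _ = p

-- If every colour below `k` occurred, sending each to its position in `xs` would put `k` pigeons
-- into fewer holes, yet colours at the same position are equal.
missing : ∀ k (xs : List ℕ) → length xs < k → ∃ λ c → c < k × ¬ c ∈ˡ xs
missing k xs short with Fin.any? {n = k} (λ i → ¬? (Any.any? (toℕ i ≟_) xs))
... | yes (i , i∉) = toℕ i , Fin.toℕ<n i , i∉
... | no all∈ = ⊥-elim (collision (Fin.pigeonhole short (λ i → Any.index (i∈ i))))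
  where
  i∈ : (i : Fin k) → toℕ i ∈ˡ xs
  i∈ i = decidable-stable (Any.any? (toℕ i ≟_) xs) λ i∉ → all∈ (i , i∉)
  collision : ¬ ∃₂ λ i j → toℕ i < toℕ j × Any.index (i∈ i) ≡ Any.index (i∈ j)
  collision (i , j , i<j , eq) = ℕ.<⇒≢ i<j
    (trans (lookup-index (i∈ i)) (trans (cong (List.lookup xs) eq) (sym (lookup-index (i∈ j)))))

transpose : ℕ → ℕ → ℕ → ℕ
transpose a b x with x ≟ a | x ≟ b
... | yes _ | _     = b
... | no _  | yes _ = a
... | no _  | no _  = x

transpose-first : ∀ a b → transpose a b a ≡ b
transpose-first a b with a ≟ a
... | yes _ = refl
... | no a≢a = ⊥-elim (a≢a refl)

transpose-second : ∀ {a b} → a ≢ b → transpose a b b ≡ a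
transpose-second {a} {b} a≢b with b ≟ a | b ≟ b
... | yes b≡a | _     = ⊥-elim (a≢b (sym b≡a))
... | no _    | yes _ = refl
... | no _    | no b≢b = ⊥-elim (b≢b refl)

transpose-other : ∀ {a b x} → x ≢ a → x ≢ b → transpose a b x ≡ x
transpose-other {a} {b} {x} x≢a x≢b with x ≟ a | x ≟ b
... | yes x≡a | _       = ⊥-elim (x≢a x≡a)
... | no _    | yes x≡b = ⊥-elim (x≢b x≡b)
... | no _    | no _    = refl

transpose-injective : ∀ a b {x y} → transpose a b x ≡ transpose a b y → x ≡ y
transpose-injective a b {x} {y} eq with x ≟ a | x ≟ b | y ≟ a | y ≟ b
... | yes p | _     | yes q | _     = trans p (sym q)
... | yes p | _     | no ¬q | yes r = ⊥-elim (¬q (trans r eq))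
... | yes p | _     | no ¬q | no ¬r = ⊥-elim (¬r (sym eq))
... | no ¬p | yes p | yes q | _     = ⊥-elim (¬p (trans p (sym eq)))
... | no ¬p | yes p | no ¬q | yes r = trans p (sym r)
... | no ¬p | yes p | no ¬q | no ¬r = ⊥-elim (¬q (sym eq))
... | no ¬p | no ¬r | yes q | _     = ⊥-elim (¬r eq)
... | no ¬p | no ¬r | no ¬q | yes r = ⊥-elim (¬p eq)
... | no ¬p | no ¬r | no ¬q | no _  = eq

transpose-< : ∀ {a b x k} → a < k → b < k → x < k → transpose a b x < k
transpose-< {a} {b} {x} a<k b<k x<k with x ≟ a | x ≟ b
... | yes _ | _     = b<k
... | no _  | yes _ = a<k
... | no _  | no _  = x<k

-- Every step takes a test that some candidate passes and keeps only the candidates passing it.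
maximal : ∀ {n} {X : Set} {Pass : Fin n → X → Set} (pass? : ∀ u x → Dec (Pass u x)) (xs : List X)
          {A : Fin n → Set} → U.Decidable A → ∃ A →
          ∃ λ v → A v × ∀ u → A u → All (λ x → Pass v x → Pass u x) xs → All (λ x → Pass u x → Pass v x) xs
maximal pass? [] A? (v , v∈A) = v , v∈A , λ _ _ _ → []
maximal pass? (x ∷ xs) A? (v₀ , v₀∈A) with Fin.any? (λ u → A? u ×-dec pass? u x)
... | yes u₀ with maximal pass? xs (λ u → A? u ×-dec pass? u x) u₀
...   | v , (v∈A , vx) , max = v , v∈A , λ { u u∈A (le ∷ les) → (λ _ → vx) ∷ max u (u∈A , le vx) les }
maximal pass? (x ∷ xs) A? (v₀ , v₀∈A) | no none with maximal pass? xs A? (v₀ , v₀∈A)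
...   | v , v∈A , max = v , v∈A , λ { u u∈A (_ ∷ les) → (λ ux → ⊥-elim (none (u , u∈A , ux))) ∷ max u u∈A les }

-- Colourings of vertex subsets, clique cutsets and induced paths.

module Colourings (G : Graph) where
  open Vertices G

  CliqueIn : (V → Set) → Set
  CliqueIn S = ∀ {u v} → S u → S v → u ≢ v → u ~ v

  -- Cliques are lists here, so that a vertex is added by a cons. Adjacency is irreflexive, so
  -- pairwise adjacent entries are distinct and the length is the size of the clique.
  CliquesBounded : Subset (order G) → ℕ → Set
  CliquesBounded A k = ∀ K → All (_∈ A) K → AllPairs _~_ K → length K ≤ k

  -- Colours are numbers defined on all vertices and constrained only on `A`, so permuting and
  -- pasting need no membership proof to evaluate a colour.
  record Colouring (A : Subset (order G)) (k : ℕ) : Set where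
    field
      colour  : V → ℕ
      bounded : ∀ {v} → v ∈ A → colour v < k
      proper  : ∀ {u v} → u ∈ A → v ∈ A → u ~ v → colour u ≢ colour v

  open Colouring public

  bounded-⊆ : ∀ {A B k} → B ⊆ A → CliquesBounded A k → CliquesBounded B k
  bounded-⊆ B⊆A ω≤k K K⊆B = ω≤k K (All.map B⊆A K⊆B)

  recolour : ∀ {A k} (c : Colouring A k) {a b} → a < k → b < k → Colouring A k
  recolour c {a} {b} a<k b<k .colour = transpose a b ∘ colour c
  recolour c a<k b<k .bounded v∈A = transpose-< a<k b<k (bounded c v∈A)
  recolour c {a} {b} a<k b<k .proper u∈A v∈A uv eq = proper c u∈A v∈A uv (transpose-injective a b eq)

  -- One transposition per vertex of the clique. Matched vertices stay matched: both colourings are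
  -- injective on a clique, so neither exchanged colour occurs at another matched vertex.
  agreeOn : ∀ {X Y k} (c : Colouring X k) (d : Colouring Y k) {S : V → Set} → CliqueIn S →
            (∀ {s} → S s → s ∈ X × s ∈ Y) → (K : List V) → All S K →
            ∃ λ (d′ : Colouring Y k) → All (λ s → colour d′ s ≡ colour c s) K
  agreeOn c d S-clique S⊆ [] [] = d , []
  agreeOn {X} {Y} {k} c d {S} S-clique S⊆ (x ∷ K) (x∈S ∷ K⊆S) with agreeOn c d S-clique S⊆ K K⊆S
  ... | d₁ , agree with colour d₁ x ≟ colour c x
  ...   | yes eq = d₁ , eq ∷ agree
  ...   | no ne  = recolour d₁ (bounded d₁ (proj₂ (S⊆ x∈S))) (bounded c (proj₁ (S⊆ x∈S)))
                 , transpose-first (colour d₁ x) (colour c x) ∷ All.map fixed (All.zip (K⊆S , agree))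
    where
    fixed : ∀ {y} → S y × colour d₁ y ≡ colour c y →
            transpose (colour d₁ x) (colour c x) (colour d₁ y) ≡ colour c y
    fixed {y} (y∈S , eq) with y Fin.≟ x
    ... | yes refl = ⊥-elim (ne eq)
    ... | no y≢x = trans (transpose-other
      (proper d₁ (proj₂ (S⊆ y∈S)) (proj₂ (S⊆ x∈S)) (S-clique y∈S x∈S y≢x))
      λ eq′ → proper c (proj₁ (S⊆ y∈S)) (proj₁ (S⊆ x∈S)) (S-clique y∈S x∈S y≢x) (trans (sym eq) eq′)) eq

  glue : ∀ {A X Y k} {S : V → Set} → U.Decidable S → CliqueIn S →
         (∀ {s} → S s → s ∈ X × s ∈ Y) → (∀ {v} → v ∈ A → v ∈ X ⊎ v ∈ Y) →
         (∀ {u v} → u ∈ X → v ∈ Y → v ∉ X → u ~ v → S u) →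
         Colouring X k → Colouring Y k → Colouring A k
  glue {A} {X} {Y} {k} {S} S? S-clique S⊆ cover border c d =
    record { colour = e ; bounded = e-bounded ; proper = e-proper }
    where
    agreed = agreeOn c d S-clique S⊆ (filter S? (allFin _)) (all-filter S? (allFin _))
    d′ = proj₁ agreed
    agree : ∀ {s} → S s → colour d′ s ≡ colour c s
    agree {s} s∈S = All.lookup (proj₂ agreed) (∈-filter⁺ S? (∈-allFin s) s∈S)
    e : V → ℕ
    e v with v ∈? X
    ... | yes _ = colour c v
    ... | no _  = colour d′ v
    inY : ∀ {v} → v ∈ A → v ∉ X → v ∈ Y
    inY v∈A v∉X with cover v∈A
    ... | inj₁ v∈X = ⊥-elim (v∉X v∈X)
    ... | inj₂ v∈Y = v∈Y
    e-bounded : ∀ {v} → v ∈ A → e v < k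
    e-bounded {v} v∈A with v ∈? X
    ... | yes v∈X = bounded c v∈X
    ... | no v∉X  = bounded d′ (inY v∈A v∉X)
    -- An edge leaving `X` starts in `S`, where the two colourings have been made to agree.
    cross : ∀ {u v} → u ∈ X → v ∈ A → v ∉ X → u ~ v → colour c u ≢ colour d′ v
    cross u∈X v∈A v∉X uv eq =
      let u∈S = border u∈X (inY v∈A v∉X) v∉X uv
      in proper d′ (proj₂ (S⊆ u∈S)) (inY v∈A v∉X) uv (trans (agree u∈S) eq)
    e-proper : ∀ {u v} → u ∈ A → v ∈ A → u ~ v → e u ≢ e v
    e-proper {u} {v} u∈A v∈A uv with u ∈? X | v ∈? X
    ... | yes u∈X | yes v∈X = proper c u∈X v∈X uv
    ... | yes u∈X | no v∉X  = cross u∈X v∈A v∉X uv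
    ... | no u∉X  | yes v∈X = cross v∈X u∈A u∉X (~-sym uv) ∘ sym
    ... | no u∉X  | no v∉X  = proper d′ (inY u∈A u∉X) (inY v∈A v∉X) uv

  Step : Subset (order G) → V → V → Set
  Step M u v = u ∈ M × v ∈ M × u ~ v

  walk-sym : ∀ {M u v} → Star (Step M) u v → Star (Step M) v u
  walk-sym = reverse λ (u∈M , v∈M , uv) → v∈M , u∈M , ~-sym uv

  record Component (M : Subset (order G)) (x : V) : Set where
    field
      vertices : Subset (order G)
      start    : x ∈ vertices
      inside   : vertices ⊆ M
      closed   : ∀ {u v} → u ∈ vertices → v ∈ M → u ~ v → v ∈ vertices
      walk     : ∀ {u} → u ∈ vertices → Star (Step M) x u

  open Component public

  component : ∀ {M x} → x ∈ M → Component M x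
  component {M} {x} x∈M = grow (⊃-wellFounded ⁅ x ⁆) (x∈⁅x⁆ x)
    (λ u∈ → subst (_∈ M) (sym (x∈⁅y⁆⇒x≡y x u∈)) x∈M)
    (λ u∈ → subst (Star (Step M) x) (sym (x∈⁅y⁆⇒x≡y x u∈)) ε)
    where
    grow : ∀ {Z} → Acc _⊃_ Z → x ∈ Z → Z ⊆ M → (∀ {u} → u ∈ Z → Star (Step M) x u) → Component M x
    grow {Z} (acc rec) x∈Z Z⊆M reach
      with Fin.any? (λ u → Fin.any? λ v → (u ∈? Z) ×-dec (v ∈? M) ×-dec (u ~? v) ×-dec ¬? (v ∈? Z))
    ... | no stuck = record
      { vertices = Z ; start = x∈Z ; inside = Z⊆M ; walk = reach
      ; closed = λ {u} {v} u∈Z v∈M uv → decidable-stable (v ∈? Z) λ v∉Z → stuck (u , v , u∈Z , v∈M , uv , v∉Z) }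
    ... | yes (u , v , u∈Z , v∈M , uv , v∉Z) = grow
      (rec (p⊆p∪q ⁅ v ⁆ , v , x∈p∪q⁺ (inj₂ (x∈⁅x⁆ v)) , v∉Z)) (p⊆p∪q ⁅ v ⁆ x∈Z)
      (λ w∈ → caseZ w∈ Z⊆M v∈M) (λ w∈ → caseZ w∈ reach (reach u∈Z ◅◅ (Z⊆M u∈Z , v∈M , uv) ◅ ε))
      where
      caseZ : ∀ {Q : V → Set} {w} → w ∈ Z ∪ ⁅ v ⁆ → (∀ {w} → w ∈ Z → Q w) → Q v → Q w
      caseZ {Q} w∈ z q with x∈p∪q⁻ Z ⁅ v ⁆ w∈
      ... | inj₁ w∈Z = z w∈Z
      ... | inj₂ w∈v = subst Q (sym (x∈⁅y⁆⇒x≡y v w∈v)) q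

  Border : Subset (order G) → Subset (order G) → V → Set
  Border A Z s = s ∈ A × s ∉ Z × ∃ λ z → z ∈ Z × s ~ z

  border? : ∀ A Z → U.Decidable (Border A Z)
  border? A Z s = (s ∈? A) ×-dec ¬? (s ∈? Z) ×-dec Fin.any? λ z → (z ∈? Z) ×-dec (s ~? z)

  -- The two sides are `Z` with its border and `A` without `Z`; they overlap in the border. The
  -- vertices `w` and `x` witness that the first and the second side are proper subsets, as `rec`
  -- demands.
  cutset : ∀ {A Z k x w} → Z ⊆ A → x ∈ Z → CliqueIn (Border A Z) → w ∈ A → w ∉ Z → ¬ Border A Z w →
           (∀ {B} → B ⊂ A → Colouring B k) → Colouring A k
  cutset {A} {Z} {k} {x} {w} Z⊆A x∈Z clique w∈A w∉Z w∉S rec = glue (border? A Z) clique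
    (λ s → ∈⟪⟫⁺ X? (proj₁ s , inj₂ s) , ∈⟪⟫⁺ Y? (proj₁ s , proj₁ (proj₂ s))) cover border
    (rec {⟪ X? ⟫} ((λ v∈ → proj₁ (∈⟪⟫⁻ X? v∈)) , w , w∈A , λ w∈ → outside (proj₂ (∈⟪⟫⁻ X? w∈))))
    (rec {⟪ Y? ⟫} ((λ v∈ → proj₁ (∈⟪⟫⁻ Y? v∈)) , x , Z⊆A x∈Z , λ x∈ → proj₂ (∈⟪⟫⁻ Y? x∈) x∈Z))
    where
    X? : U.Decidable (λ v → v ∈ A × (v ∈ Z ⊎ Border A Z v))
    X? v = (v ∈? A) ×-dec ((v ∈? Z) ⊎-dec border? A Z v)
    Y? : U.Decidable (λ v → v ∈ A × v ∉ Z)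
    Y? v = (v ∈? A) ×-dec ¬? (v ∈? Z)
    outside : ¬ (w ∈ Z ⊎ Border A Z w)
    outside (inj₁ w∈Z) = w∉Z w∈Z
    outside (inj₂ w∈S) = w∉S w∈S
    cover : ∀ {v} → v ∈ A → v ∈ ⟪ X? ⟫ ⊎ v ∈ ⟪ Y? ⟫
    cover {v} v∈A with v ∈? Z
    ... | yes v∈Z = inj₁ (∈⟪⟫⁺ X? (v∈A , inj₁ v∈Z))
    ... | no v∉Z  = inj₂ (∈⟪⟫⁺ Y? (v∈A , v∉Z))
    border : ∀ {u v} → u ∈ ⟪ X? ⟫ → v ∈ ⟪ Y? ⟫ → v ∉ ⟪ X? ⟫ → u ~ v → Border A Z u
    border {u} {v} u∈ v∈ v∉ uv with proj₂ (∈⟪⟫⁻ X? u∈) | ∈⟪⟫⁻ Y? v∈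
    ... | inj₂ u∈S | _ = u∈S
    ... | inj₁ u∈Z | v∈A , v∉Z = ⊥-elim (v∉ (∈⟪⟫⁺ X? (v∈A , inj₂ (v∈A , v∉Z , u , u∈Z , ~-sym uv))))

  -- Path T x ys: x followed by ys is an induced path whose last vertex is the only one in T.
  data Path (T : V → Set) : V → List V → Set where
    stop : ∀ {x} → T x → Path T x []
    step : ∀ {x y ys} → ¬ T x → x ~ y → All (λ z → ¬ x ~ z) ys → Path T y ys → Path T x (y ∷ ys)

  module _ {T : V → Set} (T? : U.Decidable T) where

    -- If `x` sees a vertex beyond `y`, the path is entered later: dropping its front keeps it
    -- induced and keeps its end. The recursion stops at the last neighbour of `x`.
    prepend : ∀ {Q : V → Set} {x y ys} → ¬ T x → Any (x ~_) (y ∷ ys) → Path T y ys → All Q (y ∷ ys) →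
              ∃ λ zs → Path T x zs × All Q zs
    prepend {x = x} {ys = ys} x∉T xys p qs with Any.any? (x ~?_) ys
    prepend x∉T _ (step _ _ _ p) (_ ∷ qs) | yes xys = prepend x∉T xys p qs
    prepend x∉T (here xy) p qs | no ¬xys = _ , step x∉T xy (¬Any⇒All¬ _ ¬xys) p , qs
    prepend x∉T (there xys) p qs | no ¬xys = ⊥-elim (¬xys xys)

    walk⇒path : ∀ {M x y} → Star (Step M) x y → T y → ∃ λ zs → Path T x zs × All (_∈ M) zs
    walk⇒path ε y∈T = [] , stop y∈T , []
    walk⇒path {x = x} ((_ , v∈M , xv) ◅ w) y∈T with T? x
    -- Cutting the walk at its first vertex in `T` keeps all earlier vertices out of `T`.
    ... | yes x∈T = [] , stop x∈T , []
    ... | no x∉T = let (zs , p , zs⊆M) = walk⇒path w y∈T in prepend x∉T (here xv) p (v∈M ∷ zs⊆M)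

-- Domination of C₅s.

cyc₅ : (a b c d e : ℕ) → List Lit
cyc₅ a b c d e = a ∼ b ∷ a ≁ c ∷ a ≁ d ∷ a ∼ e ∷ b ∼ c ∷ b ≁ d ∷ b ≁ e ∷ c ∼ d ∷ c ≁ e ∷ d ∼ e ∷ []

none₅ : (i a b c d e : ℕ) → List Lit
none₅ i a b c d e = i ≁ a ∷ i ≁ b ∷ i ≁ c ∷ i ≁ d ∷ i ≁ e ∷ []

module Pentagons (G : Graph) (free : (P 7 ∷ C 7 ∷ C 4 ∷ gem ∷ []) -Free G) where
  open Vertices G
  open Semantics G
  open Colourings G

  -- Past the end the last vertex is repeated: the assignment is total and, by `at-All`, stays in
  -- any set containing the listed vertices.
  at : V → List V → ℕ → V
  at x ys       zero    = x
  at x []       (suc _) = x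
  at x (y ∷ ys) (suc i) = at y ys i

  at-All : ∀ {W : V → Set} {x ys} → W x → All W ys → ∀ i → W (at x ys i)
  at-All w ws       zero    = w
  at-All w []       (suc _) = w
  at-All w (v ∷ ws) (suc i) = at-All v ws i

  IsC₅ : Vec V 5 → Set
  IsC₅ (a ∷ b ∷ c ∷ d ∷ e ∷ []) = All (Holds (at a (b ∷ c ∷ d ∷ e ∷ []))) (cyc₅ 0 1 2 3 4)

  holds? : ∀ φ l → Dec (Holds φ l)
  holds? φ (i ∼ j) = φ i ~? φ j
  holds? φ (i ≁ j) = ¬? (φ i ~? φ j)
  holds? φ (i ≐ j) = φ i Fin.≟ φ j
  holds? φ (i ≠ j) = ¬? (φ i Fin.≟ φ j)

  isC₅? : ∀ Q → Dec (IsC₅ Q)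
  isC₅? (a ∷ b ∷ c ∷ d ∷ e ∷ []) = All.all? (holds? _) _

  Dominates : V → Vec V 5 → Set
  Dominates v Q = Anyᵛ (v ~_) Q

  dominates? : ∀ v Q → Dec (Dominates v Q)
  dominates? v Q = Anyᵛ.any? (v ~?_) Q

  cycle : ∀ φ i j k l m → IsC₅ (φ i ∷ φ j ∷ φ k ∷ φ l ∷ φ m ∷ []) → All (Holds φ) (cyc₅ i j k l m)
  cycle φ i j k l m (ab ∷ ac ∷ ad ∷ ae ∷ bc ∷ bd ∷ be ∷ cd ∷ ce ∷ de ∷ []) =
    ab ∷ ac ∷ ad ∷ ae ∷ bc ∷ bd ∷ be ∷ cd ∷ ce ∷ de ∷ []

  undominated : ∀ φ h i j k l m → ¬ Dominates (φ h) (φ i ∷ φ j ∷ φ k ∷ φ l ∷ φ m ∷ []) →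
                All (Holds φ) (none₅ h i j k l m)
  undominated φ h i j k l m n =
    (λ x → n (here x)) ∷ (λ x → n (there (here x))) ∷ (λ x → n (there (there (here x)))) ∷
    (λ x → n (there (there (there (here x))))) ∷ (λ x → n (there (there (there (there (here x)))))) ∷ []

  reflect : ∀ {a b c d e} → IsC₅ (a ∷ b ∷ c ∷ d ∷ e ∷ []) → IsC₅ (b ∷ a ∷ e ∷ d ∷ c ∷ [])
  reflect (ab ∷ ac ∷ ad ∷ ae ∷ bc ∷ bd ∷ be ∷ cd ∷ ce ∷ de ∷ []) =
    ~-sym ab ∷ be ∷ bd ∷ bc ∷ ae ∷ ad ∷ ac ∷ ~-sym de ∷ ce ∘ ~-sym ∷ ~-sym cd ∷ []

  -- A rotation, remembered only through what is used of it: a C₅ all of whose vertices are vertices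
  -- of `Q`, once for existential and once for universal predicates.
  record _⊑_ (R Q : Vec V 5) : Set₁ where
    field
      isC₅ : IsC₅ R
      any  : ∀ {X : V → Set} → Anyᵛ X R → Anyᵛ X Q
      all  : ∀ {X : V → Set} → Allᵛ X Q → Allᵛ X R

  open _⊑_

  rotate : ∀ {a b c d e} → IsC₅ (a ∷ b ∷ c ∷ d ∷ e ∷ []) → (b ∷ c ∷ d ∷ e ∷ a ∷ []) ⊑ (a ∷ b ∷ c ∷ d ∷ e ∷ [])
  rotate (ab ∷ ac ∷ ad ∷ ae ∷ bc ∷ bd ∷ be ∷ cd ∷ ce ∷ de ∷ []) .isC₅ =
    bc ∷ bd ∷ be ∷ ~-sym ab ∷ cd ∷ ce ∷ ac ∘ ~-sym ∷ de ∷ ad ∘ ~-sym ∷ ~-sym ae ∷ []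
  rotate _ .any (here x) = there (here x)
  rotate _ .any (there (here x)) = there (there (here x))
  rotate _ .any (there (there (here x))) = there (there (there (here x)))
  rotate _ .any (there (there (there (here x)))) = there (there (there (there (here x))))
  rotate _ .any (there (there (there (there (here x))))) = here x
  rotate _ .all (a ∷ b ∷ c ∷ d ∷ e ∷ []) = b ∷ c ∷ d ∷ e ∷ a ∷ []

  infixr 9 _▹_
  _▹_ : ∀ {R S Q} → S ⊑ R → R ⊑ Q → S ⊑ Q
  (s ▹ r) .isC₅ = isC₅ s
  (s ▹ r) .any = any r ∘ any s
  (s ▹ r) .all = all s ∘ all r

  ⊑-refl : ∀ {Q} → IsC₅ Q → Q ⊑ Q
  ⊑-refl q .isC₅ = q
  ⊑-refl q .any = id
  ⊑-refl q .all = id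

  toFront : ∀ {X : V → Set} {Q} → IsC₅ Q → Anyᵛ X Q → ∃ λ R → R ⊑ Q × X (Vec.head R)
  toFront {Q = _ ∷ _ ∷ _ ∷ _ ∷ _ ∷ []} q (here x) = _ , ⊑-refl q , x
  toFront {Q = _ ∷ _ ∷ _ ∷ _ ∷ _ ∷ []} q (there (here x)) = _ , rotate q , x
  toFront {Q = _ ∷ _ ∷ _ ∷ _ ∷ _ ∷ []} q (there (there (here x))) =
    let r = rotate q in _ , rotate (isC₅ r) ▹ r , x
  toFront {Q = _ ∷ _ ∷ _ ∷ _ ∷ _ ∷ []} q (there (there (there (here x)))) =
    let r = rotate q ; s = rotate (isC₅ r) in _ , rotate (isC₅ s) ▹ s ▹ r , x
  toFront {Q = _ ∷ _ ∷ _ ∷ _ ∷ _ ∷ []} q (there (there (there (there (here x))))) =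
    let r = rotate q ; s = rotate (isC₅ r) ; t = rotate (isC₅ s) in _ , rotate (isC₅ t) ▹ t ▹ s ▹ r , x

  contradict : ∀ Γ c → T (check forbidden [] Γ c) → ∀ φ → ¬ All (Holds φ) Γ
  contradict Γ c ok φ = refute (forbidden-impossible G (λ _ → ⊤) free) [] Γ c ok φ (λ _ → tt) []

  -- The possible neighbourhoods on a pentagon of a vertex outside it, up to rotation.
  data Shape (p : V) : Vec V 5 → Set where
    lone   : ∀ {a b c d e} → p ~ a → ¬ p ~ b → ¬ p ~ c → ¬ p ~ d → ¬ p ~ e → Shape p (a ∷ b ∷ c ∷ d ∷ e ∷ [])
    edge   : ∀ {a b c d e} → p ~ a → p ~ b → ¬ p ~ c → ¬ p ~ d → ¬ p ~ e → Shape p (a ∷ b ∷ c ∷ d ∷ e ∷ [])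
    middle : ∀ {a b c d e} → p ~ a → p ~ b → ¬ p ~ c → ¬ p ~ d → p ~ e → Shape p (a ∷ b ∷ c ∷ d ∷ e ∷ [])

  module _ {v p : V} (vp : v ~ p) where

    -- Otherwise `p`, `a`, `b`, `c` form a C₄. That `p` differs from `b` is seen from `v`, which is
    -- adjacent to `p` but to no vertex of the pentagon.
    gap : ∀ {a b c d e} → IsC₅ (a ∷ b ∷ c ∷ d ∷ e ∷ []) → ¬ Dominates v (a ∷ b ∷ c ∷ d ∷ e ∷ []) →
          p ~ a → ¬ p ~ b → ¬ p ~ c
    gap {a} {b} {c} {d} {e} q vQ pa pb pc =
      contradict (0 ∼ 1 ∷ cyc₅ 2 3 4 5 6 ++ none₅ 0 2 3 4 5 6 ++ 1 ∼ 2 ∷ 1 ∼ 4 ∷ 1 ≁ 3 ∷ []) cert-gap tt φ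
        (vp ∷ ++⁺ (cycle φ 2 3 4 5 6 q) (++⁺ (undominated φ 0 2 3 4 5 6 vQ) (pa ∷ pc ∷ pb ∷ [])))
      where φ = at v (p ∷ a ∷ b ∷ c ∷ d ∷ e ∷ [])

    -- Otherwise `p` is the hub of a gem over the path `e`, `a`, `b`, `c`.
    four : ∀ {a b c d e} → IsC₅ (a ∷ b ∷ c ∷ d ∷ e ∷ []) → ¬ Dominates v (a ∷ b ∷ c ∷ d ∷ e ∷ []) →
           p ~ e → p ~ a → p ~ b → ¬ p ~ c
    four {a} {b} {c} {d} {e} q vQ pe pa pb pc =
      contradict (0 ∼ 1 ∷ cyc₅ 2 3 4 5 6 ++ none₅ 0 2 3 4 5 6 ++ 1 ∼ 6 ∷ 1 ∼ 2 ∷ 1 ∼ 3 ∷ 1 ∼ 4 ∷ []) cert-four tt φ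
        (vp ∷ ++⁺ (cycle φ 2 3 4 5 6 q) (++⁺ (undominated φ 0 2 3 4 5 6 vQ) (pe ∷ pa ∷ pb ∷ pc ∷ [])))
      where φ = at v (p ∷ a ∷ b ∷ c ∷ d ∷ e ∷ [])

    shape : ∀ {Q} → IsC₅ Q → ¬ Dominates v Q → Dominates p Q → ∃ λ R → R ⊑ Q × Shape p R
    shape q vQ pQ with toFront q pQ
    ... | a ∷ b ∷ c ∷ d ∷ e ∷ [] , r , pa = classify (p ~? b) (p ~? c) (p ~? d) (p ~? e)
      where
      vR = vQ ∘ any r
      r¹ = rotate (isC₅ r)
      r² = rotate (isC₅ r¹)
      r³ = rotate (isC₅ r²)
      r⁴ = rotate (isC₅ r³)
      r₁ = r¹ ▹ r
      r₃ = r³ ▹ r² ▹ r₁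
      r₄ = r⁴ ▹ r₃
      classify : Dec (p ~ b) → Dec (p ~ c) → Dec (p ~ d) → Dec (p ~ e) → ∃ λ R → R ⊑ _ × Shape p R
      classify (no pb)  (no pc)  (no pd)  (no pe)  = _ , r , lone pa pb pc pd pe
      classify (yes pb) (no pc)  (no pd)  (no pe)  = _ , r , edge pa pb pc pd pe
      -- The rotations `r₁`, `r₃` and `r₄` bring `b`, `d` and `e` to the front.
      classify (no pb)  (no pc)  (no pd)  (yes pe) = _ , r₄ , edge pe pa pb pc pd
      classify (yes pb) (no pc)  (no pd)  (yes pe) = _ , r , middle pa pb pc pd pe
      classify (yes pb) (yes pc) (no pd)  (no pe)  = _ , r₁ , middle pb pc pd pe pa
      classify (no pb)  (no pc)  (yes pd) (yes pe) = _ , r₄ , middle pe pa pb pc pd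
      classify (no pb)  (yes pc) _        _        = ⊥-elim (gap (isC₅ r) vR pa pb pc)
      classify _        _        (yes pd) (no pe)  = ⊥-elim (gap (isC₅ r₃) (vQ ∘ any r₃) pd pe pa)
      classify (yes pb) (no pc)  (yes pd) _        = ⊥-elim (gap (isC₅ r₁) (vQ ∘ any r₁) pb pc pd)
      classify (yes pb) (yes pc) _        (yes pe) = ⊥-elim (four (isC₅ r) vR pe pa pb pc)

    -- Here 0 is v, 1 is p, 2–6 is a pentagon not dominated by v, and 7–11 one not dominated by 2.
    config : List Lit → List Lit → List Lit
    config t u = 0 ∼ 1 ∷ cyc₅ 2 3 4 5 6 ++ none₅ 0 2 3 4 5 6 ++ t ++ cyc₅ 7 8 9 10 11 ++ none₅ 2 7 8 9 10 11 ++ 0 ∼ 7 ∷ u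

    clash : ∀ t u cert → T (check forbidden [] (config t u) cert) → ∀ {a b c d e f g h i j} →
            let φ = at v (p ∷ a ∷ b ∷ c ∷ d ∷ e ∷ f ∷ g ∷ h ∷ i ∷ j ∷ []) in
            IsC₅ (a ∷ b ∷ c ∷ d ∷ e ∷ []) → ¬ Dominates v (a ∷ b ∷ c ∷ d ∷ e ∷ []) → All (Holds φ) t →
            IsC₅ (f ∷ g ∷ h ∷ i ∷ j ∷ []) → ¬ Dominates a (f ∷ g ∷ h ∷ i ∷ j ∷ []) → v ~ f → ¬ All (Holds φ) u
    clash t u cert ok {a} {b} {c} {d} {e} {f} {g} {h} {i} {j} q vQ ts s aS vf us =
      contradict (config t u) cert ok φ
        (vp ∷ ++⁺ (cycle φ 2 3 4 5 6 q) (++⁺ (undominated φ 0 2 3 4 5 6 vQ) (++⁺ ts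
          (++⁺ (cycle φ 7 8 9 10 11 s) (++⁺ (undominated φ 2 7 8 9 10 11 aS) (vf ∷ us))))))
      where φ = at v (p ∷ a ∷ b ∷ c ∷ d ∷ e ∷ f ∷ g ∷ h ∷ i ∷ j ∷ [])

    edge-literals : List Lit
    edge-literals = 1 ∼ 2 ∷ 1 ∼ 3 ∷ 1 ≁ 4 ∷ 1 ≁ 5 ∷ 1 ≁ 6 ∷ []

    -- On the second C₅, `f` is a vertex seen by `v` and `h` lies two steps further on. The second
    -- refutation builds on the outcome of the first, `p ~ h`.
    edge-neighbour : ∀ {a b c d e f g h i j} → IsC₅ (a ∷ b ∷ c ∷ d ∷ e ∷ []) →
                     ¬ Dominates v (a ∷ b ∷ c ∷ d ∷ e ∷ []) → p ~ a → p ~ b → ¬ p ~ c → ¬ p ~ d → ¬ p ~ e →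
                     IsC₅ (f ∷ g ∷ h ∷ i ∷ j ∷ []) → ¬ Dominates a (f ∷ g ∷ h ∷ i ∷ j ∷ []) → v ~ f →
                     p ~ h × b ~ h
    edge-neighbour {b = b} {h = h} q vQ pa pb pc pd pe s aS vf = ph , bh
      where
      ts = pa ∷ pb ∷ pc ∷ pd ∷ pe ∷ []
      ph = decidable-stable (p ~? h) λ ¬ph →
        clash edge-literals (1 ≁ 9 ∷ []) cert-edge₁ tt q vQ ts s aS vf (¬ph ∷ [])
      bh = decidable-stable (b ~? h) λ ¬bh →
        clash edge-literals (1 ∼ 9 ∷ 3 ≁ 9 ∷ []) cert-edge₂ tt q vQ ts s aS vf (ph ∷ ¬bh ∷ [])

    -- Suppose that `a` misses `S` and `b` misses `S′`. By `edge-neighbour` and its mirror image,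
    -- `p` and `b` share a neighbour `h` in `S`, and `p` and `a` share a neighbour `h′` in `S′`. If
    -- `h` and `h′` are adjacent, then `h`, `b`, `a`, `h′` form a C₄; if not, they form a P₄ and `p`
    -- completes a gem.
    edge-dominates : ∀ {a b c d e S S′} → IsC₅ (a ∷ b ∷ c ∷ d ∷ e ∷ []) →
                     ¬ Dominates v (a ∷ b ∷ c ∷ d ∷ e ∷ []) → p ~ a → p ~ b → ¬ p ~ c → ¬ p ~ d → ¬ p ~ e →
                     IsC₅ S → Dominates v S → ¬ Dominates a S → IsC₅ S′ → Dominates v S′ → Dominates b S′
    edge-dominates {a} {b} {c} {d} {e} {S} {S′} q vQ pa pb pc pd pe s vS aS s′ vS′ =
      decidable-stable (dominates? b S′) λ bS′ → absurd q bS′ (toFront s vS) (toFront s′ vS′)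
      where
      vQ′ : ¬ Dominates v (b ∷ a ∷ e ∷ d ∷ c ∷ [])
      vQ′ (here x) = vQ (there (here x))
      vQ′ (there (here x)) = vQ (here x)
      vQ′ (there (there (here x))) = vQ (there (there (there (there (here x)))))
      vQ′ (there (there (there (here x)))) = vQ (there (there (there (here x))))
      vQ′ (there (there (there (there (here x))))) = vQ (there (there (here x)))
      absurd : IsC₅ (a ∷ b ∷ c ∷ d ∷ e ∷ []) → ¬ Dominates b S′ →
               ∃ (λ R → R ⊑ S × v ~ Vec.head R) → ∃ (λ R → R ⊑ S′ × v ~ Vec.head R) → ⊥
      absurd (ab ∷ _ ∷ _ ∷ ae ∷ bc ∷ _) bS′ (f ∷ g ∷ h ∷ i ∷ j ∷ [] , r , vf) (f′ ∷ g′ ∷ h′ ∷ i′ ∷ j′ ∷ [] , r′ , vf′)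
        with isC₅ r | isC₅ r′
           | edge-neighbour q vQ pa pb pc pd pe (isC₅ r) (aS ∘ any r) vf
           | edge-neighbour (reflect q) vQ′ pb pa pe pd pc (isC₅ r′) (bS′ ∘ any r′) vf′
      ... | _ ∷ _ ∷ _ ∷ _ ∷ gh ∷ _ | _ ∷ _ ∷ _ ∷ _ ∷ gh′ ∷ _ | ph , bh | ph′ , ah′ =
        contradict (0 ∼ 1 ∷ 2 ∼ 3 ∷ 2 ∼ 5 ∷ 3 ∼ 4 ∷ 0 ≁ 4 ∷ 0 ≁ 5 ∷ 1 ∼ 2 ∷ 1 ∼ 3 ∷ 1 ≁ 4 ∷ 1 ≁ 5 ∷ 6 ∼ 7 ∷ 2 ≁ 6 ∷ 2 ≁ 7 ∷
                    8 ∼ 9 ∷ 3 ≁ 8 ∷ 3 ≁ 9 ∷ 1 ∼ 7 ∷ 3 ∼ 7 ∷ 1 ∼ 9 ∷ 2 ∼ 9 ∷ []) cert-edge₃ tt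
          (at v (p ∷ a ∷ b ∷ c ∷ e ∷ g ∷ h ∷ g′ ∷ h′ ∷ []))
          (vp ∷ ab ∷ ae ∷ bc ∷ (λ x → vQ (there (there (here x)))) ∷ (λ x → vQ (there (there (there (there (here x)))))) ∷
           pa ∷ pb ∷ pc ∷ pe ∷ gh ∷ (λ x → aS (any r (there (here x)))) ∷ (λ x → aS (any r (there (there (here x))))) ∷
           gh′ ∷ (λ x → bS′ (any r′ (there (here x)))) ∷ (λ x → bS′ (any r′ (there (there (here x))))) ∷
           ph ∷ bh ∷ ph′ ∷ ah′ ∷ [])

    -- The vertex is the only neighbour of `p`, or the middle one of three. With two neighbours it
    -- is `a`, unless `a` misses some listed C₅; then `edge-dominates` makes `b` work for all of
    -- them. Any vertex of `Q` dominates `Q`, through the next one.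
    dominator : ∀ {Q} → IsC₅ Q → ¬ Dominates v Q → Dominates p Q → (Ss : List (Vec V 5)) → All IsC₅ Ss →
                ∃ λ u → Anyᵛ (_≡ u) Q × Dominates u Q × All (λ S → Dominates v S → Dominates u S) Ss
    dominator {Q} q vQ pQ Ss ss with shape q vQ pQ
    ... | _ , r , lone {a} pa pb pc pd pe = a , any r (here refl) , any r (there (here (All.head (isC₅ r)))) ,
      All.map (λ {S} s vS → decidable-stable (dominates? a S) λ aS → case (toFront s vS) aS) ss
      where
      case : ∀ {S} → ∃ (λ R → R ⊑ S × v ~ Vec.head R) → ¬ ¬ Dominates a S
      case (_ ∷ _ ∷ _ ∷ _ ∷ _ ∷ [] , t , vf) aS =
        clash (1 ∼ 2 ∷ 1 ≁ 3 ∷ 1 ≁ 4 ∷ 1 ≁ 5 ∷ 1 ≁ 6 ∷ []) [] cert-lone tt (isC₅ r) (vQ ∘ any r)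
          (pa ∷ pb ∷ pc ∷ pd ∷ pe ∷ []) (isC₅ t) (aS ∘ any t) vf []
    ... | _ , r , middle {a} pa pb pc pd pe = a , any r (here refl) , any r (there (here (All.head (isC₅ r)))) ,
      All.map (λ {S} s vS → decidable-stable (dominates? a S) λ aS → case (toFront s vS) aS) ss
      where
      case : ∀ {S} → ∃ (λ R → R ⊑ S × v ~ Vec.head R) → ¬ ¬ Dominates a S
      case (_ ∷ _ ∷ _ ∷ _ ∷ _ ∷ [] , t , vf) aS =
        clash (1 ∼ 2 ∷ 1 ∼ 3 ∷ 1 ≁ 4 ∷ 1 ≁ 5 ∷ 1 ∼ 6 ∷ []) [] cert-middle tt (isC₅ r) (vQ ∘ any r)
          (pa ∷ pb ∷ pc ∷ pd ∷ pe ∷ []) (isC₅ t) (aS ∘ any t) vf []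
    ... | _ , r , edge {a} {b} pa pb pc pd pe with All.all? (λ S → dominates? v S →-dec dominates? a S) Ss
    ...   | yes better = a , any r (here refl) , any r (there (here (All.head (isC₅ r)))) , better
    ...   | no worse = b , any r (there (here refl)) , any r (here (~-sym (All.head (isC₅ r)))) , witness ss
        (¬All⇒Any¬ (λ S → dominates? v S →-dec dominates? a S) Ss worse)
      where
      find : ∀ {Ss} → All IsC₅ Ss → Any (λ S → ¬ (Dominates v S → Dominates a S)) Ss →
             ∃ λ S → IsC₅ S × Dominates v S × ¬ Dominates a S
      find (s ∷ _) (here {S} ¬le) with dominates? v S
      ... | yes vS = S , s , vS , λ aS → ¬le λ _ → aS
      ... | no ¬vS = ⊥-elim (¬le λ vS → ⊥-elim (¬vS vS))
      find (_ ∷ ss) (there x) = find ss x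
      witness : ∀ {Ts} → All IsC₅ Ts → Any (λ S → ¬ (Dominates v S → Dominates a S)) Ts →
                All (λ S → Dominates v S → Dominates b S) Ts
      witness ts bad = let (S , s , vS , aS) = find ts bad in
        All.map (λ s′ vS′ → edge-dominates (isC₅ r) (vQ ∘ any r) pa pb pc pd pe s vS aS s′ vS′) ts

  noP₇ : ∀ φ → ¬ All (Holds φ) (diagram (P 7))
  noP₇ = contradict (diagram (P 7)) (p₇ 0x6543210) tt

  noC₇ : ∀ φ → ¬ All (Holds φ) (diagram (C 7))
  noC₇ = contradict (diagram (C 7)) (c₇ 0x6543210) tt

  -- Only the last four vertices of the path matter. Once C₄ and the gem are excluded, the
  -- neighbours of the last one on the C₅ are consecutive and at most three. Entering at an end of
  -- this run leaves two further vertices to walk along, which gives a P₇.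
  short : ∀ {Q} → IsC₅ Q → ∀ {x a b c zs} → ¬ Path (λ u → Dominates u Q) x (a ∷ b ∷ c ∷ zs)
  short q {zs = _ ∷ _} (step _ _ _ p) = short q p
  short q {x} {y} {z} {w} {[]} (step xQ xy (xz ∷ xw ∷ []) (step yQ yz (yw ∷ []) (step zQ zw [] (stop wQ))))
    with toFront q wQ
  ... | a ∷ b ∷ c ∷ d ∷ e ∷ [] , r , wa =
    contradict (cyc₅ 4 5 6 7 8 ++ 0 ∼ 1 ∷ 1 ∼ 2 ∷ 2 ∼ 3 ∷ 0 ≁ 2 ∷ 0 ≁ 3 ∷ 1 ≁ 3 ∷
                none₅ 0 4 5 6 7 8 ++ none₅ 1 4 5 6 7 8 ++ none₅ 2 4 5 6 7 8 ++ 3 ∼ 4 ∷ []) cert-far tt φ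
      (++⁺ (cycle φ 4 5 6 7 8 (isC₅ r)) (xy ∷ yz ∷ zw ∷ xz ∷ xw ∷ yw ∷
        ++⁺ (undominated φ 0 4 5 6 7 8 (xQ ∘ any r)) (++⁺ (undominated φ 1 4 5 6 7 8 (yQ ∘ any r))
          (++⁺ (undominated φ 2 4 5 6 7 8 (zQ ∘ any r)) (wa ∷ [])))))
    where φ = at x (y ∷ z ∷ w ∷ a ∷ b ∷ c ∷ d ∷ e ∷ [])

  -- The induced P₇ is `v`, `x`, `p`, `a`, `e`, `d`, `c`. It avoids `b`, so the shapes `lone` and
  -- `edge` are treated alike.
  tail : ∀ {v x p a b c d e} → IsC₅ (a ∷ b ∷ c ∷ d ∷ e ∷ []) → ¬ Dominates x (a ∷ b ∷ c ∷ d ∷ e ∷ []) →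
         ¬ Dominates v (a ∷ b ∷ c ∷ d ∷ e ∷ []) → v ~ x → x ~ p → ¬ v ~ p → p ~ a → ¬ p ~ c → ¬ p ~ d → ¬ p ~ e → ⊥
  tail {v} {x} {p} {a} {b} {c} {d} {e} (_ ∷ ac ∷ ad ∷ ae ∷ _ ∷ _ ∷ _ ∷ cd ∷ ce ∷ de ∷ []) xQ vQ vx xp v≁p pa pc pd pe =
    noP₇ (at v (x ∷ p ∷ a ∷ e ∷ d ∷ c ∷ []))
      (vx ∷ v≁p ∷ (λ y → vQ (here y)) ∷ (λ y → vQ (there (there (there (there (here y)))))) ∷
       (λ y → vQ (there (there (there (here y))))) ∷
       (λ y → vQ (there (there (here y)))) ∷ xp ∷ (λ y → xQ (here y)) ∷ (λ y → xQ (there (there (there (there (here y)))))) ∷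
       (λ y → xQ (there (there (there (here y))))) ∷ (λ y → xQ (there (there (here y)))) ∷
       pa ∷ pe ∷ pd ∷ pc ∷ ae ∷ ad ∷ ac ∷ ~-sym de ∷ ce ∘ ~-sym ∷ ~-sym cd ∷ [])

  -- By `short` the path has at most two edges. With two, the C₅ reached may have to be exchanged
  -- for another one that is closer to `v`.
  distanceTwo : ∀ {A : V → Set} {v Q zs} → IsC₅ Q → Allᵛ A Q → Path (λ u → Dominates u Q) v zs → All A zs →
                ¬ Dominates v Q → ∃₂ λ p R → IsC₅ R × Allᵛ A R × ¬ Dominates v R × v ~ p × Dominates p R
  distanceTwo q Q⊆A (stop vQ) _ ¬vQ = ⊥-elim (¬vQ vQ)
  distanceTwo q Q⊆A (step _ vp _ (stop pQ)) _ vQ = _ , _ , q , Q⊆A , vQ , vp , pQ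
  distanceTwo {A} {v} q Q⊆A (step _ vx (v≁p ∷ []) (step {x} {p} xQ xp _ (stop pQ))) (_ ∷ p∈A ∷ []) vQ with shape xp q xQ pQ
  ... | _ , r , lone pa pb pc pd pe = ⊥-elim (tail (isC₅ r) (xQ ∘ any r) (vQ ∘ any r) vx xp v≁p pa pc pd pe)
  ... | _ , r , edge pa pb pc pd pe = ⊥-elim (tail (isC₅ r) (xQ ∘ any r) (vQ ∘ any r) vx xp v≁p pa pc pd pe)
  ... | _ , r , middle {a} {b} {c} {d} {e} pa pb pc pd pe with isC₅ r | all r Q⊆A
  -- Here `p` takes the place of `a`. The new C₅ contains `p`, so `x` dominates it, while `v` sees
  -- neither `p` nor the four old vertices.
  ...   | _ ∷ _ ∷ _ ∷ _ ∷ bc ∷ bd ∷ be ∷ cd ∷ ce ∷ de ∷ [] | _ ∷ A-rest =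
    x , p ∷ b ∷ c ∷ d ∷ e ∷ [] , pb ∷ pc ∷ pd ∷ pe ∷ bc ∷ bd ∷ be ∷ cd ∷ ce ∷ de ∷ [] ,
    p∈A ∷ A-rest , (λ { (here y) → v≁p y ; (there y) → vQ (any r (there y)) }) , vx , here xp
  distanceTwo q Q⊆A p@(step _ _ _ (step _ _ _ (step _ _ _ _))) _ _ = ⊥-elim (short q p)

-- C₆s in C₅-free sets: replacing vertices, outside vertices and bridges.

cyc₆ : List Lit
cyc₆ = 0 ∼ 1 ∷ 0 ≁ 2 ∷ 0 ≁ 3 ∷ 0 ≁ 4 ∷ 0 ∼ 5 ∷ 1 ∼ 2 ∷ 1 ≁ 3 ∷ 1 ≁ 4 ∷ 1 ≁ 5 ∷ 2 ∼ 3 ∷ 2 ≁ 4 ∷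
       2 ≁ 5 ∷ 3 ∼ 4 ∷ 3 ≁ 5 ∷ 4 ∼ 5 ∷ []

-- The six ways of being `Near`, in the same order; taken as hypotheses of a certificate they make
-- vertex `m` an `Outside` one.
outs : ℕ → List (List Lit)
outs m = (m ∼ 5 ∷ m ∼ 1 ∷ []) ∷ (m ∼ 0 ∷ m ∼ 2 ∷ []) ∷ (m ∼ 1 ∷ m ∼ 3 ∷ []) ∷
         (m ∼ 2 ∷ m ∼ 4 ∷ []) ∷ (m ∼ 3 ∷ m ∼ 5 ∷ []) ∷ (m ∼ 4 ∷ m ∼ 0 ∷ []) ∷ []

module Hexagons (G : Graph) (free : (P 7 ∷ C 7 ∷ C 4 ∷ gem ∷ []) -Free G) where
  open Vertices G
  open Semantics G
  open Colourings G
  open Pentagons G free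

  C₅Free : Subset (order G) → Set
  C₅Free A = ∀ Q → Allᵛ (_∈ A) Q → ¬ IsC₅ Q

  module _ {A : Subset (order G)} (noC₅ : C₅Free A) where

    record Hexagon : Set where
      field
        a b c d e f : V
        members : All (_∈ A) (a ∷ b ∷ c ∷ d ∷ e ∷ f ∷ [])
        isC₆ : All (Holds (at a (b ∷ c ∷ d ∷ e ∷ f ∷ []))) cyc₆

    open Hexagon

    turn : Hexagon → Hexagon
    turn h = record { a = b h ; b = c h ; c = d h ; d = e h ; e = f h ; f = a h
                    ; members = turnMembers (members h) ; isC₆ = turnC₆ (isC₆ h) }
      where
      turnMembers : ∀ {a b c d e f} → All (_∈ A) (a ∷ b ∷ c ∷ d ∷ e ∷ f ∷ []) → All (_∈ A) (b ∷ c ∷ d ∷ e ∷ f ∷ a ∷ [])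
      turnMembers (a ∷ b ∷ c ∷ d ∷ e ∷ f ∷ []) = b ∷ c ∷ d ∷ e ∷ f ∷ a ∷ []
      turnC₆ : ∀ {a b c d e f} → All (Holds (at a (b ∷ c ∷ d ∷ e ∷ f ∷ []))) cyc₆ →
               All (Holds (at b (c ∷ d ∷ e ∷ f ∷ a ∷ []))) cyc₆
      turnC₆ (ab ∷ ac ∷ ad ∷ ae ∷ af ∷ bc ∷ bd ∷ be ∷ bf ∷ cd ∷ ce ∷ cf ∷ de ∷ df ∷ ef ∷ []) =
        bc ∷ bd ∷ be ∷ bf ∷ ~-sym ab ∷ cd ∷ ce ∷ cf ∷ ac ∘ ~-sym ∷ de ∷ df ∷ ad ∘ ~-sym ∷ ef ∷ ae ∘ ~-sym ∷ ~-sym af ∷ []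

    -- Near h i x: x may replace the i-th vertex of h (and that vertex itself qualifies).
    Near : Hexagon → Fin 6 → V → Set
    Near h 0F x = x ~ f h × x ~ b h
    Near h 1F x = x ~ a h × x ~ c h
    Near h 2F x = x ~ b h × x ~ d h
    Near h 3F x = x ~ c h × x ~ e h
    Near h 4F x = x ~ d h × x ~ f h
    Near h 5F x = x ~ e h × x ~ a h

    near? : ∀ h i x → Dec (Near h i x)
    near? h 0F x = (x ~? f h) ×-dec (x ~? b h)
    near? h 1F x = (x ~? a h) ×-dec (x ~? c h)
    near? h 2F x = (x ~? b h) ×-dec (x ~? d h)
    near? h 3F x = (x ~? c h) ×-dec (x ~? e h)
    near? h 4F x = (x ~? d h) ×-dec (x ~? f h)
    near? h 5F x = (x ~? e h) ×-dec (x ~? a h)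

    Outside : Hexagon → V → Set
    Outside h x = ¬ ∃ λ i → Near h i x

    outside? : ∀ h x → Dec (Outside h x)
    outside? h x = ¬? (Fin.any? λ i → near? h i x)

    outside-turn : ∀ {h x} → Outside h x → Outside (turn h) x
    outside-turn out (0F , s) = out (1F , s)
    outside-turn out (1F , s) = out (2F , s)
    outside-turn out (2F , s) = out (3F , s)
    outside-turn out (3F , s) = out (4F , s)
    outside-turn out (4F , s) = out (5F , s)
    outside-turn out (5F , s) = out (0F , s)

    outs-hold : ∀ h {xs} m → let φ = at (a h) (b h ∷ c h ∷ d h ∷ e h ∷ f h ∷ xs) in
                Outside h (φ m) → All (λ η → ¬ All (Holds φ) η) (outs m)
    outs-hold h m out =
      (λ { (s ∷ t ∷ []) → out (0F , s , t) }) ∷ (λ { (s ∷ t ∷ []) → out (1F , s , t) }) ∷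
      (λ { (s ∷ t ∷ []) → out (2F , s , t) }) ∷ (λ { (s ∷ t ∷ []) → out (3F , s , t) }) ∷
      (λ { (s ∷ t ∷ []) → out (4F , s , t) }) ∷ (λ { (s ∷ t ∷ []) → out (5F , s , t) }) ∷ []

    -- The C₅ is appended at position 5, to which the pattern `c₅` refers.
    impossible : All (Impossible (_∈ A)) (forbidden ++ cyc₅ 0 1 2 3 4 ∷ [])
    impossible = ++⁺ (forbidden-impossible G (_∈ A) free) (noPentagon ∷ [])
      where
      noPentagon : Impossible (_∈ A) (cyc₅ 0 1 2 3 4)
      noPentagon φ w (ab ∷ ac ∷ ad ∷ ae ∷ bc ∷ bd ∷ be ∷ cd ∷ ce ∷ de ∷ []) =
        noC₅ (φ 0 ∷ φ 1 ∷ φ 2 ∷ φ 3 ∷ φ 4 ∷ []) (w 0 ∷ w 1 ∷ w 2 ∷ w 3 ∷ w 4 ∷ [])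
          (ab ∷ ac ∷ ad ∷ ae ∷ bc ∷ bd ∷ be ∷ cd ∷ ce ∷ de ∷ [])

    exclude : ∀ h {xs} → All (_∈ A) xs → ∀ ηs Γ cert →
              T (check (forbidden ++ cyc₅ 0 1 2 3 4 ∷ []) ηs (cyc₆ ++ Γ) cert) →
              let φ = at (a h) (b h ∷ c h ∷ d h ∷ e h ∷ f h ∷ xs) in
              All (λ η → ¬ All (Holds φ) η) ηs → ¬ All (Holds φ) Γ
    exclude h {xs} xs∈A ηs Γ cert ok hyps lits with members h | isC₆ h
    ... | a∈A ∷ ms | ab ∷ ac ∷ ad ∷ ae ∷ af ∷ bc ∷ bd ∷ be ∷ bf ∷ cd ∷ ce ∷ cf ∷ de ∷ df ∷ ef ∷ [] =
      refute {W = _∈ A} impossible ηs (cyc₆ ++ Γ) cert ok _ (at-All a∈A (++⁺ ms xs∈A)) hyps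
        (ab ∷ ac ∷ ad ∷ ae ∷ af ∷ bc ∷ bd ∷ be ∷ bf ∷ cd ∷ ce ∷ cf ∷ de ∷ df ∷ ef ∷ lits)

    module _ (h : Hexagon) {x y : V} (x∈A : x ∈ A) (y∈A : y ∈ A) where

      -- Otherwise `f`, `x`, `b`, `y` would form a C₄.
      near₀₀ : Near h 0F x → Near h 0F y → x ≢ y → x ~ y
      near₀₀ (xf , xb) (yf , yb) x≢y = decidable-stable (x ~? y) λ ¬xy →
        exclude h (x∈A ∷ y∈A ∷ []) [] (6 ∼ 5 ∷ 6 ∼ 1 ∷ 7 ∼ 5 ∷ 7 ∼ 1 ∷ 6 ≁ 7 ∷ 6 ≠ 7 ∷ []) cert-near₀₀ tt []
          (xf ∷ xb ∷ yf ∷ yb ∷ ¬xy ∷ x≢y ∷ [])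

      near₀₁ : Near h 0F x → Near h 1F y → x ~ y
      near₀₁ (xf , xb) (ya , yc) = decidable-stable (x ~? y) λ ¬xy →
        exclude h (x∈A ∷ y∈A ∷ []) [] (6 ∼ 5 ∷ 6 ∼ 1 ∷ 7 ∼ 0 ∷ 7 ∼ 2 ∷ 6 ≁ 7 ∷ []) cert-near₀₁ tt []
          (xf ∷ xb ∷ ya ∷ yc ∷ ¬xy ∷ [])

      near₀₂ : Near h 0F x → Near h 2F y → ¬ x ~ y
      near₀₂ (xf , xb) (yb , yd) xy =
        exclude h (x∈A ∷ y∈A ∷ []) [] (6 ∼ 5 ∷ 6 ∼ 1 ∷ 7 ∼ 1 ∷ 7 ∼ 3 ∷ 6 ∼ 7 ∷ []) cert-near₀₂ tt []
          (xf ∷ xb ∷ yb ∷ yd ∷ xy ∷ [])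

      near₀₃ : Near h 0F x → Near h 3F y → ¬ x ~ y
      near₀₃ (xf , xb) (yc , ye) xy =
        exclude h (x∈A ∷ y∈A ∷ []) [] (6 ∼ 5 ∷ 6 ∼ 1 ∷ 7 ∼ 2 ∷ 7 ∼ 4 ∷ 6 ∼ 7 ∷ []) cert-near₀₃ tt []
          (xf ∷ xb ∷ yc ∷ ye ∷ xy ∷ [])

      -- Together with `attach₀₃` and after turning, an outside vertex can only be attached to two
      -- consecutive classes of near vertices. These form a clique by `near₀₀` and `near₀₁`.
      attach₀₂ : ∀ {o} → o ∈ A → Outside h o → Near h 0F x → Near h 2F y → o ~ x → ¬ o ~ y
      attach₀₂ {o} o∈A out (xf , xb) (yb , yd) ox oy =
        exclude h {x ∷ y ∷ o ∷ []} (x∈A ∷ y∈A ∷ o∈A ∷ []) (outs 8)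
          (6 ∼ 5 ∷ 6 ∼ 1 ∷ 7 ∼ 1 ∷ 7 ∼ 3 ∷ 8 ∼ 6 ∷ 8 ∼ 7 ∷ []) cert-attach₀₂ tt
          (outs-hold h {x ∷ y ∷ o ∷ []} 8 out) (xf ∷ xb ∷ yb ∷ yd ∷ ox ∷ oy ∷ [])

      attach₀₃ : ∀ {o} → o ∈ A → Outside h o → Near h 0F x → Near h 3F y → o ~ x → ¬ o ~ y
      attach₀₃ {o} o∈A out (xf , xb) (yc , ye) ox oy =
        exclude h {x ∷ y ∷ o ∷ []} (x∈A ∷ y∈A ∷ o∈A ∷ []) (outs 8)
          (6 ∼ 5 ∷ 6 ∼ 1 ∷ 7 ∼ 2 ∷ 7 ∼ 4 ∷ 8 ∼ 6 ∷ 8 ∼ 7 ∷ []) cert-attach₀₃ tt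
          (outs-hold h {x ∷ y ∷ o ∷ []} 8 out) (xf ∷ xb ∷ yc ∷ ye ∷ ox ∷ oy ∷ [])

    -- An edge between vertices outside a hexagon whose ends are attached to opposite vertices of it.
    Bridge : Hexagon → Set
    Bridge h = ∃₂ λ o p → (o ∈ A × Outside h o) × (p ∈ A × Outside h p) × o ~ p × o ~ b h × p ~ e h

    bridge? : ∀ h → Dec (Bridge h)
    bridge? h = Fin.any? λ o → Fin.any? λ p → ((o ∈? A) ×-dec outside? h o) ×-dec ((p ∈? A) ×-dec outside? h p) ×-dec
      (o ~? p) ×-dec (o ~? b h) ×-dec (p ~? e h)

    module _ (h : Hexagon) {o p : V} (o∈A : o ∈ A) (p∈A : p ∈ A)
             (o-out : Outside h o) (p-out : Outside h p) (op : o ~ p) where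

      -- Used where no bridge exists: adjacency to `b` then passes along every edge between outside
      -- vertices, hence through a whole component of them.
      spread : o ~ b h → ¬ p ~ b h → p ~ e h
      spread ob ¬pb = decidable-stable (p ~? e h) λ ¬pe →
        exclude h {o ∷ p ∷ []} (o∈A ∷ p∈A ∷ []) (outs 6 ++ outs 7) (6 ∼ 7 ∷ 6 ∼ 1 ∷ 7 ≁ 1 ∷ 7 ≁ 4 ∷ []) cert-spread tt
          (++⁺ (outs-hold h {o ∷ p ∷ []} 6 o-out) (outs-hold h {o ∷ p ∷ []} 7 p-out)) (op ∷ ob ∷ ¬pb ∷ ¬pe ∷ [])

      module _ {x : V} (x∈A : x ∈ A) (ob : o ~ b h) (pb : p ~ b h) (ox : o ~ x) where

        -- Adjacent outside vertices that both see `b` have the same neighbours near `a`, `b` and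
        -- `c`; `i` and `j` are the positions of the two neighbours that make `x` near.
        share : ∀ i j cert →
                T (check (forbidden ++ cyc₅ 0 1 2 3 4 ∷ []) (outs 6 ++ outs 7)
                    (cyc₆ ++ (8 ∼ i ∷ 8 ∼ j ∷ 6 ∼ 7 ∷ 6 ∼ 1 ∷ 7 ∼ 1 ∷ 6 ∼ 8 ∷ 7 ≁ 8 ∷ [])) cert) →
                let φ = at (a h) (b h ∷ c h ∷ d h ∷ e h ∷ f h ∷ o ∷ p ∷ x ∷ []) in
                x ~ φ i → x ~ φ j → p ~ x
        share i j cert ok xi xj = decidable-stable (p ~? x) λ ¬px →
          exclude h {o ∷ p ∷ x ∷ []} (o∈A ∷ p∈A ∷ x∈A ∷ []) (outs 6 ++ outs 7)
            (8 ∼ i ∷ 8 ∼ j ∷ 6 ∼ 7 ∷ 6 ∼ 1 ∷ 7 ∼ 1 ∷ 6 ∼ 8 ∷ 7 ≁ 8 ∷ []) cert ok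
            (++⁺ (outs-hold h {o ∷ p ∷ x ∷ []} 6 o-out) (outs-hold h {o ∷ p ∷ x ∷ []} 7 p-out))
            (xi ∷ xj ∷ op ∷ ob ∷ pb ∷ ox ∷ ¬px ∷ [])

        share₀ : Near h 0F x → p ~ x
        share₀ (xf , xb) = share 5 1 cert-share₀ tt xf xb

        share₁ : Near h 1F x → p ~ x
        share₁ (xa , xc) = share 0 2 cert-share₁ tt xa xc

        share₂ : Near h 2F x → p ~ x
        share₂ (xb , xd) = share 1 3 cert-share₂ tt xb xd

    bridges : ∀ h → (∃₂ λ o p → (o ∈ A × Outside h o) × (p ∈ A × Outside h p) × o ~ p × o ~ a h × p ~ d h) → ¬ Bridge h
    bridges h (o , p , (o∈A , o-out) , (p∈A , p-out) , op , oa , pd)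
              (q , r , (q∈A , q-out) , (r∈A , r-out) , qr , qb , re) =
      exclude h {os} (o∈A ∷ p∈A ∷ q∈A ∷ r∈A ∷ []) (outs 6 ++ outs 7 ++ outs 8 ++ outs 9)
        (6 ∼ 7 ∷ 6 ∼ 0 ∷ 7 ∼ 3 ∷ 8 ∼ 9 ∷ 8 ∼ 1 ∷ 9 ∼ 4 ∷ []) cert-bridges tt
        (++⁺ (outs-hold h {os} 6 o-out) (++⁺ (outs-hold h {os} 7 p-out)
          (++⁺ (outs-hold h {os} 8 q-out) (outs-hold h {os} 9 r-out))))
        (op ∷ oa ∷ pd ∷ qr ∷ qb ∷ re ∷ [])
      where os = o ∷ p ∷ q ∷ r ∷ []

    -- A bridge between `b` and `e` becomes, after one turn, one between `a` and `d`, and `bridges`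
    -- forbids another at the following pair.
    unbridged : Hexagon → ∃ λ h → ¬ Bridge h
    unbridged h with bridge? h
    ... | no ¬br = h , ¬br
    ... | yes (o , p , (o∈A , o-out) , (p∈A , p-out) , op , ob , pe) =
      turn h , bridges (turn h) (o , p , (o∈A , outside-turn o-out) , (p∈A , outside-turn p-out) , op , ob , pe)

-- Kempe changes at a vertex whose neighbourhood is covered by two cliques.

module KempeChains (G : Graph) (free : (P 7 ∷ C 7 ∷ C 4 ∷ gem ∷ []) -Free G) where
  open Vertices G
  open Semantics G
  open Colourings G
  open Pentagons G free
  open Hexagons G free

  without? : (A : Subset (order G)) (v : V) → U.Decidable (λ u → u ∈ A × u ≢ v)
  without? A v u = (u ∈? A) ×-dec ¬? (u Fin.≟ v)

  _∖_ : Subset (order G) → V → Subset (order G)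
  A ∖ v = ⟪ without? A v ⟫

  ∖-⊂ : ∀ {A v} → v ∈ A → (A ∖ v) ⊂ A
  ∖-⊂ {A} {v} v∈A = (λ u∈ → proj₁ (∈⟪⟫⁻ (without? A v) u∈)) , v , v∈A , λ v∈ → proj₂ (∈⟪⟫⁻ (without? A v) v∈) refl

  extend : ∀ {A v k γ} (c : Colouring (A ∖ v) k) → γ < k →
           (∀ {u} → u ∈ A → u ~ v → colour c u ≢ γ) → Colouring A k
  extend {A} {v} {k} {γ} c γ<k free-γ = record { colour = c′ ; bounded = c′-bounded ; proper = c′-proper }
    where
    c′ : V → ℕ
    c′ u with u Fin.≟ v
    ... | yes _ = γ
    ... | no _  = colour c u
    c′-bounded : ∀ {u} → u ∈ A → c′ u < k
    c′-bounded {u} u∈A with u Fin.≟ v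
    ... | yes _  = γ<k
    ... | no u≢v = bounded c (∈⟪⟫⁺ (without? A v) (u∈A , u≢v))
    c′-proper : ∀ {u w} → u ∈ A → w ∈ A → u ~ w → c′ u ≢ c′ w
    c′-proper {u} {w} u∈A w∈A uw with u Fin.≟ v | w Fin.≟ v
    ... | yes refl | yes refl = ⊥-elim (irrefl G uw)
    ... | yes refl | no _     = free-γ w∈A (~-sym uw) ∘ sym
    ... | no _     | yes refl = free-γ u∈A uw
    ... | no u≢v   | no w≢v   = proper c (∈⟪⟫⁺ (without? A v) (u∈A , u≢v)) (∈⟪⟫⁺ (without? A v) (w∈A , w≢v)) uw

  pairwise : ∀ {S} → CliqueIn S → ∀ {K} → All S K → AllPairs _≢_ K → AllPairs _~_ K
  pairwise S-clique [] [] = []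
  pairwise S-clique (x∈S ∷ K⊆S) (x≢K ∷ ≢K) =
    All.map (λ (y∈S , x≢y) → S-clique x∈S y∈S x≢y) (All.zip (K⊆S , x≢K)) ∷ pairwise S-clique K⊆S ≢K

  spare : ∀ {A v k S} → CliquesBounded A k → v ∈ A → U.Decidable S → CliqueIn S → (∀ {u} → S u → u ∈ A × u ~ v) →
          (c : V → ℕ) → ∃ λ γ → γ < k × ∀ {u} → S u → c u ≢ γ
  spare {A} {v} {k} {S} ω≤k v∈A S? S-clique S⊆N c with missing k (map c K) short′
    where
    K = filter S? (allFin (order G))
    K⊆S = all-filter S? (allFin (order G))
    short′ : length (map c K) < k
    short′ = subst (_< k) (sym (length-map c K)) (ω≤k (v ∷ K) (v∈A ∷ All.map (proj₁ ∘ S⊆N) K⊆S)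
      (All.map (~-sym ∘ proj₂ ∘ S⊆N) K⊆S ∷ pairwise S-clique K⊆S (filter⁺ S? (allFin⁺ (order G)))))
  ... | γ , γ<k , γ∉ = γ , γ<k , λ {u} u∈S eq → γ∉ (subst (_∈ˡ _) eq (∈-map⁺ c (∈-filter⁺ S? (∈-allFin u) u∈S)))

  -- A Kempe chain joining the two cliques would, together with v, be an odd hole.
  kempe : ∀ {A v k} {L R : V → Set} → C₅Free A → CliquesBounded A k → v ∈ A →
          U.Decidable L → U.Decidable R → CliqueIn L → CliqueIn R →
          (∀ {u} → L u → u ∈ A × u ~ v) → (∀ {u} → R u → u ∈ A × u ~ v) →
          (∀ {u} → u ∈ A → u ~ v → L u ⊎ R u) → (∀ {u w} → L u → ¬ R u → R w → ¬ L w → ¬ u ~ w) →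
          Colouring (A ∖ v) k → Colouring A k
  kempe {A} {v} {k} {L} {R} noC₅ ω≤k v∈A L? R? L-clique R-clique L⊆N R⊆N N⊆ sep c
    with spare ω≤k v∈A L? L-clique L⊆N (colour c) | spare ω≤k v∈A R? R-clique R⊆N (colour c)
  ... | α , α<k , L-α | β , β<k , R-β
    with Fin.any? (λ x → L? x ×-dec (colour c x ≟ β)) | Fin.any? (λ y → R? y ×-dec (colour c y ≟ α))
  -- `R` avoids `β` by choice and here `L` does too, so `v` can take it. Symmetrically for `α`
  -- below.
  ... | no noβ | _ = extend c β<k λ u∈A uv eq → case (N⊆ u∈A uv) eq
    where
    case : ∀ {u} → L u ⊎ R u → colour c u ≢ β
    case (inj₁ u∈L) eq = noβ (_ , u∈L , eq)
    case (inj₂ u∈R) eq = R-β u∈R eq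
  ... | yes _ | no noα = extend c α<k λ u∈A uv eq → case (N⊆ u∈A uv) eq
    where
    case : ∀ {u} → L u ⊎ R u → colour c u ≢ α
    case (inj₁ u∈L) eq = L-α u∈L eq
    case (inj₂ u∈R) eq = noα (_ , u∈R , eq)
  ... | yes (x , x∈L , cx) | yes (y , y∈R , cy) = extend swapped β<k free-β
    where
    α≢β : α ≢ β
    α≢β eq = L-α x∈L (trans cx (sym eq))
    M? : U.Decidable (λ u → u ∈ (A ∖ v) × (colour c u ≡ α ⊎ colour c u ≡ β))
    M? u = (u ∈? (A ∖ v)) ×-dec ((colour c u ≟ α) ⊎-dec (colour c u ≟ β))
    M = ⟪ M? ⟫
    in∖ : ∀ {u} → u ∈ A × u ~ v → u ∈ (A ∖ v)
    in∖ (u∈A , uv) = ∈⟪⟫⁺ (without? A v) (u∈A , ~⇒≢ uv)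
    inA : ∀ {u} → u ∈ M → u ∈ A
    inA u∈M = proj₁ (∈⟪⟫⁻ (without? A v) (proj₁ (∈⟪⟫⁻ M? u∈M)))
    x∈M : x ∈ M
    x∈M = ∈⟪⟫⁺ M? (in∖ (L⊆N x∈L) , inj₂ cx)
    Z = component x∈M
    x∉R : ¬ R x
    x∉R x∈R = R-β x∈R cx
    isα : ∀ {u w} → u ∈ M → w ∈ M → u ~ w → colour c u ≡ β → colour c w ≡ α
    isα u∈M w∈M uw cu with ∈⟪⟫⁻ M? w∈M
    ... | _ , inj₁ cw = cw
    ... | w∈ , inj₂ cw = ⊥-elim (proper c (proj₁ (∈⟪⟫⁻ M? u∈M)) w∈ uw (trans cu (sym cw)))
    isβ : ∀ {u w} → u ∈ M → w ∈ M → u ~ w → colour c u ≡ α → colour c w ≡ β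
    isβ u∈M w∈M uw cu with ∈⟪⟫⁻ M? w∈M
    ... | w∈ , inj₁ cw = ⊥-elim (proper c (proj₁ (∈⟪⟫⁻ M? u∈M)) w∈ uw (trans cu (sym cw)))
    ... | _ , inj₂ cw = cw
    -- The chain is stopped at the first `α`-coloured neighbour of `v`, which need not be `y`: thus
    -- no earlier `α`-coloured vertex sees `v`.
    Target : V → Set
    Target u = u ~ v × colour c u ≡ α
    -- A `β`-coloured neighbour of `v` is not in `R`, hence lies in the clique `L` with `x`. So it
    -- is `x` or sees `x`, which an induced path excludes.
    inner : ∀ {u w} → u ∈ M → colour c u ≡ β → ¬ x ~ u → u ~ w → ¬ x ~ w → ¬ v ~ u
    inner {u} u∈M cu ¬xu uw ¬xw vu with N⊆ (inA u∈M) (~-sym vu)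
    ... | inj₂ u∈R = R-β u∈R cu
    ... | inj₁ u∈L with x Fin.≟ u
    ...   | yes refl = ¬xw uw
    ...   | no x≢u = ¬xu (L-clique x∈L u∈L x≢u)
    noT : ∀ {u} → ¬ Target u → colour c u ≡ α → ¬ v ~ u
    noT ¬t cu vu = ¬t (~-sym vu , cu)
    vx : v ~ x
    vx = ~-sym (proj₂ (L⊆N x∈L))
    x∈A = proj₁ (L⊆N x∈L)
    -- Colours alternate from `β` at `x` to `α` at the end, so the number of edges is odd. One edge
    -- contradicts `sep`; three or five close up through `v` to a C₅ or C₇.
    odd : ∀ {zs} → Path Target x zs → ¬ All (_∈ M) zs
    odd (stop (_ , cx′)) _ = α≢β (trans (sym cx′) cx)
    odd (step _ xw _ (stop (wv , cw))) (w∈M ∷ []) with N⊆ (inA w∈M) wv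
    ... | inj₁ w∈L = L-α w∈L cw
    ... | inj₂ w∈R = sep x∈L x∉R w∈R (λ w∈L → L-α w∈L cw) xw
    odd (step _ xa _ (step _ ab _ (stop (_ , cb)))) (a∈M ∷ b∈M ∷ []) =
      α≢β (trans (sym cb) (isβ a∈M b∈M ab (isα x∈M a∈M xa cx)))
    odd (step _ xa (xb ∷ xw ∷ []) (step a∉T ab (aw ∷ []) (step _ bw [] (stop (wv , _))))) (a∈M ∷ b∈M ∷ w∈M ∷ []) =
      noC₅ (v ∷ x ∷ _ ∷ _ ∷ _ ∷ []) (v∈A ∷ x∈A ∷ inA a∈M ∷ inA b∈M ∷ inA w∈M ∷ [])
        (vx ∷ noT a∉T ca ∷ inner b∈M cb xb bw xw ∷ ~-sym wv ∷ xa ∷ xb ∷ xw ∷ ab ∷ aw ∷ bw ∷ [])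
      where
      ca = isα x∈M a∈M xa cx
      cb = isβ a∈M b∈M ab ca
    odd (step _ xa _ (step _ ab _ (step _ bd _ (step _ dw _ (stop (_ , cw)))))) (a∈M ∷ b∈M ∷ d∈M ∷ w∈M ∷ []) =
      α≢β (trans (sym cw) (isβ d∈M w∈M dw (isα b∈M d∈M bd (isβ a∈M b∈M ab (isα x∈M a∈M xa cx)))))
    odd (step _ xa (xb ∷ xd ∷ xe ∷ xw ∷ []) (step a∉T ab (ad ∷ ae ∷ aw ∷ []) (step _ bd (be ∷ bw ∷ [])
          (step d∉T de (dw ∷ []) (step _ ew [] (stop (wv , _))))))) (a∈M ∷ b∈M ∷ d∈M ∷ e∈M ∷ w∈M ∷ []) =
      noC₇ (at v (x ∷ _ ∷ _ ∷ _ ∷ _ ∷ _ ∷ []))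
        (vx ∷ noT a∉T ca ∷ inner b∈M cb xb bd xd ∷ noT d∉T cd ∷ inner e∈M ce xe ew xw ∷ ~-sym wv ∷
         xa ∷ xb ∷ xd ∷ xe ∷ xw ∷ ab ∷ ad ∷ ae ∷ aw ∷ bd ∷ be ∷ bw ∷ de ∷ dw ∷ ew ∷ [])
      where
      ca = isα x∈M a∈M xa cx
      cb = isβ a∈M b∈M ab ca
      cd = isα b∈M d∈M bd cb
      ce = isβ d∈M e∈M de cd
    -- With six or more edges the first seven vertices of the path are already a P₇; neither `v` nor
    -- the parity enters.
    odd (step _ xa (xb ∷ xc ∷ xd ∷ xe ∷ xf ∷ _) (step _ ab (ac ∷ ad ∷ ae ∷ af ∷ _) (step _ bc (bd ∷ be ∷ bf ∷ _)
          (step _ cd (ce ∷ cf ∷ _) (step _ de (df ∷ _) (step _ ef _ _)))))) _ =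
      noP₇ (at x (_ ∷ _ ∷ _ ∷ _ ∷ _ ∷ _ ∷ []))
        (xa ∷ xb ∷ xc ∷ xd ∷ xe ∷ xf ∷ ab ∷ ac ∷ ad ∷ ae ∷ af ∷ bc ∷ bd ∷ be ∷ bf ∷ cd ∷ ce ∷ cf ∷ de ∷ df ∷ ef ∷ [])
    y∉Z : y ∉ vertices Z
    y∉Z y∈Z = let (_ , p , zs⊆M) = walk⇒path (λ u → (u ~? v) ×-dec (colour c u ≟ α)) (walk Z y∈Z) (proj₂ (R⊆N y∈R) , cy)
              in odd p zs⊆M
    swap : V → ℕ
    swap u with u ∈? vertices Z
    ... | yes _ = transpose α β (colour c u)
    ... | no _  = colour c u
    mixed : ∀ {u w} → u ∈ (A ∖ v) → w ∈ (A ∖ v) → u ∈ vertices Z → w ∉ vertices Z → u ~ w →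
            transpose α β (colour c u) ≢ colour c w
    -- The swapped colour of `u` is again `α` or `β`. If `w` had it, `w` would belong to the
    -- two-coloured set and, next to `u`, to `Z`.
    mixed {u} {w} u∈ w∈ u∈Z w∉Z uw eq = w∉Z (closed Z u∈Z (∈⟪⟫⁺ M? (w∈ , cw (∈⟪⟫⁻ M? (inside Z u∈Z)))) uw)
      where
      cw : u ∈ (A ∖ v) × (colour c u ≡ α ⊎ colour c u ≡ β) → colour c w ≡ α ⊎ colour c w ≡ β
      cw (_ , inj₁ cu) = inj₂ (trans (sym eq) (trans (cong (transpose α β) cu) (transpose-first α β)))
      cw (_ , inj₂ cu) = inj₁ (trans (sym eq) (trans (cong (transpose α β) cu) (transpose-second α≢β)))
    swapped : Colouring (A ∖ v) k
    swapped .colour = swap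
    swapped .bounded {u} u∈ with u ∈? vertices Z
    ... | yes _ = transpose-< α<k β<k (bounded c u∈)
    ... | no _  = bounded c u∈
    swapped .proper {u} {w} u∈ w∈ uw with u ∈? vertices Z | w ∈? vertices Z
    ... | yes _   | yes _   = proper c u∈ w∈ uw ∘ transpose-injective α β
    ... | yes u∈Z | no w∉Z  = mixed u∈ w∈ u∈Z w∉Z uw
    ... | no u∉Z  | yes w∈Z = mixed w∈ u∈ w∈Z u∉Z (~-sym uw) ∘ sym
    ... | no _    | no _    = proper c u∈ w∈ uw
    unique : ∀ {S : V → Set} {u w γ} → CliqueIn S → (∀ {u} → S u → u ∈ A × u ~ v) → S u → S w →
             colour c u ≡ γ → colour c w ≡ γ → u ≡ w
    unique {u = u} {w} S-clique S⊆N u∈S w∈S cu cw with u Fin.≟ w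
    ... | yes eq = eq
    ... | no ne  = ⊥-elim (proper c (in∖ (S⊆N u∈S)) (in∖ (S⊆N w∈S)) (S-clique u∈S w∈S ne) (trans cu (sym cw)))
    -- In `L` only `x` had `β`, and it has been swapped away. In `R` only a vertex coloured `α` in
    -- `Z` could acquire `β`; but the single `α`-vertex of `R` is `y`, outside `Z`.
    free-β : ∀ {u} → u ∈ A → u ~ v → swap u ≢ β
    free-β {u} u∈A uv eq with u ∈? vertices Z | N⊆ u∈A uv
    ... | no u∉Z  | inj₁ u∈L = u∉Z (subst (_∈ vertices Z) (unique L-clique L⊆N x∈L u∈L cx eq) (start Z))
    ... | no _    | inj₂ u∈R = R-β u∈R eq
    ... | yes u∈Z | u∈LR with ∈⟪⟫⁻ M? (inside Z u∈Z) | u∈LR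
    ...   | _ , inj₂ cu | _        = α≢β (trans (sym (transpose-second α≢β)) (trans (cong (transpose α β) (sym cu)) eq))
    ...   | _ , inj₁ cu | inj₁ u∈L = L-α u∈L cu
    ...   | _ , inj₁ cu | inj₂ u∈R = y∉Z (subst (_∈ vertices Z) (unique R-clique R⊆N u∈R y∈R cu cy) u∈Z)

-- Colouring C₅-free sets with as many colours as the clique bound.

module C₅FreeColourings (G : Graph) (free : (P 7 ∷ C 7 ∷ C 4 ∷ gem ∷ []) -Free G) where
  open Vertices G
  open Semantics G
  open Colourings G
  open Pentagons G free
  open Hexagons G free
  open KempeChains G free
  open _⊑_
  open Hexagon

  C₅Free-⊆ : ∀ {A B} → B ⊆ A → C₅Free A → C₅Free B
  C₅Free-⊆ B⊆A noC₅ Q Q⊆B = noC₅ Q (Allᵛ.map B⊆A Q⊆B)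

  module _ {A : Subset (order G)} (noC₅ : C₅Free A) {k} (ω≤k : CliquesBounded A k)
           (rec : ∀ {B} → B ⊂ A → Colouring B k) (h : Hexagon noC₅) where

    private
      h¹ = turn noC₅ h
      h² = turn noC₅ h¹
      -- Five turns amount to one turn backwards: class 5 of `h` becomes class 0 and class 1 becomes
      -- class 2.
      h⁵ = turn noC₅ (turn noC₅ (turn noC₅ h²))

      Nearʰ : Fin 6 → V → Set
      Nearʰ = Near noC₅ h

      a∈A = All.lookup (members h) (here refl)
      b∈A = All.lookup (members h) (there (here refl))
      c∈A = All.lookup (members h) (there (there (here refl)))

      a-near : Nearʰ 0F (a h)
      a-near with isC₆ h
      ... | ab ∷ _ ∷ _ ∷ _ ∷ af ∷ _ = af , ab

      b-near : Nearʰ 1F (b h)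
      b-near with isC₆ h
      ... | ab ∷ _ ∷ _ ∷ _ ∷ _ ∷ bc ∷ _ = ~-sym ab , bc

      c-near : Nearʰ 2F (c h)
      c-near with isC₆ h
      ... | _ ∷ _ ∷ _ ∷ _ ∷ _ ∷ bc ∷ _ ∷ _ ∷ _ ∷ cd ∷ _ = ~-sym bc , cd

      a≁c : ¬ a h ~ c h
      a≁c with isC₆ h
      ... | _ ∷ ac ∷ _ = ac

      a≢c : a h ≢ c h
      a≢c eq with isC₆ h
      ... | _ ∷ _ ∷ ad ∷ _ ∷ _ ∷ _ ∷ _ ∷ _ ∷ _ ∷ cd ∷ _ = ad (subst (_~ d h) (sym eq) cd)

      turn⁵ : ∀ {o} → Outside noC₅ h o → Outside noC₅ h⁵ o
      turn⁵ = turnˣ {h = turn noC₅ (turn noC₅ h²)} ∘ turnˣ {h = turn noC₅ h²} ∘ turnˣ {h = h²} ∘ turnˣ {h = h¹} ∘ turnˣ {h = h}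
        where
        turnˣ : ∀ {h o} → Outside noC₅ h o → Outside noC₅ (turn noC₅ h) o
        turnˣ = outside-turn noC₅

    -- No outside vertex sees `b`, and vertices of classes 3, 4 and 5 do not either, because `b` is
    -- in class 1. Its neighbours thus lie in classes 0, 1 and 2, of which consecutive ones form
    -- cliques. Class 1 belongs to both cliques, so `sep` only concerns classes 0 and 2.
    bisimplicial : ¬ (∃ λ u → u ∈ A × Outside noC₅ h u × u ~ b h) → Colouring A k
    bisimplicial none = kempe {L = L} {R} noC₅ ω≤k b∈A L? R? L-clique R-clique proj₁ proj₁ cover sep (rec (∖-⊂ b∈A))
      where
      L R : V → Set
      L u = (u ∈ A × u ~ b h) × (Nearʰ 0F u ⊎ Nearʰ 1F u)
      R u = (u ∈ A × u ~ b h) × (Nearʰ 1F u ⊎ Nearʰ 2F u)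
      N? : U.Decidable (λ u → u ∈ A × u ~ b h)
      N? u = (u ∈? A) ×-dec (u ~? b h)
      L? : U.Decidable L
      L? u = N? u ×-dec (near? noC₅ h 0F u ⊎-dec near? noC₅ h 1F u)
      R? : U.Decidable R
      R? u = N? u ×-dec (near? noC₅ h 1F u ⊎-dec near? noC₅ h 2F u)
      L-clique : CliqueIn L
      L-clique ((u∈A , _) , inj₁ u₀) ((w∈A , _) , inj₁ w₀) = near₀₀ noC₅ h u∈A w∈A u₀ w₀
      L-clique ((u∈A , _) , inj₁ u₀) ((w∈A , _) , inj₂ w₁) _ = near₀₁ noC₅ h u∈A w∈A u₀ w₁
      L-clique ((u∈A , _) , inj₂ u₁) ((w∈A , _) , inj₁ w₀) _ = ~-sym (near₀₁ noC₅ h w∈A u∈A w₀ u₁)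
      L-clique ((u∈A , _) , inj₂ u₁) ((w∈A , _) , inj₂ w₁) = near₀₀ noC₅ h¹ u∈A w∈A u₁ w₁
      R-clique : CliqueIn R
      R-clique ((u∈A , _) , inj₁ u₁) ((w∈A , _) , inj₁ w₁) = near₀₀ noC₅ h¹ u∈A w∈A u₁ w₁
      R-clique ((u∈A , _) , inj₁ u₁) ((w∈A , _) , inj₂ w₂) _ = near₀₁ noC₅ h¹ u∈A w∈A u₁ w₂
      R-clique ((u∈A , _) , inj₂ u₂) ((w∈A , _) , inj₁ w₁) _ = ~-sym (near₀₁ noC₅ h¹ w∈A u∈A w₁ u₂)
      R-clique ((u∈A , _) , inj₂ u₂) ((w∈A , _) , inj₂ w₂) = near₀₀ noC₅ h² u∈A w∈A u₂ w₂
      cover : ∀ {u} → u ∈ A → u ~ b h → L u ⊎ R u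
      cover {u} u∈A ub with Fin.any? (λ i → near? noC₅ h i u)
      ... | no out = ⊥-elim (none (u , u∈A , out , ub))
      ... | yes (0F , n) = inj₁ ((u∈A , ub) , inj₁ n)
      ... | yes (1F , n) = inj₁ ((u∈A , ub) , inj₂ n)
      ... | yes (2F , n) = inj₂ ((u∈A , ub) , inj₂ n)
      ... | yes (3F , n) = ⊥-elim (near₀₂ noC₅ h¹ b∈A u∈A b-near n (~-sym ub))
      ... | yes (4F , n) = ⊥-elim (near₀₃ noC₅ h¹ b∈A u∈A b-near n (~-sym ub))
      ... | yes (5F , n) = ⊥-elim (near₀₂ noC₅ h⁵ u∈A b∈A n b-near ub)
      sep : ∀ {u w} → L u → ¬ R u → R w → ¬ L w → ¬ u ~ w
      sep (u∈ , inj₂ n) u∉R _ _ _ = u∉R (u∈ , inj₁ n)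
      sep (_ , inj₁ _) _ (w∈ , inj₁ n) w∉L _ = w∉L (w∈ , inj₂ n)
      sep ((u∈A , _) , inj₁ u₀) _ ((w∈A , _) , inj₂ w₂) _ = near₀₂ noC₅ h u∈A w∈A u₀ w₂

    -- Without a bridge, all of the component `Z` of `u` sees `b`, and every border vertex of `Z` is
    -- already a neighbour of `u`. The border therefore lies in classes 0 to 2 and does not meet
    -- both 0 and 2, so it is a clique cutset.
    outsider : ¬ Bridge noC₅ h → (∃ λ u → u ∈ A × Outside noC₅ h u × u ~ b h) → Colouring A k
    outsider ¬bridge (u , u∈A , u-out , ub) = cut (border? A (vertices Z) (a h))
      where
      M? : U.Decidable (λ w → w ∈ A × Outside noC₅ h w)
      M? w = (w ∈? A) ×-dec outside? noC₅ h w
      M = ⟪ M? ⟫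
      Z = component (∈⟪⟫⁺ M? (u∈A , u-out))
      classify : ∀ {o x} → o ∈ A → Outside noC₅ h o → o ~ b h → x ∈ A → o ~ x → (∃ λ i → Nearʰ i x) →
                 Nearʰ 0F x ⊎ Nearʰ 1F x ⊎ Nearʰ 2F x
      classify _ _ _ _ _ (0F , n) = inj₁ n
      classify _ _ _ _ _ (1F , n) = inj₂ (inj₁ n)
      classify _ _ _ _ _ (2F , n) = inj₂ (inj₂ n)
      classify o∈A out ob x∈A ox (3F , n) =
        ⊥-elim (attach₀₂ noC₅ h¹ b∈A x∈A o∈A (outside-turn noC₅ {h = h} out) b-near n ob ox)
      classify o∈A out ob x∈A ox (4F , n) =
        ⊥-elim (attach₀₃ noC₅ h¹ b∈A x∈A o∈A (outside-turn noC₅ {h = h} out) b-near n ob ox)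
      classify o∈A out ob x∈A ox (5F , n) =
        ⊥-elim (attach₀₂ noC₅ h⁵ x∈A b∈A o∈A (turn⁵ out) n b-near ox ob)
      pull : ∀ {y z x} → y ∈ M → z ∈ M → y ~ z → y ~ b h → z ~ b h → x ∈ A → (∃ λ i → Nearʰ i x) → y ~ x → z ~ x
      pull y∈M z∈M yz yb zb x∈A near yx with ∈⟪⟫⁻ M? y∈M | ∈⟪⟫⁻ M? z∈M
      ... | y∈A , y-out | z∈A , z-out with classify y∈A y-out yb x∈A yx near
      ...   | inj₁ n        = share₀ noC₅ h y∈A z∈A y-out z-out yz x∈A yb zb yx n
      ...   | inj₂ (inj₁ n) = share₁ noC₅ h y∈A z∈A y-out z-out yz x∈A yb zb yx n
      ...   | inj₂ (inj₂ n) = share₂ noC₅ h y∈A z∈A y-out z-out yz x∈A yb zb yx n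
      -- Adjacency to `b` is carried forwards along the walk by `spread`, adjacency to a near vertex
      -- backwards by `pull`.
      along : ∀ {z w} → Star (Step M) z w → z ~ b h →
              w ~ b h × (∀ {x} → x ∈ A → (∃ λ i → Nearʰ i x) → w ~ x → z ~ x)
      along ε zb = zb , λ _ _ wx → wx
      along {z} (_◅_ {j = y} (z∈M , y∈M , zy) rest) zb =
        let (wb , back) = along rest yb
        in wb , λ x∈A near wx → pull y∈M z∈M (~-sym zy) yb zb x∈A near (back x∈A near wx)
        where
        yb : y ~ b h
        yb with ∈⟪⟫⁻ M? z∈M | ∈⟪⟫⁻ M? y∈M
        ... | z∈A , z-out | y∈A , y-out = decidable-stable (y ~? b h) λ ¬yb →
          ¬bridge (z , y , (z∈A , z-out) , (y∈A , y-out) , zy , zb , spread noC₅ h z∈A y∈A z-out y-out zy zb ¬yb)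
      attached : ∀ {s} → Border A (vertices Z) s → u ~ s × (Nearʰ 0F s ⊎ Nearʰ 1F s ⊎ Nearʰ 2F s)
      attached {s} (s∈A , s∉Z , z , z∈Z , sz) with Fin.any? (λ i → near? noC₅ h i s)
      ... | no out = ⊥-elim (s∉Z (closed Z z∈Z (∈⟪⟫⁺ M? (s∈A , out)) (~-sym sz)))
      ... | yes near = us , classify u∈A u-out ub s∈A us near
        where us = proj₂ (along (walk Z z∈Z) ub) s∈A near (~-sym sz)
      clique : CliqueIn (Border A (vertices Z))
      clique {s} {t} s∈ t∈ s≢t with attached s∈ | attached t∈
      ... | us , inj₁ s₀        | ut , inj₁ t₀        = near₀₀ noC₅ h (proj₁ s∈) (proj₁ t∈) s₀ t₀ s≢t
      ... | us , inj₁ s₀        | ut , inj₂ (inj₁ t₁) = near₀₁ noC₅ h (proj₁ s∈) (proj₁ t∈) s₀ t₁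
      ... | us , inj₁ s₀        | ut , inj₂ (inj₂ t₂) = ⊥-elim (attach₀₂ noC₅ h (proj₁ s∈) (proj₁ t∈) u∈A u-out s₀ t₂ us ut)
      ... | us , inj₂ (inj₁ s₁) | ut , inj₁ t₀        = ~-sym (near₀₁ noC₅ h (proj₁ t∈) (proj₁ s∈) t₀ s₁)
      ... | us , inj₂ (inj₁ s₁) | ut , inj₂ (inj₁ t₁) = near₀₀ noC₅ h¹ (proj₁ s∈) (proj₁ t∈) s₁ t₁ s≢t
      ... | us , inj₂ (inj₁ s₁) | ut , inj₂ (inj₂ t₂) = near₀₁ noC₅ h¹ (proj₁ s∈) (proj₁ t∈) s₁ t₂
      ... | us , inj₂ (inj₂ s₂) | ut , inj₁ t₀        = ⊥-elim (attach₀₂ noC₅ h (proj₁ t∈) (proj₁ s∈) u∈A u-out t₀ s₂ ut us)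
      ... | us , inj₂ (inj₂ s₂) | ut , inj₂ (inj₁ t₁) = ~-sym (near₀₁ noC₅ h¹ (proj₁ t∈) (proj₁ s∈) t₁ s₂)
      ... | us , inj₂ (inj₂ s₂) | ut , inj₂ (inj₂ t₂) = near₀₀ noC₅ h² (proj₁ s∈) (proj₁ t∈) s₂ t₂ s≢t
      near∉Z : ∀ i {x} → Nearʰ i x → x ∉ vertices Z
      near∉Z i n x∈Z = proj₂ (∈⟪⟫⁻ M? (inside Z x∈Z)) (i , n)
      Z⊆A : vertices Z ⊆ A
      Z⊆A z∈Z = proj₁ (∈⟪⟫⁻ M? (inside Z z∈Z))
      -- As `a` and `c` are not adjacent, the border misses one of them. Being near, that vertex is
      -- not in `Z` either, so it witnesses a proper separation.
      cut : Dec (Border A (vertices Z) (a h)) → Colouring A k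
      cut (no a∉S) = cutset Z⊆A (start Z) clique a∈A (near∉Z 0F a-near) a∉S rec
      cut (yes a∈S) = cutset Z⊆A (start Z) clique c∈A (near∉Z 2F c-near)
        (λ c∈S → a≁c (clique a∈S c∈S a≢c)) rec

  -- With `v` and `t` the path closes to a cycle. One, two or four inner vertices give a C₄, C₅ or
  -- C₇; five or more give a P₇ starting at `v`. Only three remain, the C₆.
  hole : ∀ {A v s t zs} (noC₅ : C₅Free A) → v ∈ A → s ∈ A → t ∈ A → v ~ s → v ~ t → s ≢ t → ¬ s ~ t →
         Path (_~ t) s zs → All (λ z → z ∈ A × z ≢ v × ¬ v ~ z) zs → Hexagon noC₅
  hole noC₅ _ _ _ _ _ _ s≁t (stop st) _ = ⊥-elim (s≁t st)
  hole {v = v} {s} {t} noC₅ _ _ _ vs vt s≢t s≁t (step {y = x} _ sx _ (stop xt)) ((_ , x≢v , v≁x) ∷ []) =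
    ⊥-elim (contradict (0 ≠ 2 ∷ 1 ≠ 3 ∷ diagram (C 4)) (c₄ 0x3210) tt (at v (s ∷ x ∷ t ∷ []))
      (x≢v ∘ sym ∷ s≢t ∷ vs ∷ v≁x ∷ vt ∷ sx ∷ s≁t ∷ xt ∷ []))
  hole noC₅ v∈A s∈A t∈A vs vt _ s≁t (step _ sx (sy ∷ []) (step x≁t xy [] (stop yt)))
       ((x∈A , _ , vx) ∷ (y∈A , _ , vy) ∷ []) =
    ⊥-elim (noC₅ (_ ∷ _ ∷ _ ∷ _ ∷ _ ∷ []) (v∈A ∷ s∈A ∷ x∈A ∷ y∈A ∷ t∈A ∷ [])
      (vs ∷ vx ∷ vy ∷ vt ∷ sx ∷ sy ∷ s≁t ∷ xy ∷ x≁t ∷ yt ∷ []))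
  hole {v = v} {s} {t} noC₅ v∈A s∈A t∈A vs vt _ s≁t
       (step {y = x} _ sx (sy ∷ sz ∷ []) (step {y = y} x≁t xy (xz ∷ []) (step {y = z} y≁t yz [] (stop zt))))
       ((x∈A , _ , vx) ∷ (y∈A , _ , vy) ∷ (z∈A , _ , vz) ∷ []) = record
    { a = v ; b = s ; c = x ; d = y ; e = z ; f = t ; members = v∈A ∷ s∈A ∷ x∈A ∷ y∈A ∷ z∈A ∷ t∈A ∷ []
    ; isC₆ = vs ∷ vx ∷ vy ∷ vz ∷ vt ∷ sx ∷ sy ∷ sz ∷ s≁t ∷ xy ∷ xz ∷ x≁t ∷ yz ∷ y≁t ∷ zt ∷ [] }
  hole {v = v} noC₅ _ _ _ vs vt _ s≁t
       (step {x = s} {w} s∉ sw (sx ∷ sy ∷ sz ∷ []) (step {y = x} w≁t wx (wy ∷ wz ∷ []) (step {y = y} x≁t xy (xz ∷ [])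
         (step {y = z} y≁t yz [] (stop zt)))))
       ((_ , _ , vw) ∷ (_ , _ , vx) ∷ (_ , _ , vy) ∷ (_ , _ , vz) ∷ []) =
    ⊥-elim (noC₇ (at v (s ∷ w ∷ x ∷ y ∷ z ∷ _ ∷ []))
      (vs ∷ vw ∷ vx ∷ vy ∷ vz ∷ vt ∷ sw ∷ sx ∷ sy ∷ sz ∷ s≁t ∷ wx ∷ wy ∷ wz ∷ w≁t ∷ xy ∷ xz ∷ x≁t ∷ yz ∷ y≁t ∷ zt ∷ []))
  hole {v = v} noC₅ _ _ _ vs _ _ _
       (step {x = s} {w} _ sw (sx ∷ sy ∷ sz ∷ sq ∷ _) (step {y = x} _ wx (wy ∷ wz ∷ wq ∷ _) (step {y = y} _ xy (xz ∷ xq ∷ _)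
         (step {y = z} _ yz (yq ∷ _) (step {y = q} _ zq _ _)))))
       ((_ , _ , vw) ∷ (_ , _ , vx) ∷ (_ , _ , vy) ∷ (_ , _ , vz) ∷ (_ , _ , vq) ∷ _) =
    ⊥-elim (noP₇ (at v (s ∷ w ∷ x ∷ y ∷ z ∷ q ∷ []))
      (vs ∷ vw ∷ vx ∷ vy ∷ vz ∷ vq ∷ sw ∷ sx ∷ sy ∷ sz ∷ sq ∷ wx ∷ wy ∷ wz ∷ wq ∷ xy ∷ xz ∷ xq ∷ yz ∷ yq ∷ zq ∷ []))

  weaken : ∀ {A k l} → k ≤ l → Colouring A k → Colouring A l
  weaken k≤l c = record { colour = colour c ; bounded = λ u∈A → ℕ.<-≤-trans (bounded c u∈A) k≤l ; proper = proper c }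

  -- The induction is on vertex subsets of a fixed graph, so the excluded subgraphs need no transfer
  -- to smaller graphs.
  perfect : ∀ {A} → Acc _⊂_ A → C₅Free A → ∀ {k} → CliquesBounded A k → Colouring A k
  perfect {A} (acc smaller) noC₅ {k} ω≤k with Fin.any? (_∈? A)
  ... | no empty = record { colour = λ _ → 0 ; bounded = λ u∈A → ⊥-elim (empty (_ , u∈A))
                          ; proper = λ u∈A → ⊥-elim (empty (_ , u∈A)) }
  ... | yes (v , v∈A) with Fin.any? (λ x → (x ∈? A) ×-dec ¬? (x Fin.≟ v) ×-dec ¬? (v ~? x))
  ...   | no universal = dominated ω≤k
    where
    adjacent : ∀ {u} → u ∈ (A ∖ v) → v ~ u
    adjacent {u} u∈ = let (u∈A , u≢v) = ∈⟪⟫⁻ (without? A v) u∈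
                      in decidable-stable (v ~? u) λ ¬vu → universal (u , u∈A , u≢v , ¬vu)
    dominated : ∀ {k} → CliquesBounded A k → Colouring A k
    dominated {zero} ω≤0 with ω≤0 (v ∷ []) (v∈A ∷ []) ([] ∷ [])
    ... | ()
    -- All of the rest sees `v`, so its cliques have at most `k` vertices. It uses the colours below
    -- `k`, and `v` gets `k` itself.
    dominated {suc k} ω≤1+k = extend (weaken (ℕ.n≤1+n k) rest) ℕ.≤-refl
      λ {u} u∈A uv → ℕ.<⇒≢ (bounded rest (∈⟪⟫⁺ (without? A v) (u∈A , ~⇒≢ uv)))
      where
      rest : Colouring (A ∖ v) k
      rest = perfect (smaller (∖-⊂ v∈A)) (C₅Free-⊆ (proj₁ (∖-⊂ v∈A)) noC₅) λ K K⊆ K-clique →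
        ℕ.≤-pred (ω≤1+k (v ∷ K) (v∈A ∷ All.map (proj₁ (∖-⊂ v∈A)) K⊆) (All.map adjacent K⊆ ∷ K-clique))
  ...   | yes (x , x∈A , x≢v , v≁x) = separate
    where
    M? : U.Decidable (λ u → u ∈ A × u ≢ v × ¬ v ~ u)
    M? u = (u ∈? A) ×-dec ¬? (u Fin.≟ v) ×-dec ¬? (v ~? u)
    M = ⟪ M? ⟫
    Z = component (∈⟪⟫⁺ M? (x∈A , x≢v , v≁x))
    S = Border A (vertices Z)
    rec : ∀ {B} → B ⊂ A → Colouring B k
    rec B⊂A = perfect (smaller B⊂A) (C₅Free-⊆ (proj₁ B⊂A) noC₅) (bounded-⊆ (proj₁ B⊂A) ω≤k)
    v∉Z : v ∉ vertices Z
    v∉Z v∈Z = proj₁ (proj₂ (∈⟪⟫⁻ M? (inside Z v∈Z))) refl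
    S⇒~ : ∀ {s} → S s → v ~ s
    S⇒~ {s} (s∈A , s∉Z , z , z∈Z , sz) = decidable-stable (v ~? s) λ ¬vs →
      s∉Z (closed Z z∈Z (∈⟪⟫⁺ M? (s∈A , s≢v , ¬vs)) (~-sym sz))
      where
      s≢v : s ≢ v
      s≢v refl = proj₂ (proj₂ (∈⟪⟫⁻ M? (inside Z z∈Z))) sz
    hexagon : (∃₂ λ s t → S s × S t × s ≢ t × ¬ s ~ t) → Hexagon noC₅
    hexagon (s , t , s∈S@(s∈A , _ , y , y∈Z , sy) , t∈S@(t∈A , _ , z , z∈Z , tz) , s≢t , s≁t) =
      -- The walk leads inside `Z` from `y` back to the starting vertex and on to `z`; `s` is put in
      -- front of the path extracted from it.
      let (_ , p , ⊆M) = walk⇒path (_~? t) (walk-sym (walk Z y∈Z) ◅◅ walk Z z∈Z) (~-sym tz)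
          (_ , q , ⊆M′) = prepend (_~? t) s≁t (here sy) p (inside Z y∈Z ∷ ⊆M)
      in hole noC₅ v∈A s∈A t∈A (S⇒~ s∈S) (S⇒~ t∈S) s≢t s≁t q (All.map (∈⟪⟫⁻ M?) ⊆M′)
    hexagonal : Hexagon noC₅ → Colouring A k
    hexagonal h₀ with unbridged noC₅ h₀
    ... | h , ¬bridge with Fin.any? (λ u → (u ∈? A) ×-dec outside? noC₅ h u ×-dec (u ~? b h))
    ...   | yes out = outsider noC₅ ω≤k rec h ¬bridge out
    ...   | no none = bisimplicial noC₅ ω≤k rec h none
    separate : Colouring A k
    separate with Fin.any? (λ s → Fin.any? λ t → border? A (vertices Z) s ×-dec border? A (vertices Z) t ×-dec
                    ¬? (s Fin.≟ t) ×-dec ¬? (s ~? t))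
    ... | yes st = hexagonal (hexagon st)
    ... | no clique = cutset (λ z∈Z → proj₁ (∈⟪⟫⁻ M? (inside Z z∈Z))) (start Z)
      (λ {s} {t} s∈S t∈S s≢t → decidable-stable (s ~? t) λ ¬st → clique (s , t , s∈S , t∈S , s≢t , ¬st))
      v∈A v∉Z (λ v∈S → irrefl G (S⇒~ v∈S)) rec

-- A vertex dominating all C₅s, and the bound on χ.

cardinality-insert : ∀ {n} (x : Fin n) (S : Subset n) → x ∉ S → ∣ ⁅ x ⁆ ∪ S ∣ ≡ suc ∣ S ∣
cardinality-insert zero    (true  ∷ S) x∉ = ⊥-elim (x∉ here)
cardinality-insert zero    (false ∷ S) x∉ = cong (suc ∘ ∣_∣) (∪-identityˡ S)
cardinality-insert (suc x) (true  ∷ S) x∉ = cong suc (cardinality-insert x S (x∉ ∘ there))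
cardinality-insert (suc x) (false ∷ S) x∉ = cardinality-insert x S (x∉ ∘ there)

allVecs : ∀ n m → List (Vec (Fin n) m)
allVecs n zero = [] ∷ []
allVecs n (suc m) = cartesianProductWith _∷_ (allFin n) (allVecs n m)

∈-allVecs : ∀ {n m} (Q : Vec (Fin n) m) → Q ∈ˡ allVecs n m
∈-allVecs [] = here refl
∈-allVecs (x ∷ Q) = ∈-cartesianProductWith⁺ _∷_ (∈-allFin x) (∈-allVecs Q)

module ChromaticBound (G : Graph) (free : (P 7 ∷ C 7 ∷ C 4 ∷ gem ∷ []) -Free G) where
  open Vertices G
  open Semantics G
  open Colourings G
  open Pentagons G free
  open Hexagons G free
  open KempeChains G free
  open C₅FreeColourings G free

  conflict : ∀ {m} {X : V → Set} {Q : Vec V m} → Allᵛ (λ u → ¬ X u) Q → ¬ Anyᵛ X Q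
  conflict (n ∷ _) (here x) = n x
  conflict (_ ∷ ns) (there x) = conflict ns x

  pick : ∀ {m} {X : V → Set} {Q : Vec V m} {u} → Allᵛ X Q → Anyᵛ (_≡ u) Q → X u
  pick (x ∷ _) (here refl) = x
  pick (_ ∷ xs) (there i) = pick xs i

  module _ {A : Subset (order G)} where

    good? : U.Decidable (λ Q → IsC₅ Q × Allᵛ (_∈ A) Q)
    good? Q = isC₅? Q ×-dec Allᵛ.all? (_∈? A) Q

    pentagons : List (Vec V 5)
    pentagons = filter good? (allVecs (order G) 5)

    -- `v` is chosen maximal over the finite list of C₅s in `A`. For an undominated one,
    -- `distanceTwo` and `dominator` produce a vertex of `A` that dominates strictly more.
    dominating : ∀ {v₀} → v₀ ∈ A → (∀ {u w} → u ∈ A → w ∈ A → Star (Step A) u w) →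
                 ∃ λ v → v ∈ A × ∀ Q → Allᵛ (_∈ A) Q → IsC₅ Q → Dominates v Q
    dominating {v₀} v₀∈A connected with maximal dominates? pentagons (_∈? A) (v₀ , v₀∈A)
    ... | v , v∈A , max = v , v∈A , λ Q Q⊆A q → decidable-stable (dominates? v Q) (absurd Q Q⊆A q)
      where
      absurd : ∀ Q → Allᵛ (_∈ A) Q → IsC₅ Q → ¬ ¬ Dominates v Q
      absurd (x ∷ y ∷ Q) (x∈A ∷ Q⊆A) q ¬vQ =
        -- Being on the C₅, `x` dominates it through its neighbour `y`, so the path has a target.
        let (_ , path , path⊆A) = walk⇒path (λ u → dominates? u (x ∷ y ∷ Q)) (connected v∈A x∈A) (there (here (first q)))
            (p , R , r , R⊆A , ¬vR , vp , pR) = distanceTwo q (x∈A ∷ Q⊆A) path path⊆A ¬vQ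
            (u , u∈R , uR , v≼u) = dominator vp r ¬vR pR pentagons (All.map proj₁ (all-filter good? (allVecs (order G) 5)))
        in ¬vR (All.lookup (max u (pick R⊆A u∈R) v≼u) (∈-filter⁺ good? (∈-allVecs R) (r , R⊆A)) uR)
        where
        first : ∀ {x y Q} → IsC₅ (x ∷ y ∷ Q) → x ~ y
        first {Q = _ ∷ _ ∷ _ ∷ []} (xy ∷ _) = xy

  colour-all : ∀ {A} → Acc _⊂_ A → ∀ {k} → CliquesBounded A (suc k) → Colouring A (suc k + k)
  colour-all {A} (acc smaller) {k} ω≤1+k with Fin.any? (_∈? A)
  ... | no empty = record { colour = λ _ → 0 ; bounded = λ u∈A → ⊥-elim (empty (_ , u∈A))
                          ; proper = λ u∈A → ⊥-elim (empty (_ , u∈A)) }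
  ... | yes (v₀ , v₀∈A) with Fin.any? (λ w → (w ∈? A) ×-dec ¬? (w ∈? vertices (component v₀∈A)))
  -- `A` is disconnected: a full component has empty border, which is trivially a clique cutset.
  ...   | yes (w , w∈A , w∉Z) = cutset (inside Z) (start Z) (λ s∈S → ⊥-elim (noBorder s∈S)) w∈A w∉Z noBorder
      (λ B⊂A → colour-all (smaller B⊂A) (bounded-⊆ (proj₁ B⊂A) ω≤1+k))
    where
    Z = component v₀∈A
    noBorder : ∀ {s} → ¬ Border A (vertices Z) s
    noBorder (s∈A , s∉Z , _ , z∈Z , sz) = s∉Z (closed Z z∈Z s∈A (~-sym sz))
  ...   | no connected = split (dominating v₀∈A λ u∈A w∈A → walk-sym (walk Z (inZ u∈A)) ◅◅ walk Z (inZ w∈A))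
    where
    Z = component v₀∈A
    inZ : ∀ {u} → u ∈ A → u ∈ vertices Z
    inZ {u} u∈A = decidable-stable (u ∈? vertices Z) λ u∉Z → connected (u , u∈A , u∉Z)
    split : (∃ λ v → v ∈ A × ∀ Q → Allᵛ (_∈ A) Q → IsC₅ Q → Dominates v Q) → Colouring A (suc k + k)
    split (v , v∈A , dom) = record { colour = c ; bounded = c-bounded ; proper = c-proper }
      where
      N? : U.Decidable (λ u → u ∈ A × v ~ u)
      N? u = (u ∈? A) ×-dec (v ~? u)
      F? : U.Decidable (λ u → u ∈ A × ¬ v ~ u)
      F? u = (u ∈? A) ×-dec ¬? (v ~? u)
      N-free : C₅Free ⟪ N? ⟫
      -- Four consecutive vertices of the C₅ form a P₄, and `v` would be the hub of a gem.
      N-free (a ∷ b ∷ c ∷ d ∷ e ∷ []) (a∈ ∷ b∈ ∷ c∈ ∷ d∈ ∷ _) (ab ∷ ac ∷ ad ∷ _ ∷ bc ∷ bd ∷ _ ∷ cd ∷ _) =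
        contradict (diagram gem) (fan 0x43210) tt (at v (a ∷ b ∷ c ∷ d ∷ []))
          (adjacent a∈ ∷ adjacent b∈ ∷ adjacent c∈ ∷ adjacent d∈ ∷ ab ∷ ac ∷ ad ∷ bc ∷ bd ∷ cd ∷ [])
        where
        adjacent : ∀ {u} → u ∈ ⟪ N? ⟫ → v ~ u
        adjacent u∈ = proj₂ (∈⟪⟫⁻ N? u∈)
      F-free : C₅Free ⟪ F? ⟫
      F-free Q Q⊆F q = conflict (Allᵛ.map (λ u∈ → proj₂ (∈⟪⟫⁻ F? u∈)) Q⊆F)
        (dom Q (Allᵛ.map (λ u∈ → proj₁ (∈⟪⟫⁻ F? u∈)) Q⊆F) q)
      near : Colouring ⟪ N? ⟫ k
      near = perfect (⊂-wellFounded _) N-free λ K K⊆N K-clique → ℕ.≤-pred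
        (ω≤1+k (v ∷ K) (v∈A ∷ All.map (λ u∈ → proj₁ (∈⟪⟫⁻ N? u∈)) K⊆N) (All.map (λ u∈ → proj₂ (∈⟪⟫⁻ N? u∈)) K⊆N ∷ K-clique))
      far : Colouring ⟪ F? ⟫ (suc k)
      far = perfect (⊂-wellFounded _) F-free (bounded-⊆ (λ u∈ → proj₁ (∈⟪⟫⁻ F? u∈)) ω≤1+k)
      -- The palettes are disjoint: non-neighbours of `v`, and `v` itself, use colours up to `k`;
      -- neighbours use the `k` colours from `suc k` on.
      c : V → ℕ
      c u with v ~? u
      ... | yes _ = suc k + colour near u
      ... | no _  = colour far u
      c-bounded : ∀ {u} → u ∈ A → c u < suc k + k
      c-bounded {u} u∈A with v ~? u
      ... | yes vu = ℕ.+-monoʳ-< (suc k) (bounded near (∈⟪⟫⁺ N? (u∈A , vu)))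
      ... | no ¬vu = ℕ.<-≤-trans (bounded far (∈⟪⟫⁺ F? (u∈A , ¬vu))) (ℕ.m≤m+n (suc k) k)
      low≢high : ∀ {u x} → u ∈ A → ¬ v ~ u → colour far u ≢ suc k + x
      low≢high u∈A ¬vu = ℕ.<⇒≢ (ℕ.<-≤-trans (bounded far (∈⟪⟫⁺ F? (u∈A , ¬vu))) (ℕ.m≤m+n (suc k) _))
      c-proper : ∀ {u w} → u ∈ A → w ∈ A → u ~ w → c u ≢ c w
      c-proper {u} {w} u∈A w∈A uw with v ~? u | v ~? w
      ... | yes vu | yes vw = proper near (∈⟪⟫⁺ N? (u∈A , vu)) (∈⟪⟫⁺ N? (w∈A , vw)) uw ∘ ℕ.+-cancelˡ-≡ (suc k) _ _
      ... | yes _  | no ¬vw = low≢high w∈A ¬vw ∘ sym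
      ... | no ¬vu | yes _  = low≢high u∈A ¬vu
      ... | no ¬vu | no ¬vw = proper far (∈⟪⟫⁺ F? (u∈A , ¬vu)) (∈⟪⟫⁺ F? (w∈A , ¬vw)) uw

  -- Translates list cliques into the subsets by which `ω` is defined; irreflexivity guarantees that
  -- each new entry enlarges the subset.
  clique-subset : ∀ {K} → AllPairs _~_ K → ∃ λ S → (∀ {u} → u ∈ S → u ∈ˡ K) × IsClique G S × ∣ S ∣ ≡ length K
  clique-subset [] = ∅ , (λ u∈∅ → ⊥-elim (∉⊥ u∈∅)) , (λ _ _ u∈∅ → ⊥-elim (∉⊥ u∈∅)) , ∣⊥∣≡0 (order G)
  clique-subset {x ∷ K} (xK ∷ K-clique) with clique-subset K-clique
  ... | S , S⊆K , S-clique , size = ⁅ x ⁆ ∪ S , ⊆xK , clique , trans (cardinality-insert x S x∉S) (cong suc size)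
    where
    x∉S : x ∉ S
    x∉S x∈S = irrefl G (All.lookup xK (S⊆K x∈S))
    cases : ∀ {u} → u ∈ ⁅ x ⁆ ∪ S → u ≡ x ⊎ u ∈ S
    cases u∈ with x∈p∪q⁻ ⁅ x ⁆ S u∈
    ... | inj₁ u∈x = inj₁ (x∈⁅y⁆⇒x≡y x u∈x)
    ... | inj₂ u∈S = inj₂ u∈S
    ⊆xK : ∀ {u} → u ∈ ⁅ x ⁆ ∪ S → u ∈ˡ x ∷ K
    ⊆xK u∈ with cases u∈
    ... | inj₁ refl = here refl
    ... | inj₂ u∈S = there (S⊆K u∈S)
    clique : IsClique G (⁅ x ⁆ ∪ S)
    clique u w u∈ w∈ u≢w with cases u∈ | cases w∈
    ... | inj₁ refl | inj₁ refl = ⊥-elim (u≢w refl)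
    ... | inj₁ refl | inj₂ w∈S  = All.lookup xK (S⊆K w∈S)
    ... | inj₂ u∈S  | inj₁ refl = ~-sym (All.lookup xK (S⊆K u∈S))
    ... | inj₂ u∈S  | inj₂ w∈S  = S-clique u w u∈S w∈S u≢w

  ω-bounds : CliquesBounded Subset.⊤ (ω G)
  ω-bounds K _ K-clique = let (S , _ , clique , size) = clique-subset K-clique
                          in proj₂ (proj₂ (cliqueNumber G)) (length K) (S , clique , size)

  χ-bound : ∀ {k} → Colouring Subset.⊤ k → χ G ≤ k
  χ-bound {k} c = proj₂ (proj₂ (chromaticNumber G)) k
    ( (λ v → fromℕ< (bounded c (∈⊤ {x = v})))
    , λ u v uv eq → proper c ∈⊤ ∈⊤ uv (Fin.fromℕ<-injective _ _ _ _ eq) )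

  bound : ∀ w → 1 ≤ w → CliquesBounded Subset.⊤ w → χ G ≤ 2 * w ∸ 1
  bound (suc k) _ ω≤ = subst (χ G ≤_) (sym (arithmetic k)) (χ-bound (colour-all (⊂-wellFounded _) ω≤))
    where
    -- The left side is what `2 * suc k ∸ 1` computes to.
    arithmetic : ∀ k → k + (suc k + 0) ≡ suc k + k
    arithmetic = solve-∀

theorem4p7 : (G : Graph) → 1 ≤ order G →
    (P 7 ∷ C 7 ∷ C 4 ∷ gem ∷ []) -Free G →
    χ G ≤ 2 * ω G ∸ 1
theorem4p7 G 1≤n free = bound (ω G) (ω-bounds (fromℕ< 1≤n ∷ []) (∈⊤ ∷ []) ([] ∷ [])) ω-bounds
  where open ChromaticBound G free
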